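{- There is an absolute constant $c>0$ such that the following holds for all reals $\lambda\geq 1$ and $d>0$. Let $G$ be a graph in which $d\leq d_G(v)\leq \lambda d$ for each $v\in V(G)$. Then, for some $d'\geq cd/\lambda^3$, $G$ contains a subgraph $H$ with average degree $d'$ and maximum degree at most $d'+10^8$ such that $|H|\geq c|G|/\lambda^{10}$.
   Context: All graphs are finite and simple with non-empty vertex sets. $|G|$ denotes the number of vertices of $G$ and $d_G(v)$ the degree of $v$ in $G$.
   Formalization: The parameters λ ≥ 1 and d > 0 range over rational numbers instead of reals, and the absolute constant c is rational (the real case follows by taking d as the minimum degree and λ as the ratio of maximum to minimum degree). -}

module Defs where

open import Data.Nat using (ℕ; zero; suc)
open import Data.Bool using (Bool; true; false; if_then_else_)
open import Data.Fin using (Fin)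
open import Data.List using (map; allFin)
open import Data.Nat.ListAction using (sum)
open import Data.Integer using (+_)
open import Data.Rational using (ℚ; _/_; _*_; 1ℚ)
open import Relation.Binary.PropositionalEquality using (_≡_)
open import Function.Definitions using (Injective)

record Graph (n : ℕ) : Set where
  field
    adj    : Fin n → Fin n → Bool
    sym    : ∀ i j → adj i j ≡ adj j i
    irrefl : ∀ i → adj i i ≡ false
open Graph public

deg : ∀ {n} → Graph n → Fin n → ℕ
deg {n} G v = sum (map (λ j → if adj G v j then 1 else 0) (allFin n))

degSum : ∀ {n} → Graph n → ℕ
degSum {n} G = sum (map (deg G) (allFin n))

avgDeg : ∀ {k} → Graph (suc k) → ℚ
avgDeg {k} G = (+ degSum G) / suc k

ℕ→ℚ : ℕ → ℚ
ℕ→ℚ m = (+ m) / 1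

_^ℚ_ : ℚ → ℕ → ℚ
q ^ℚ zero  = 1ℚ
q ^ℚ suc e = q * (q ^ℚ e)

record Subgraph {n : ℕ} (G : Graph n) (m : ℕ) : Set where
  field
    graph  : Graph m
    emb    : Fin m → Fin n
    emb-inj : Injective _≡_ _≡_ emb
    edges  : ∀ i j → adj graph i j ≡ true → adj G (emb i) (emb j) ≡ true
open Subgraph public

-- A maximum cut makes the graph bipartite, and thinning it gives sides A, B, with B small, on which every b ∈ B can
-- spread the amount 2D evenly over its edges so that every a ∈ A receives x(a) D with x(a) ≤ 1. This defines edge weights
-- w ≤ 1 of total D at each a and, weighted by x, of total 2D at each b.
--
-- Vertex sets are selected without randomness, as minimisers of a sum of squared discrepancies over all subsets. With
-- ε(b) the load of b minus its target, flipping one vertex a shows that Σ_b w(a,b) ε(b) is at most D/2 when a is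
-- selected, and at least −D/2 otherwise. Applied twice, this yields A′ ⊆ A whose loads are D − O(1) on average, hence
-- |A′| ≥ |B| (1 − O(1/D)), with Σ_b w(a,b) ε(b) ≤ D/2 for all a ∈ A′.
--
-- Let k = D/2 and let H be a maximum subgraph between A′ and B of maximum degree k. The cut (X, Z) dual to H is evaluated
-- with p(b) = w(X, b): since ε(b) ≥ p(b) − D, the last inequality gives Σ_b p(b) (p(b) − D) ≤ D |X| / 2, and
-- p (p − D) ≥ D (p − D) on Z, ≥ −D p off Z, turns this into k (|X| − |Z|) ≤ e(X, B ∖ Z) + |X| / 4. Hence H misses
-- only |A′| / 4 edges of the full number k |A′|, and its average degree on A′ ∪ B is k − O(1).
--
-- If d is less than a constant times λ², a maximum matching of the cut graph suffices.
module Submission where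

open import Defs renaming (sym to adj-sym)
open import Data.Nat as ℕ using (ℕ; zero; suc)
import Data.Nat.Properties as ℕP
import Data.Integer as ℤ
import Data.Integer.Properties as ℤP
open import Data.Bool using (Bool; true; false; if_then_else_; _∧_; _∨_; not)
open import Data.Bool.Properties using () renaming (_≟_ to _≟ᵇ_)
open import Data.Fin using (Fin; zero; suc)
import Data.Fin.Properties as FinP
open import Data.Product using (Σ; _×_; _,_; proj₁; proj₂; ∃-syntax)
open import Data.Sum using (_⊎_; inj₁; inj₂)
open import Data.Empty using (⊥; ⊥-elim)
open import Data.Vec using (Vec; []; _∷_; lookup; tabulate)
open import Data.Vec.Properties using (lookup∘tabulate)
open import Data.Rational using (ℚ; _≤_; _<_; _*_; _+_; 0ℚ; 1ℚ; -_; _-_; _/_; 1/_; ≢-nonZero; nonNegative; positive)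
open import Data.Rational.Properties
import Data.Rational.Unnormalised as ℚᵘ
import Data.Rational.Unnormalised.Properties as ℚᵘP
open import Relation.Nullary using (¬_; Dec; yes; no; does; contradiction)
open import Relation.Nullary.Decidable using (dec⇒maybe; _×-dec_; _⊎-dec_; _→-dec_; dec-true)
open import Relation.Binary.PropositionalEquality
open import Function using (_∘_)
open import Level using (0ℓ)
open import Algebra.Bundles using (CommutativeRing)
open import Algebra.Properties.Semiring.Sum (CommutativeRing.semiring +-*-commutativeRing) using (sum; sum-cong-≗; ∑-distrib-+; ∑-comm; *-distribˡ-sum)
open import Algebra.Properties.Semiring.Sum ℕP.+-*-semiring using () renaming (sum to sumℕ; sum-cong-≗ to sumℕ-cong)
open import Tactic.RingSolver using (solve-∀)
import Tactic.RingSolver.Core.AlmostCommutativeRing as ACR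
open import Data.List using (map; allFin)
import Data.List as List
open import Data.List.Properties using (map-tabulate)
open import Data.Nat.ListAction using () renaming (sum to sumᴸ)
import Data.Nat.DivMod as DivMod
open import Function.Definitions using (Injective)

-- The obstacle is the additive error: the sides must agree up to a factor 1 - O(1/D), while single
-- loads, here as for a random choice, may deviate by the order of the square root of D. They are
-- never controlled one by one. Only two linear averages of the deviations matter, their total and
-- the sum seen from one selected row; flip conditions bound both at the cost of a diagonal term Σ
-- w² ≤ Σ w. Bounding the total from below needs left-out rows that load all columns nearly alike.
-- The rows left out by the first round need not do so, whereas taking half of an almost uniform
-- supply leaves the other half. Hence two rounds, and the target 2D in the first. In the cut
-- inequality the weight leaving X outside Z is counted twice, which is why the cap is D/2 and not
-- D. The weights absorb the unequal degrees: a row has total D whatever its degree. For x ≤ 1 the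
-- columns need at least twice the degree of the rows, and thinning the columns provides this.

-- Ordered arithmetic of the rationals

ℚ-ring : ACR.AlmostCommutativeRing 0ℓ 0ℓ
ℚ-ring = ACR.fromCommutativeRing +-*-commutativeRing (λ q → dec⇒maybe (0ℚ ≟ q))

-- The opaque ι protects large literals from being normalised; # computes, as the ring solver requires.
# : ℕ → ℚ
# = ℕ→ℚ

opaque
  ι : ℕ → ℚ
  ι = ℕ→ℚ

  ι≡ : ∀ n → ι n ≡ ℕ→ℚ n
  ι≡ n = refl

  ι0 : ι 0 ≡ 0ℚ
  ι0 = refl

  ι1 : ι 1 ≡ 1ℚ
  ι1 = refl

  ι-+ : ∀ m n → ι (m ℕ.+ n) ≡ ι m + ι n
  ι-+ m n = toℚᵘ-injective (ℚᵘP.≃-trans (toℚᵘ-fromℚᵘ (ℚᵘ.mkℚᵘ (ℤ.+ (m ℕ.+ n)) 0))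
    (ℚᵘP.≃-sym (ℚᵘP.≃-trans (toℚᵘ-homo-+ (ι m) (ι n))
      (ℚᵘP.≃-trans (ℚᵘP.+-cong (toℚᵘ-fromℚᵘ (ℚᵘ.mkℚᵘ (ℤ.+ m) 0)) (toℚᵘ-fromℚᵘ (ℚᵘ.mkℚᵘ (ℤ.+ n) 0)))
        (ℚᵘ.*≡* (cong (ℤ._* (ℤ.+ 1)) (cong₂ ℤ._+_ (ℤP.*-identityʳ (ℤ.+ m)) (ℤP.*-identityʳ (ℤ.+ n)))))))))

  ι-* : ∀ m n → ι (m ℕ.* n) ≡ ι m * ι n
  ι-* m n = toℚᵘ-injective (ℚᵘP.≃-trans (toℚᵘ-fromℚᵘ (ℚᵘ.mkℚᵘ (ℤ.+ (m ℕ.* n)) 0))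
    (ℚᵘP.≃-sym (ℚᵘP.≃-trans (toℚᵘ-homo-* (ι m) (ι n))
      (ℚᵘP.≃-trans (ℚᵘP.*-cong (toℚᵘ-fromℚᵘ (ℚᵘ.mkℚᵘ (ℤ.+ m) 0)) (toℚᵘ-fromℚᵘ (ℚᵘ.mkℚᵘ (ℤ.+ n) 0)))
        (ℚᵘ.*≡* (cong (ℤ._* (ℤ.+ 1)) (sym (ℤP.pos-* m n))))))))

  ι-mono : ∀ {m n} → m ℕ.≤ n → ι m ≤ ι n
  ι-mono {m} {n} m≤n = toℚᵘ-cancel-≤
    (ℚᵘP.≤-respˡ-≃ (ℚᵘP.≃-sym (toℚᵘ-fromℚᵘ (ℚᵘ.mkℚᵘ (ℤ.+ m) 0)))
      (ℚᵘP.≤-respʳ-≃ (ℚᵘP.≃-sym (toℚᵘ-fromℚᵘ (ℚᵘ.mkℚᵘ (ℤ.+ n) 0)))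
        (ℚᵘ.*≤* (ℤP.*-monoʳ-≤-nonNeg (ℤ.+ 1) (ℤ.+≤+ m≤n)))))

0≤ι : ∀ n → 0ℚ ≤ ι n
0≤ι n = subst (_≤ ι n) ι0 (ι-mono {0} {n} ℕ.z≤n)

#≥ : ∀ n → 0ℚ ≤ # n
#≥ n = subst (0ℚ ≤_) (ι≡ n) (0≤ι n)

gap : ∀ {a b} → a ≤ b → 0ℚ ≤ b - a
gap {a} {b} h = subst (_≤ b - a) (+-inverseʳ a) (+-monoˡ-≤ (- a) h)

-- The form in which most inequalities below are proved: the slack `r` is a combination of products
-- of nonnegative factors, and the ring solver checks the identity. The numerals in such an `r` are
-- the multipliers of the inequalities combined.
≤-by : ∀ {a b} r → 0ℚ ≤ r → a + r ≡ b → a ≤ b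
≤-by {a} r 0≤r eq = subst₂ _≤_ (+-identityʳ a) eq (+-monoʳ-≤ a 0≤r)

infixl 6 _+≥_
infixl 7 _*≥_

_+≥_ : ∀ {a b} → 0ℚ ≤ a → 0ℚ ≤ b → 0ℚ ≤ a + b
_+≥_ = +-mono-≤

*-monoˡ : ∀ {a b c} → 0ℚ ≤ c → a ≤ b → c * a ≤ c * b
*-monoˡ {c = c} 0≤c = *-monoˡ-≤-nonNeg c {{nonNegative 0≤c}}

*-monoʳ : ∀ {a b c} → 0ℚ ≤ c → a ≤ b → a * c ≤ b * c
*-monoʳ {c = c} 0≤c = *-monoʳ-≤-nonNeg c {{nonNegative 0≤c}}

_*≥_ : ∀ {a b} → 0ℚ ≤ a → 0ℚ ≤ b → 0ℚ ≤ a * b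
_*≥_ {a} {b} 0≤a 0≤b = subst (_≤ a * b) (*-zeroʳ a) (*-monoˡ 0≤a 0≤b)

*-cancelˡ : ∀ {a b c} → 0ℚ < c → c * a ≤ c * b → a ≤ b
*-cancelˡ {c = c} 0<c = *-cancelˡ-≤-pos c {{positive 0<c}}

sq≥0 : ∀ a → 0ℚ ≤ a * a
sq≥0 a with ≤-total 0ℚ a
... | inj₁ p = p *≥ p
... | inj₂ n = subst (0ℚ ≤_) (lem a) (q *≥ q)
  where
  q : 0ℚ ≤ - a
  q = neg-antimono-≤ n
  lem : ∀ a → (- a) * (- a) ≡ a * a
  lem = solve-∀ ℚ-ring

0≤1 : 0ℚ ≤ 1ℚ
0≤1 = subst (0ℚ ≤_) ι1 (0≤ι 1)

does-true : ∀ {ℓ} {A : Set ℓ} (d : Dec A) → does d ≡ true → A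
does-true (yes a) _ = a

ind : Bool → ℚ
ind true  = 1ℚ
ind false = 0ℚ

0≤ind : ∀ b → 0ℚ ≤ ind b
0≤ind true  = 0≤1
0≤ind false = ≤-refl

ind≤1 : ∀ b → ind b ≤ 1ℚ
ind≤1 true  = ≤-refl
ind≤1 false = 0≤1

0≤1-ind : ∀ b → 0ℚ ≤ 1ℚ - ind b
0≤1-ind b = gap (ind≤1 b)

ind-∧ : ∀ a b → ind (a ∧ b) ≡ ind a * ind b
ind-∧ true  b = sym (*-identityˡ (ind b))
ind-∧ false b = sym (*-zeroˡ (ind b))

sub : ∀ {a b} → 0ℚ ≤ b - a → a ≤ b
sub {a} {b} h = ≤-by (b - a) h (l a b)
  where
  l : ∀ a b → a + (b - a) ≡ b
  l = solve-∀ ℚ-ring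

-- Finite sums

opaque
  ∑ : ∀ {n} → (Fin n → ℚ) → ℚ
  ∑ = sum

  ∑-0 : (f : Fin 0 → ℚ) → ∑ f ≡ 0ℚ
  ∑-0 f = refl

  ∑-suc : ∀ {n} (f : Fin (suc n) → ℚ) → ∑ f ≡ f zero + ∑ (f ∘ suc)
  ∑-suc f = refl

  ∑-cong : ∀ {n} {f g : Fin n → ℚ} → (∀ i → f i ≡ g i) → ∑ f ≡ ∑ g
  ∑-cong = sum-cong-≗

  ∑-+ : ∀ {n} (f g : Fin n → ℚ) → ∑ (λ i → f i + g i) ≡ ∑ f + ∑ g
  ∑-+ = ∑-distrib-+

  ∑-* : ∀ {n} (c : ℚ) (f : Fin n → ℚ) → ∑ (λ i → c * f i) ≡ c * ∑ f
  ∑-* c f = sym (*-distribˡ-sum c f)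

  ∑-swap : ∀ {m n} (f : Fin m → Fin n → ℚ) → ∑ (λ i → ∑ (λ j → f i j)) ≡ ∑ (λ j → ∑ (λ i → f i j))
  ∑-swap = ∑-comm

  ∑-mono : ∀ {n} {f g : Fin n → ℚ} → (∀ i → f i ≤ g i) → ∑ f ≤ ∑ g
  ∑-mono {zero}  h = ≤-refl
  ∑-mono {suc n} h = +-mono-≤ (h zero) (∑-mono (h ∘ suc))

∑-zero : ∀ n → ∑ {n} (λ _ → 0ℚ) ≡ 0ℚ
∑-zero n = trans (∑-cong {f = λ (_ : Fin n) → 0ℚ} (λ _ → sym (*-zeroˡ 0ℚ))) (trans (∑-* {n} 0ℚ (λ _ → 0ℚ)) (*-zeroˡ (∑ {n} (λ _ → 0ℚ))))

∑-nonneg : ∀ {n} {f : Fin n → ℚ} → (∀ i → 0ℚ ≤ f i) → 0ℚ ≤ ∑ f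
∑-nonneg {n} {f} h = subst (_≤ ∑ f) (∑-zero n) (∑-mono h)

∑-*ʳ : ∀ {n} (c : ℚ) (f : Fin n → ℚ) → ∑ (λ i → f i * c) ≡ ∑ f * c
∑-*ʳ c f = trans (∑-cong (λ i → *-comm (f i) c)) (trans (∑-* c f) (*-comm c (∑ f)))

∑-neg : ∀ {n} (f : Fin n → ℚ) → ∑ (λ i → - f i) ≡ - ∑ f
∑-neg f = trans (∑-cong (λ i → l (f i))) (trans (∑-* (- 1ℚ) f) (sym (l (∑ f))))
  where
  l : ∀ a → - a ≡ (- 1ℚ) * a
  l = solve-∀ ℚ-ring

∑-- : ∀ {n} (f g : Fin n → ℚ) → ∑ (λ i → f i - g i) ≡ ∑ f - ∑ g
∑-- f g = trans (∑-+ f (λ i → - g i)) (cong (λ z → ∑ f + z) (∑-neg g))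

∑-inner : ∀ {m n} (x : Fin m → ℚ) (f : Fin m → Fin n → ℚ) (y : Fin n → ℚ) →
  ∑ (λ i → x i * ∑ (λ j → f i j * y j)) ≡ ∑ (λ j → ∑ (λ i → x i * f i j) * y j)
∑-inner x f y = begin
  ∑ (λ i → x i * ∑ (λ j → f i j * y j))   ≡⟨ ∑-cong (λ i → sym (∑-* (x i) (λ j → f i j * y j))) ⟩
  ∑ (λ i → ∑ (λ j → x i * (f i j * y j))) ≡⟨ ∑-swap (λ i j → x i * (f i j * y j)) ⟩
  ∑ (λ j → ∑ (λ i → x i * (f i j * y j))) ≡⟨ ∑-cong (λ j → trans (∑-cong (λ i → l (x i) (f i j) (y j)))
                                                   (trans (∑-* (y j) (λ i → x i * f i j)) (*-comm (y j) _))) ⟩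
  ∑ (λ j → ∑ (λ i → x i * f i j) * y j)   ∎
  where
  open ≡-Reasoning
  l : ∀ a b c → a * (b * c) ≡ c * (a * b)
  l = solve-∀ ℚ-ring

∑-inner₁ : ∀ {m n} (x : Fin m → ℚ) (f : Fin m → Fin n → ℚ) →
  ∑ (λ i → x i * ∑ (f i)) ≡ ∑ (λ j → ∑ (λ i → x i * f i j))
∑-inner₁ x f = trans (∑-cong (λ i → sym (∑-* (x i) (f i)))) (∑-swap (λ i j → x i * f i j))

δ : ∀ {n} → Fin n → Fin n → ℚ
δ i k = ind (does (k FinP.≟ i))

∑-δ : ∀ {n} (i : Fin n) (f : Fin n → ℚ) → ∑ (λ k → δ i k * f k) ≡ f i
∑-δ {suc n} zero f = trans (∑-suc (λ k → δ zero k * f k)) (trans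
  (cong₂ _+_ (*-identityˡ (f zero)) (trans (∑-cong (λ k → *-zeroˡ (f (suc k)))) (∑-zero n)))
  (+-identityʳ (f zero)))

∑-δ {suc n} (suc i) f = trans (∑-suc (λ k → δ (suc i) k * f k)) (trans
  (cong₂ _+_ (*-zeroˡ (f zero)) (trans (∑-cong (λ k → cong (λ z → ind z * f (suc k)) (lem k i))) (∑-δ i (f ∘ suc))))
  (+-identityˡ (f (suc i))))
  where
  lem : ∀ {n} (k i : Fin n) → does (Fin.suc k FinP.≟ suc i) ≡ does (k FinP.≟ i)
  lem k i with k FinP.≟ i
  ... | yes _ = refl
  ... | no  _ = refl

term≤∑ : ∀ {n} {f : Fin n → ℚ} → (∀ i → 0ℚ ≤ f i) → ∀ i → f i ≤ ∑ f
term≤∑ {n} {f} h i = subst (_≤ ∑ f) (∑-δ i f) (∑-mono (λ k → ≤-by ((1ℚ - δ i k) * f k) (0≤1-ind (does (k FinP.≟ i)) *≥ h k) (l (δ i k) (f k))))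
  where
  l : ∀ d a → d * a + (1ℚ - d) * a ≡ a
  l = solve-∀ ℚ-ring

-- Minimising quadratic forms over 0/1 vectors

argminᵇ : (f : Bool → ℚ) → ∃[ s ] (∀ t → f s ≤ f t)
argminᵇ f with ≤-total (f true) (f false)
... | inj₁ h = true  , λ { true → ≤-refl ; false → h }
... | inj₂ h = false , λ { true → h ; false → ≤-refl }

argminⱽ : ∀ {n} (f : Vec Bool n → ℚ) → ∃[ s ] (∀ t → f s ≤ f t)
argminⱽ {zero}  f = [] , λ { [] → ≤-refl }
argminⱽ {suc n} f with argminᵇ (λ b → f (b ∷ proj₁ (argminⱽ (λ t → f (b ∷ t)))))
... | b , hb = b ∷ proj₁ (argminⱽ (λ t → f (b ∷ t))) ,
  λ { (c ∷ t) → ≤-trans (hb c) (proj₂ (argminⱽ (λ t → f (c ∷ t))) t) }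

Mask : ℕ → Set
Mask n = Fin n → Bool

-- The search runs over vectors, and a mask `t` agrees only pointwise with `lookup (tabulate t)`;
-- `ext` carries the value of `f` across.
argmin : ∀ {n} (f : (Fin n → ℚ) → ℚ) → (∀ {x y} → (∀ i → x i ≡ y i) → f x ≡ f y) →
  ∃[ s ] (∀ (t : Mask n) → f (ind ∘ s) ≤ f (ind ∘ t))
argmin f ext with argminⱽ (λ v → f (ind ∘ lookup v))
... | s , h = lookup s , λ t → subst (f (ind ∘ lookup s) ≤_)
  (ext (λ i → cong ind (lookup∘tabulate t i))) (h (tabulate t))

assign : ∀ {n} → Mask n → Fin n → Bool → Mask n
assign s i b k = if does (k FinP.≟ i) then b else s k

ind-assign : ∀ {n} (s : Mask n) i b k → ind (assign s i b k) ≡ ind (s k) + (ind b - ind (s i)) * δ i k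
ind-assign s i b k with k FinP.≟ i
... | yes refl = l (ind b) (ind (s i))
  where
  l : ∀ x y → x ≡ y + (x - y) * 1ℚ
  l = solve-∀ ℚ-ring
... | no _ = l (ind (s k)) (ind b) (ind (s i))
  where
  l : ∀ z x y → z ≡ z + (x - y) * 0ℚ
  l = solve-∀ ℚ-ring

module QuadraticForm {n} (M : Fin n → Fin n → ℚ) (M-sym : ∀ i k → M i k ≡ M k i) (c : Fin n → ℚ) where

  grad : (Fin n → ℚ) → Fin n → ℚ
  grad x i = ∑ (λ k → M i k * x k)

  form : (Fin n → ℚ) → ℚ
  form x = ∑ (λ i → x i * (grad x i - c i))

  grad-cong : ∀ {x y} → (∀ i → x i ≡ y i) → ∀ i → grad x i ≡ grad y i
  grad-cong eq i = ∑-cong (λ k → cong (M i k *_) (eq k))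

  form-cong : ∀ {x y} → (∀ i → x i ≡ y i) → form x ≡ form y
  form-cong eq = ∑-cong (λ i → cong₂ _*_ (eq i) (cong (_- c i) (grad-cong eq i)))

  grad-shift : ∀ x ε i₀ i → grad (λ k → x k + ε * δ i₀ k) i ≡ grad x i + ε * M i i₀
  grad-shift x ε i₀ i = begin
    ∑ (λ k → M i k * (x k + ε * δ i₀ k))                ≡⟨ ∑-cong (λ k → l (M i k) (x k) ε (δ i₀ k)) ⟩
    ∑ (λ k → M i k * x k + ε * (δ i₀ k * M i k))        ≡⟨ ∑-+ (λ k → M i k * x k) (λ k → ε * (δ i₀ k * M i k)) ⟩
    grad x i + ∑ (λ k → ε * (δ i₀ k * M i k))           ≡⟨ cong (λ z → grad x i + z) (trans (∑-* ε (λ k → δ i₀ k * M i k)) (cong (ε *_) (∑-δ i₀ (M i)))) ⟩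
    grad x i + ε * M i i₀                               ∎
    where
    open ≡-Reasoning
    l : ∀ m x e d → m * (x + e * d) ≡ m * x + e * (d * m)
    l = solve-∀ ℚ-ring

  -- The expansion is exact, as the form is quadratic; the symmetry of `M` merges the two linear
  -- terms. Flips use it with `ε` equal to 1 or -1.
  form-shift : ∀ x ε i → form (λ k → x k + ε * δ i k) ≡
    form x + ε * (grad x i + grad x i - c i + ε * M i i)
  form-shift x ε i = begin
    ∑ (λ k → (x k + ε * δ i k) * (grad (λ k → x k + ε * δ i k) k - c k))
      ≡⟨ ∑-cong (λ k → trans (cong (λ z → (x k + ε * δ i k) * (z - c k)) (grad-shift x ε i k))
                             (l (x k) ε (δ i k) (grad x k) (M k i) (c k))) ⟩
    ∑ (λ k → x k * (grad x k - c k) + (ε * (M k i * x k) + ε * (δ i k * (grad x k + ε * M k i - c k))))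
      ≡⟨ trans (∑-+ (λ k → x k * (grad x k - c k)) (λ k → ε * (M k i * x k) + ε * (δ i k * (grad x k + ε * M k i - c k))))
               (cong (λ z → form x + z) (∑-+ (λ k → ε * (M k i * x k)) (λ k → ε * (δ i k * (grad x k + ε * M k i - c k))))) ⟩
    form x + (∑ (λ k → ε * (M k i * x k)) + ∑ (λ k → ε * (δ i k * (grad x k + ε * M k i - c k))))
      ≡⟨ cong (λ z → form x + z) (cong₂ _+_
           (trans (∑-* ε (λ k → M k i * x k)) (cong (ε *_) (∑-cong (λ k → cong (_* x k) (M-sym k i)))))
           (trans (∑-* ε (λ k → δ i k * (grad x k + ε * M k i - c k))) (cong (ε *_) (∑-δ i (λ k → grad x k + ε * M k i - c k))))) ⟩
    form x + (ε * grad x i + ε * (grad x i + ε * M i i - c i))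
      ≡⟨ l₂ (form x) ε (grad x i) (M i i) (c i) ⟩
    form x + ε * (grad x i + grad x i - c i + ε * M i i) ∎
    where
    open ≡-Reasoning
    l : ∀ x e d g m c → (x + e * d) * (g + e * m - c) ≡ x * (g - c) + (e * (m * x) + e * (d * (g + e * m - c)))
    l = solve-∀ ℚ-ring
    l₂ : ∀ f e g m c → f + (e * g + e * (g + e * m - c)) ≡ f + e * (g + g - c + e * m)
    l₂ = solve-∀ ℚ-ring

  -- Discrete first-order conditions: removing or adding one index may not lower the form. The
  -- diagonal entry, absent at a continuous minimum, is the price of integrality. `global` serves
  -- the comparison with a fixed set in `Core`.
  record Minimiser (s : Mask n) : Set where
    field
      global : ∀ t → form (ind ∘ s) ≤ form (ind ∘ t)
      inside  : ∀ i → s i ≡ true → grad (ind ∘ s) i + grad (ind ∘ s) i - c i ≤ M i i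
      outside : ∀ i → s i ≡ false → - M i i ≤ grad (ind ∘ s) i + grad (ind ∘ s) i - c i

  opaque
    minimiser : ∃[ s ] Minimiser s
    minimiser with argmin form form-cong
    ... | s , glob = s , record { global = glob ; inside = ins ; outside = out }
      where
      x : Fin n → ℚ
      x = ind ∘ s
      step : ∀ i b → form x ≤ form x + (ind b - ind (s i)) * (grad x i + grad x i - c i + (ind b - ind (s i)) * M i i)
      step i b = subst (form x ≤_) (trans (form-cong (ind-assign s i b)) (form-shift x (ind b - ind (s i)) i)) (glob (assign s i b))
      l₁ : ∀ f g m → f + (0ℚ - 1ℚ) * (g + (0ℚ - 1ℚ) * m) - f ≡ m - g
      l₁ = solve-∀ ℚ-ring
      l₂ : ∀ f g m → f + (1ℚ - 0ℚ) * (g + (1ℚ - 0ℚ) * m) - f ≡ g - (- m)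
      l₂ = solve-∀ ℚ-ring
      ins : ∀ i → s i ≡ true → grad x i + grad x i - c i ≤ M i i
      ins i eq = sub (subst (0ℚ ≤_) (l₁ (form x) (grad x i + grad x i - c i) (M i i)) (gap
        (subst (λ z → form x ≤ form x + (0ℚ - ind z) * (grad x i + grad x i - c i + (0ℚ - ind z) * M i i)) eq (step i false))))
      out : ∀ i → s i ≡ false → - M i i ≤ grad x i + grad x i - c i
      out i eq = sub (subst (0ℚ ≤_) (l₂ (form x) (grad x i + grad x i - c i) (M i i)) (gap
        (subst (λ z → form x ≤ form x + (1ℚ - ind z) * (grad x i + grad x i - c i + (1ℚ - ind z) * M i i)) eq (step i true))))

-- The minimised form is the sum over j of the squared discrepancies, up to a constant.
module Balancing {p q} (w : Fin p → Fin q → ℚ) (T : Fin q → ℚ) where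

  load : (Fin p → ℚ) → Fin q → ℚ
  load x j = ∑ (λ i → x i * w i j)

  disc : (Fin p → ℚ) → Fin q → ℚ
  disc x j = load x j - T j

  private
    M : Fin p → Fin p → ℚ
    M i k = ∑ (λ j → w i j * w k j)

    c : Fin p → ℚ
    c i = ∑ (λ j → w i j * T j) + ∑ (λ j → w i j * T j)

    open QuadraticForm M (λ i k → ∑-cong (λ j → *-comm (w i j) (w k j))) c

    -- Either side is the partial derivative in `x i` of the sum of squared discrepancies; `M` is
    -- the Gram matrix of the rows of `w`.
    grad-disc : ∀ x i → grad x i + grad x i - c i ≡ ∑ (λ j → w i j * disc x j) + ∑ (λ j → w i j * disc x j)
    grad-disc x i = trans (l (grad x i) (∑ (λ j → w i j * T j))) (cong (λ z → z + z) (sym eq))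
      where
      l : ∀ g t → g + g - (t + t) ≡ (g - t) + (g - t)
      l = solve-∀ ℚ-ring
      d : ∀ a b c → a * (b - c) ≡ a * b - a * c
      d = solve-∀ ℚ-ring
      open ≡-Reasoning
      eq : ∑ (λ j → w i j * disc x j) ≡ grad x i - ∑ (λ j → w i j * T j)
      eq = begin
        ∑ (λ j → w i j * disc x j) ≡⟨ trans (∑-cong (λ j → d (w i j) (load x j) (T j))) (∑-- (λ j → w i j * load x j) (λ j → w i j * T j)) ⟩
        ∑ (λ j → w i j * load x j) - ∑ (λ j → w i j * T j) ≡⟨ cong (_- ∑ (λ j → w i j * T j)) (trans
            (∑-cong (λ j → cong (w i j *_) (∑-cong (λ k → *-comm (x k) (w k j)))))
            (∑-inner (w i) (λ j k → w k j) x)) ⟩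
        grad x i - ∑ (λ j → w i j * T j) ∎

  record Balanced (s : Mask p) : Set where
    field
      inside  : ∀ i → s i ≡ true → ∑ (λ j → w i j * disc (ind ∘ s) j) + ∑ (λ j → w i j * disc (ind ∘ s) j) ≤ ∑ (λ j → w i j * w i j)
      outside : ∀ i → s i ≡ false → - ∑ (λ j → w i j * w i j) ≤ ∑ (λ j → w i j * disc (ind ∘ s) j) + ∑ (λ j → w i j * disc (ind ∘ s) j)

  opaque
    balanced : ∃[ s ] Balanced s
    balanced = proj₁ minimiser , record
      { inside  = λ i eq → subst (_≤ M i i) (grad-disc x i) (Minimiser.inside m i eq)
      ; outside = λ i eq → subst (- M i i ≤_) (grad-disc x i) (Minimiser.outside m i eq) }
      where
      m : Minimiser (proj₁ minimiser)
      m = proj₂ minimiser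
      x : Fin p → ℚ
      x = ind ∘ proj₁ minimiser

-- Rounding fractional weights in two stages

square≤self : ∀ {a} → 0ℚ ≤ a → a ≤ 1ℚ → a * a ≤ a
square≤self {a} 0≤a a≤1 = ≤-by (a * (1ℚ - a)) (0≤a *≥ gap a≤1) (l a)
  where
  l : ∀ a → a * a + a * (1ℚ - a) ≡ a
  l = solve-∀ ℚ-ring

-- The first round rounds x to a set s₁ of rows of column loads 2D + σ with Σ σ² = O(D m). The second round halves
-- these loads. Its condition on the rows left out, weighted by the remaining load 2D + σ − (D + ε) ≈ D, bounds Σ ε
-- from below, because the error Σ σ ε − Σ ε² is at most Σ σ² / 4.
module TwoStage {p q} (w : Fin p → Fin q → ℚ) (act : Mask p) (β : Mask q) (x : Fin p → ℚ) (D : ℚ)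
  (1≤D : 1ℚ ≤ D) (0≤w : ∀ a b → 0ℚ ≤ w a b) (w≤1 : ∀ a b → w a b ≤ 1ℚ)
  (0≤x : ∀ a → 0ℚ ≤ x a) (x≤1 : ∀ a → x a ≤ 1ℚ)
  (row : ∀ a → ∑ (w a) ≡ ind (act a) * D)
  (col : ∀ b → ∑ (λ a → x a * w a b) ≡ ind (β b) * (D + D))
  (w-β : ∀ a b → β b ≡ false → w a b ≡ 0ℚ) where

  m : ℚ
  m = ∑ (ind ∘ β)

  w-act : ∀ a b → act a ≡ false → w a b ≡ 0ℚ
  w-act a b eq = ≤-antisym (subst (w a b ≤_) (trans (row a) (trans (cong (λ z → ind z * D) eq) (*-zeroˡ D))) (term≤∑ (0≤w a) b)) (0≤w a b)

  T₁ T₂ : Fin q → ℚ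
  T₁ b = ind (β b) * (D + D)
  T₂ b = ind (β b) * D

  module B₁ = Balancing w T₁

  s₁ : Mask p
  s₁ = proj₁ B₁.balanced

  y : Fin p → ℚ
  y = ind ∘ s₁

  σ : Fin q → ℚ
  σ = B₁.disc y

  w₂ : Fin p → Fin q → ℚ
  w₂ a b = y a * w a b

  module B₂ = Balancing w₂ T₂

  s₂ : Mask p
  s₂ = proj₁ B₂.balanced

  y₂ : Fin p → ℚ
  y₂ = ind ∘ s₂

  ε : Fin q → ℚ
  ε = B₂.disc y₂

  disc-off : ∀ (z : Fin p → ℚ) (v : Fin p → Fin q → ℚ) b t → (∀ a → v a b ≡ 0ℚ) → β b ≡ false →
    ∑ (λ a → z a * v a b) - ind (β b) * t ≡ 0ℚ
  disc-off z v b t v0 eq = trans (cong₂ _-_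
    (trans (∑-cong (λ a → trans (cong (z a *_) (v0 a)) (*-zeroʳ (z a)))) (∑-zero p))
    (trans (cong (λ u → ind u * t) eq) (*-zeroˡ t))) refl

  σ-off : ∀ b → β b ≡ false → σ b ≡ 0ℚ
  σ-off b eq = disc-off y w b (D + D) (λ a → w-β a b eq) eq

  ε-off : ∀ b → β b ≡ false → ε b ≡ 0ℚ
  ε-off b eq = disc-off y₂ w₂ b D (λ a → trans (cong (y a *_) (w-β a b eq)) (*-zeroʳ (y a))) eq

  ∑T₁ : ∑ T₁ ≡ (D + D) * m
  ∑T₁ = trans (∑-*ʳ (D + D) (ind ∘ β)) (*-comm m (D + D))

  ∑w²≤ : ∀ a → ∑ (λ b → w a b * w a b) ≤ ∑ (w a)
  ∑w²≤ a = ∑-mono (λ b → square≤self (0≤w a b) (w≤1 a b))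

  Q S E : ℚ
  Q = ∑ (λ b → σ b * σ b)
  S = ∑ σ
  E = ∑ ε

  0≤m : 0ℚ ≤ m
  0≤m = ∑-nonneg (λ b → 0≤ind (β b))

  0≤D : 0ℚ ≤ D
  0≤D = ≤-trans 0≤1 1≤D

  opaque
    -- By `col` the fractional `x` meets the targets exactly, so only `y a - x a` contributes. This
    -- turns `Q` into a sum over rows, to which the balance conditions apply.
    σ-def : ∀ b → σ b ≡ ∑ (λ a → (y a - x a) * w a b)
    σ-def b = sym (trans (∑-cong (λ a → l (y a) (x a) (w a b))) (trans (∑-- (λ a → y a * w a b) (λ a → x a * w a b))
      (cong (λ z → ∑ (λ a → y a * w a b) - z) (col b))))
      where
      l : ∀ y x w → (y - x) * w ≡ y * w - x * w
      l = solve-∀ ℚ-ring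

    Q-expand : Q ≡ ∑ (λ a → (y a - x a) * ∑ (λ b → w a b * σ b))
    Q-expand = trans (∑-cong (λ b → cong (_* σ b) (σ-def b))) (sym (∑-inner (λ a → y a - x a) w σ))

    -- The balance condition of a row points against the sign of `y a - x a`: a selected row sees
    -- little overload, a rejected one little underload. So the left side is at most |y - x| Σ w²,
    -- and |y - x| ≤ y + x. The sum y + x is convenient because its column loads are known: `σ` plus
    -- twice the target.
    rowwise : ∀ a → (y a - x a) * ∑ (λ b → w a b * σ b) + (y a - x a) * ∑ (λ b → w a b * σ b) ≤ (y a + x a) * ∑ (w a)
    rowwise a = ≤-trans (main (s₁ a) refl) (*-monoˡ (0≤ind (s₁ a) +≥ 0≤x a) (∑w²≤ a))
      where
      R W : ℚ
      R = ∑ (λ b → w a b * σ b)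
      W = ∑ (λ b → w a b * w a b)
      0≤W : 0ℚ ≤ W
      0≤W = ∑-nonneg (λ b → sq≥0 (w a b))
      l₁ : ∀ x R W → ((1ℚ - x) * R + (1ℚ - x) * R) + ((1ℚ - x) * (W - (R + R)) + (x * W + x * W)) ≡ (1ℚ + x) * W
      l₁ = solve-∀ ℚ-ring
      l₂ : ∀ x R W → ((0ℚ - x) * R + (0ℚ - x) * R) + x * (R + R - - W) ≡ (0ℚ + x) * W
      l₂ = solve-∀ ℚ-ring
      main : ∀ v → s₁ a ≡ v → (ind (s₁ a) - x a) * R + (ind (s₁ a) - x a) * R ≤ (ind (s₁ a) + x a) * W
      main true eq = subst (λ v → (ind v - x a) * R + (ind v - x a) * R ≤ (ind v + x a) * W) (sym eq)
        (≤-by _ (gap (x≤1 a) *≥ gap (B₁.Balanced.inside (proj₂ B₁.balanced) a eq) +≥ (0≤x a *≥ 0≤W +≥ 0≤x a *≥ 0≤W)) (l₁ (x a) R W))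
      main false eq = subst (λ v → (ind v - x a) * R + (ind v - x a) * R ≤ (ind v + x a) * W) (sym eq)
        (≤-by _ (0≤x a *≥ gap (B₁.Balanced.outside (proj₂ B₁.balanced) a eq)) (l₂ (x a) R W))

    2Q≤ : Q + Q ≤ S + (D + D + (D + D)) * m
    2Q≤ = subst₂ _≤_ eq₁ eq₂ (∑-mono rowwise)
      where
      f : Fin p → ℚ
      f a = (y a - x a) * ∑ (λ b → w a b * σ b)
      eq₁ : ∑ (λ a → f a + f a) ≡ Q + Q
      eq₁ = trans (∑-+ f f) (sym (cong₂ _+_ Q-expand Q-expand))
      l : ∀ u v t → u + v ≡ (u - t) + (t + v)
      l = solve-∀ ℚ-ring
      l₃ : ∀ d m → d * m + d * m ≡ (d + d) * m
      l₃ = solve-∀ ℚ-ring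
      d : ∀ y x w → (y + x) * w ≡ y * w + x * w
      d = solve-∀ ℚ-ring
      eq₂ : ∑ (λ a → (y a + x a) * ∑ (w a)) ≡ S + (D + D + (D + D)) * m
      eq₂ = begin
        ∑ (λ a → (y a + x a) * ∑ (w a)) ≡⟨ ∑-inner₁ (λ a → y a + x a) w ⟩
        ∑ (λ b → ∑ (λ a → (y a + x a) * w a b)) ≡⟨ ∑-cong (λ b → trans (∑-cong (λ a → d (y a) (x a) (w a b)))
             (trans (∑-+ (λ a → y a * w a b) (λ a → x a * w a b)) (trans (cong (λ z → ∑ (λ a → y a * w a b) + z) (col b)) (l (∑ (λ a → y a * w a b)) (T₁ b) (T₁ b))))) ⟩
        ∑ (λ b → σ b + (T₁ b + T₁ b)) ≡⟨ trans (∑-+ σ (λ b → T₁ b + T₁ b)) (cong (λ z → S + z) (trans (∑-+ T₁ T₁) (trans (cong (λ z → z + z) ∑T₁) (l₃ (D + D) m)))) ⟩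
        S + (D + D + (D + D)) * m ∎
        where open ≡-Reasoning

    -- From (2σ - 1)² ≥ 0; off `β` the deviation vanishes, so the constant is paid only `m` times.
    -- Inserted into `2Q≤` it leaves Q ≤ (4D + 1/4) m.
    4S≤ : # 4 * S ≤ # 4 * Q + m
    4S≤ = subst₂ _≤_ (∑-* (# 4) σ) (trans (∑-+ (λ b → # 4 * (σ b * σ b)) (ind ∘ β)) (cong (λ z → z + m) (∑-* (# 4) (λ b → σ b * σ b))))
      (∑-mono (λ b → pt b (β b) refl))
      where
      l : ∀ s → # 4 * s + (s + s - 1ℚ) * (s + s - 1ℚ) ≡ # 4 * (s * s) + 1ℚ
      l = solve-∀ ℚ-ring
      pt : ∀ b v → β b ≡ v → # 4 * σ b ≤ # 4 * (σ b * σ b) + ind (β b)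
      pt b true eq = subst (λ v → # 4 * σ b ≤ # 4 * (σ b * σ b) + ind v) (sym eq) (≤-by _ (sq≥0 (σ b + σ b - 1ℚ)) (l (σ b)))
      pt b false eq = subst₂ (λ v s → # 4 * s ≤ # 4 * (s * s) + ind v) (sym eq) (sym (σ-off b eq)) ≤-refl

    m≤Dm : m ≤ D * m
    m≤Dm = subst (_≤ D * m) (*-identityˡ m) (*-monoʳ 0≤m 1≤D)

    Q≤ : Q ≤ # 5 * D * m
    Q≤ = *-cancelˡ {c = # 4} (positive⁻¹ (# 4))
      (≤-by _ (#≥ 4 *≥ gap 2Q≤ +≥ gap 4S≤ +≥ gap m≤Dm +≥ #≥ 3 *≥ (0≤D *≥ 0≤m)) (l Q S D m))
      where
      l : ∀ Q S D m → # 4 * Q + (# 4 * (S + (D + D + (D + D)) * m - (Q + Q)) + (# 4 * Q + m - # 4 * S) + (D * m - m) + # 3 * (D * m)) ≡ # 4 * (# 5 * D * m)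
      l = solve-∀ ℚ-ring

    S≤ : S ≤ # 6 * D * m
    S≤ = *-cancelˡ {c = # 4} (positive⁻¹ (# 4))
      (≤-by _ (#≥ 4 *≥ gap Q≤ +≥ gap 4S≤ +≥ gap m≤Dm +≥ #≥ 3 *≥ (0≤D *≥ 0≤m)) (l Q S D m))
      where
      l : ∀ Q S D m → # 4 * S + (# 4 * (# 5 * D * m - Q) + (# 4 * Q + m - # 4 * S) + (D * m - m) + # 3 * (D * m)) ≡ # 4 * (# 6 * D * m)
      l = solve-∀ ℚ-ring

    0≤y : ∀ a → 0ℚ ≤ y a
    0≤y a = 0≤ind (s₁ a)

    0≤w₂ : ∀ a b → 0ℚ ≤ w₂ a b
    0≤w₂ a b = 0≤y a *≥ 0≤w a b

    w₂≤1 : ∀ a b → w₂ a b ≤ 1ℚ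
    w₂≤1 a b = ≤-trans (*-monoʳ (0≤w a b) (ind≤1 (s₁ a))) (subst (_≤ 1ℚ) (sym (*-identityˡ (w a b))) (w≤1 a b))

    ∑w₂²≤ : ∀ a → ∑ (λ b → w₂ a b * w₂ a b) ≤ ∑ (w₂ a)
    ∑w₂²≤ a = ∑-mono (λ b → square≤self (0≤w₂ a b) (w₂≤1 a b))

    -- Replacing Σ w₂² by Σ w₂ makes the condition of a left-out row linear in `w₂`, so that the sum
    -- over rows can be regrouped by columns.
    slack : ∀ a → 0ℚ ≤ (1ℚ - y₂ a) * ∑ (λ b → w₂ a b * (ε b + ε b + 1ℚ))
    slack a = subst (λ z → 0ℚ ≤ (1ℚ - y₂ a) * z) (sym eq) (main (s₂ a) refl)
      where
      R W : ℚ
      R = ∑ (λ b → w₂ a b * ε b)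
      W = ∑ (λ b → w₂ a b * w₂ a b)
      d : ∀ w e → w * (e + e + 1ℚ) ≡ w * e + (w * e + w)
      d = solve-∀ ℚ-ring
      eq : ∑ (λ b → w₂ a b * (ε b + ε b + 1ℚ)) ≡ R + (R + ∑ (w₂ a))
      eq = trans (∑-cong (λ b → d (w₂ a b) (ε b))) (trans (∑-+ (λ b → w₂ a b * ε b) (λ b → w₂ a b * ε b + w₂ a b))
        (cong (λ z → R + z) (∑-+ (λ b → w₂ a b * ε b) (w₂ a))))
      l₀ : ∀ r → 0ℚ ≡ (1ℚ - 1ℚ) * r
      l₀ = solve-∀ ℚ-ring
      l₁ : ∀ R W V → 0ℚ + (R + R - - W + (V - W)) ≡ (1ℚ - 0ℚ) * (R + (R + V))
      l₁ = solve-∀ ℚ-ring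
      main : ∀ v → s₂ a ≡ v → 0ℚ ≤ (1ℚ - ind (s₂ a)) * (R + (R + ∑ (w₂ a)))
      main true eq = subst (λ v → 0ℚ ≤ (1ℚ - ind v) * (R + (R + ∑ (w₂ a)))) (sym eq) (≤-reflexive (l₀ (R + (R + ∑ (w₂ a)))))
      main false eq = subst (λ v → 0ℚ ≤ (1ℚ - ind v) * (R + (R + ∑ (w₂ a)))) (sym eq)
        (≤-by _ (gap (B₂.Balanced.outside (proj₂ B₂.balanced) a eq) +≥ gap (∑w₂²≤ a)) (l₁ R W (∑ (w₂ a))))

    left-over : ∀ b → ∑ (λ a → (1ℚ - y₂ a) * w₂ a b) ≡ (T₁ b + σ b) - (T₂ b + ε b)
    left-over b = trans (∑-cong (λ a → d (y₂ a) (w₂ a b))) (trans (∑-- (λ a → w₂ a b) (λ a → y₂ a * w₂ a b))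
      (l (B₁.load y b) (T₁ b) (B₂.load y₂ b) (T₂ b)))
      where
      d : ∀ y w → (1ℚ - y) * w ≡ w - y * w
      d = solve-∀ ℚ-ring
      l : ∀ u t v s → u - v ≡ (t + (u - t)) - (s + (v - s))
      l = solve-∀ ℚ-ring

    colwise : ∀ b → # 2 * (∑ (λ a → (1ℚ - y₂ a) * w₂ a b) * (ε b + ε b + 1ℚ)) ≤
      (# 4 * D - # 2) * ε b + (# 2 * D * ind (β b) + (# 2 * σ b + σ b * σ b))
    colwise b = subst (λ z → # 2 * (z * (ε b + ε b + 1ℚ)) ≤ (# 4 * D - # 2) * ε b + (# 2 * D * ind (β b) + (# 2 * σ b + σ b * σ b))) (sym (left-over b)) (main (β b) refl)
      where
      l : ∀ D s e → # 2 * ((1ℚ * (D + D) + s - (1ℚ * D + e)) * (e + e + 1ℚ)) + (e + e - s) * (e + e - s)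
        ≡ (# 4 * D - # 2) * e + (# 2 * D * 1ℚ + (# 2 * s + s * s))
      l = solve-∀ ℚ-ring
      l₀ : ∀ D → # 2 * ((0ℚ * (D + D) + 0ℚ - (0ℚ * D + 0ℚ)) * (0ℚ + 0ℚ + 1ℚ))
        ≡ (# 4 * D - # 2) * 0ℚ + (# 2 * D * 0ℚ + (# 2 * 0ℚ + 0ℚ * 0ℚ))
      l₀ = solve-∀ ℚ-ring
      P : Bool → ℚ → ℚ → Set
      P v s e = # 2 * ((ind v * (D + D) + s - (ind v * D + e)) * (e + e + 1ℚ)) ≤ (# 4 * D - # 2) * e + (# 2 * D * ind v + (# 2 * s + s * s))
      main : ∀ v → β b ≡ v → P (β b) (σ b) (ε b)
      main true eq = subst (λ v → P v (σ b) (ε b)) (sym eq) (≤-by _ (sq≥0 (ε b + ε b - σ b)) (l D (σ b) (ε b)))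
      main false eq = subst (λ v → P v (σ b) (ε b)) (sym eq) (subst₂ (P false) (sym (σ-off b eq)) (sym (ε-off b eq)) (≤-reflexive (l₀ D)))

    lower₀ : 0ℚ ≤ (# 4 * D - # 2) * E + (# 2 * D * m + (# 2 * S + Q))
    lower₀ = ≤-trans
      (#≥ 2 *≥ subst (0ℚ ≤_) (∑-inner (λ a → 1ℚ - y₂ a) w₂ (λ b → ε b + ε b + 1ℚ)) (∑-nonneg slack))
      (subst₂ _≤_ (∑-* (# 2) (λ b → ∑ (λ a → (1ℚ - y₂ a) * w₂ a b) * (ε b + ε b + 1ℚ))) eq (∑-mono colwise))
      where
      eq : ∑ (λ b → (# 4 * D - # 2) * ε b + (# 2 * D * ind (β b) + (# 2 * σ b + σ b * σ b))) ≡ (# 4 * D - # 2) * E + (# 2 * D * m + (# 2 * S + Q))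
      eq = trans (∑-+ _ (λ b → # 2 * D * ind (β b) + (# 2 * σ b + σ b * σ b))) (cong₂ _+_ (∑-* (# 4 * D - # 2) ε)
        (trans (∑-+ _ (λ b → # 2 * σ b + σ b * σ b)) (cong₂ _+_ (∑-* (# 2 * D) (ind ∘ β))
          (trans (∑-+ _ (λ b → σ b * σ b)) (cong (λ z → z + Q) (∑-* (# 2) σ))))))

    -- Only a negative `E` needs work. There 4D - 2 ≥ 2D yields 2D E ≥ -(2 + 12 + 5) D m, where 12
    -- and 5 come from `S≤` and `Q≤`.
    lower : 0ℚ ≤ E + # 10 * m
    lower with ≤-total 0ℚ E
    ... | inj₁ 0≤E = 0≤E +≥ #≥ 10 *≥ 0≤m
    ... | inj₂ E≤0 = *-cancelˡ {c = # 2 * D} (<-≤-trans (positive⁻¹ (# 2)) (subst (_≤ # 2 * D) (*-identityʳ (# 2)) (*-monoˡ (#≥ 2) 1≤D)))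
      (≤-by _ (lower₀ +≥ gap (*-monoˡ {c = # 2 * (D - 1ℚ)} (#≥ 2 *≥ gap 1≤D) E≤0) +≥ #≥ 2 *≥ gap S≤ +≥ gap Q≤ +≥ 0≤D *≥ 0≤m) (l Q S D m E))
      where
      l : ∀ Q S D m E → # 2 * D * 0ℚ + (((# 4 * D - # 2) * E + (# 2 * D * m + (# 2 * S + Q))) + (# 2 * (D - 1ℚ) * 0ℚ - # 2 * (D - 1ℚ) * E)
        + # 2 * (# 6 * D * m - S) + (# 5 * D * m - Q) + D * m) ≡ # 2 * D * (E + # 10 * m)
      l = solve-∀ ℚ-ring

  opaque
    -- Rows off `act` carry no weight, and rows outside `s₁` carry none in the second round, so `s₂`
    -- may contain either. Intersecting leaves the second-round loads as they are and gives every
    -- remaining row the total `D`.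
    A′ : Mask p
    A′ a = s₁ a ∧ (s₂ a ∧ act a)

  excess : Fin q → ℚ
  excess b = ∑ (λ a → ind (A′ a) * w a b) - ind (β b) * D

  opaque
    unfolding A′

    A′⊆act : ∀ a → A′ a ≡ true → act a ≡ true
    A′⊆act a h with s₁ a | s₂ a | act a
    ... | true | true | true = refl

    load-A′ : ∀ a b → y₂ a * w₂ a b ≡ ind (A′ a) * w a b
    load-A′ a b = trans (main (act a) refl) (cong (_* w a b) (sym (trans (ind-∧ (s₁ a) (s₂ a ∧ act a)) (cong (y a *_) (ind-∧ (s₂ a) (act a))))))
      where
      l : ∀ u v w → v * (u * w) ≡ u * (v * 1ℚ) * w
      l = solve-∀ ℚ-ring
      l₀ : ∀ u v k → v * (u * 0ℚ) ≡ u * (v * k) * 0ℚ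
      l₀ = solve-∀ ℚ-ring
      main : ∀ v → act a ≡ v → y₂ a * (y a * w a b) ≡ y a * (y₂ a * ind (act a)) * w a b
      main true eq = trans (l (y a) (y₂ a) (w a b)) (cong (λ v → y a * (y₂ a * ind v) * w a b) (sym eq))
      main false eq = subst (λ z → y₂ a * (y a * z) ≡ y a * (y₂ a * ind (act a)) * z) (sym (w-act a b eq)) (l₀ (y a) (y₂ a) (ind (act a)))

    ε-excess : ∀ b → ε b ≡ excess b
    ε-excess b = cong (_- T₂ b) (∑-cong (λ a → load-A′ a b))

    total : E ≡ D * ∑ (ind ∘ A′) - D * m
    total = begin
      ∑ ε ≡⟨ ∑-cong ε-excess ⟩
      ∑ excess ≡⟨ ∑-- (λ b → ∑ (λ a → ind (A′ a) * w a b)) T₂ ⟩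
      ∑ (λ b → ∑ (λ a → ind (A′ a) * w a b)) - ∑ T₂ ≡⟨ cong₂ _-_
          (trans (sym (∑-inner₁ (ind ∘ A′) w)) (trans (∑-cong (λ a → pt a (A′ a) refl)) (∑-* D (ind ∘ A′))))
          (trans (∑-*ʳ D (ind ∘ β)) (*-comm m D)) ⟩
      D * ∑ (ind ∘ A′) - D * m ∎
      where
      open ≡-Reasoning
      pt : ∀ a v → A′ a ≡ v → ind (A′ a) * ∑ (w a) ≡ D * ind (A′ a)
      pt a true eq = trans (cong (ind (A′ a) *_) (trans (row a) (trans (cong (λ v → ind v * D) (A′⊆act a eq)) (*-identityˡ D)))) (*-comm _ D)
      pt a false eq = subst (λ v → ind v * ∑ (w a) ≡ D * ind v) (sym eq) (trans (*-zeroˡ (∑ (w a))) (sym (*-zeroʳ D)))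

    A′-large : D * m ≤ D * ∑ (ind ∘ A′) + # 10 * m
    A′-large = ≤-by _ (subst (λ z → 0ℚ ≤ z + # 10 * m) total lower) (l (D * m) (D * ∑ (ind ∘ A′)) (# 10 * m))
      where
      l : ∀ x y z → x + (y - x + z) ≡ y + z
      l = solve-∀ ℚ-ring

    A′-stable : ∀ a → A′ a ≡ true → ∑ (λ b → w a b * excess b) + ∑ (λ b → w a b * excess b) ≤ D
    A′-stable a h = subst₂ _≤_ (cong (λ z → z + z) (∑-cong (λ b → cong₂ _*_ (w₂≡w b) (ε-excess b))))
      (trans (∑-cong w₂≡w) (trans (row a) (trans (cong (λ v → ind v * D) (A′⊆act a h)) (*-identityˡ D))))
      (≤-trans (B₂.Balanced.inside (proj₂ B₂.balanced) a (in₂ h)) (∑w₂²≤ a))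
      where
      in₁ : A′ a ≡ true → s₁ a ≡ true
      in₁ h with s₁ a
      ... | true = refl
      in₂ : A′ a ≡ true → s₂ a ≡ true
      in₂ h with s₁ a | s₂ a
      ... | true | true = refl
      w₂≡w : ∀ b → w₂ a b ≡ w a b
      w₂≡w b = trans (cong (λ v → ind v * w a b) (in₁ h)) (*-identityˡ (w a b))

-- Maximum capped subgraphs of bipartite graphs

opaque
  ∑ℕ : ∀ {n} → (Fin n → ℕ) → ℕ
  ∑ℕ = sumℕ

  ∑ℕ-0 : (f : Fin 0 → ℕ) → ∑ℕ f ≡ 0
  ∑ℕ-0 f = refl

  ∑ℕ-suc : ∀ {n} (f : Fin (suc n) → ℕ) → ∑ℕ f ≡ f zero ℕ.+ ∑ℕ (f ∘ suc)
  ∑ℕ-suc f = refl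

  ∑ℕ-cong : ∀ {n} {f g : Fin n → ℕ} → (∀ i → f i ≡ g i) → ∑ℕ f ≡ ∑ℕ g
  ∑ℕ-cong = sumℕ-cong

  ∑ℕ-mono : ∀ {n} {f g : Fin n → ℕ} → (∀ i → f i ℕ.≤ g i) → ∑ℕ f ℕ.≤ ∑ℕ g
  ∑ℕ-mono {zero}  h = ℕP.≤-refl
  ∑ℕ-mono {suc n} h = ℕP.+-mono-≤ (h zero) (∑ℕ-mono (h ∘ suc))

  ∑ℕ-zero : ∀ n → ∑ℕ {n} (λ _ → 0) ≡ 0
  ∑ℕ-zero zero    = refl
  ∑ℕ-zero (suc n) = ∑ℕ-zero n

  term≤∑ℕ : ∀ {n} (f : Fin n → ℕ) i → f i ℕ.≤ ∑ℕ f
  term≤∑ℕ f zero    = ℕP.m≤m+n _ _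
  term≤∑ℕ f (suc i) = ℕP.≤-trans (term≤∑ℕ (f ∘ suc) i) (ℕP.m≤n+m _ _)

  -- Written with both terms added, so that no truncated subtraction occurs; the changes of degrees
  -- and size under `put` inherit this form.
  ∑ℕ-update : ∀ {n} (f g : Fin n → ℕ) i → (∀ k → k ≢ i → f k ≡ g k) → ∑ℕ f ℕ.+ g i ≡ ∑ℕ g ℕ.+ f i
  ∑ℕ-update f g zero h = begin
    f zero ℕ.+ ∑ℕ (f ∘ suc) ℕ.+ g zero ≡⟨ cong (λ z → f zero ℕ.+ z ℕ.+ g zero) (∑ℕ-cong (λ k → h (suc k) (λ ()))) ⟩
    f zero ℕ.+ ∑ℕ (g ∘ suc) ℕ.+ g zero ≡⟨ ℕP.+-comm (f zero ℕ.+ ∑ℕ (g ∘ suc)) (g zero) ⟩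
    g zero ℕ.+ (f zero ℕ.+ ∑ℕ (g ∘ suc)) ≡⟨ cong (λ z → g zero ℕ.+ z) (ℕP.+-comm (f zero) (∑ℕ (g ∘ suc))) ⟩
    g zero ℕ.+ (∑ℕ (g ∘ suc) ℕ.+ f zero) ≡⟨ ℕP.+-assoc (g zero) _ _ ⟨
    g zero ℕ.+ ∑ℕ (g ∘ suc) ℕ.+ f zero ∎
    where open ≡-Reasoning
  ∑ℕ-update f g (suc i) h = begin
    f zero ℕ.+ ∑ℕ (f ∘ suc) ℕ.+ g (suc i) ≡⟨ ℕP.+-assoc (f zero) _ _ ⟩
    f zero ℕ.+ (∑ℕ (f ∘ suc) ℕ.+ g (suc i)) ≡⟨ cong₂ ℕ._+_ (h zero (λ ())) (∑ℕ-update (f ∘ suc) (g ∘ suc) i (λ k ne → h (suc k) (λ eq → ne (FinP.suc-injective eq)))) ⟩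
    g zero ℕ.+ (∑ℕ (g ∘ suc) ℕ.+ f (suc i)) ≡⟨ ℕP.+-assoc (g zero) _ _ ⟨
    g zero ℕ.+ ∑ℕ (g ∘ suc) ℕ.+ f (suc i) ∎
    where open ≡-Reasoning

bit : Bool → ℕ
bit true  = 1
bit false = 0

module Edges {p q : ℕ} where

  Edges : Set
  Edges = Fin p → Fin q → Bool

  rowdeg : Edges → Fin p → ℕ
  rowdeg H a = ∑ℕ (λ b → bit (H a b))

  coldeg : Edges → Fin q → ℕ
  coldeg H b = ∑ℕ (λ a → bit (H a b))

  size : Edges → ℕ
  size H = ∑ℕ (rowdeg H)

  put : Edges → Fin p → Fin q → Bool → Edges
  put H a b v a′ b′ with a′ FinP.≟ a | b′ FinP.≟ b
  ... | yes _ | yes _ = v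
  ... | yes _ | no _  = H a′ b′
  ... | no _  | _     = H a′ b′

  put-same : ∀ H a b v → put H a b v a b ≡ v
  put-same H a b v with a FinP.≟ a | b FinP.≟ b
  ... | yes _ | yes _ = refl
  ... | yes _ | no ne = contradiction refl ne
  ... | no ne | _     = contradiction refl ne

  put-row : ∀ H a b v {a′} b′ → a′ ≢ a → put H a b v a′ b′ ≡ H a′ b′
  put-row H a b v {a′} b′ ne with a′ FinP.≟ a | b′ FinP.≟ b
  ... | yes eq | _ = contradiction eq ne
  ... | no _ | _ = refl

  put-col : ∀ H a b v a′ {b′} → b′ ≢ b → put H a b v a′ b′ ≡ H a′ b′
  put-col H a b v a′ {b′} ne with a′ FinP.≟ a | b′ FinP.≟ b
  ... | yes _ | yes eq = contradiction eq ne
  ... | yes _ | no _ = refl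
  ... | no _ | _ = refl

  rowdeg-put-≢ : ∀ H a b v {a′} → a′ ≢ a → rowdeg (put H a b v) a′ ≡ rowdeg H a′
  rowdeg-put-≢ H a b v ne = ∑ℕ-cong (λ b′ → cong bit (put-row H a b v b′ ne))

  coldeg-put-≢ : ∀ H a b v {b′} → b′ ≢ b → coldeg (put H a b v) b′ ≡ coldeg H b′
  coldeg-put-≢ H a b v ne = ∑ℕ-cong (λ a′ → cong bit (put-col H a b v a′ ne))

  rowdeg-put : ∀ H a b v → rowdeg (put H a b v) a ℕ.+ bit (H a b) ≡ rowdeg H a ℕ.+ bit v
  rowdeg-put H a b v = trans (∑ℕ-update _ _ b (λ k ne → cong bit (put-col H a b v a ne)))
    (cong (λ z → rowdeg H a ℕ.+ bit z) (put-same H a b v))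

  coldeg-put : ∀ H a b v → coldeg (put H a b v) b ℕ.+ bit (H a b) ≡ coldeg H b ℕ.+ bit v
  coldeg-put H a b v = trans (∑ℕ-update _ _ a (λ k ne → cong bit (put-row H a b v b ne)))
    (cong (λ z → coldeg H b ℕ.+ bit z) (put-same H a b v))

  size-put : ∀ H a b v → size (put H a b v) ℕ.+ bit (H a b) ≡ size H ℕ.+ bit v
  size-put H a b v = ℕP.+-cancelʳ-≡ (rowdeg H a) _ _ (begin
    size H′ ℕ.+ bit (H a b) ℕ.+ rowdeg H a   ≡⟨ swap₃ (size H′) _ _ ⟩
    size H′ ℕ.+ rowdeg H a ℕ.+ bit (H a b)   ≡⟨ cong (ℕ._+ bit (H a b)) (∑ℕ-update (rowdeg H′) (rowdeg H) a (λ k ne → rowdeg-put-≢ H a b v ne)) ⟩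
    size H ℕ.+ rowdeg H′ a ℕ.+ bit (H a b)   ≡⟨ ℕP.+-assoc (size H) _ _ ⟩
    size H ℕ.+ (rowdeg H′ a ℕ.+ bit (H a b)) ≡⟨ cong (λ z → size H ℕ.+ z) (trans (rowdeg-put H a b v) (ℕP.+-comm (rowdeg H a) (bit v))) ⟩
    size H ℕ.+ (bit v ℕ.+ rowdeg H a)        ≡⟨ ℕP.+-assoc (size H) _ _ ⟨
    size H ℕ.+ bit v ℕ.+ rowdeg H a          ∎)
    where
    open ≡-Reasoning
    H′ : Edges
    H′ = put H a b v
    swap₃ : ∀ x y z → x ℕ.+ y ℕ.+ z ≡ x ℕ.+ z ℕ.+ y
    swap₃ x y z = trans (ℕP.+-assoc x y z) (trans (cong (λ t → x ℕ.+ t) (ℕP.+-comm y z)) (sym (ℕP.+-assoc x z y)))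

module König {p q : ℕ} (E : Fin p → Fin q → Bool) (K : ℕ) where

  open Edges {p} {q}

  record Capped (H : Edges) : Set where
    field
      inc  : ∀ a b → H a b ≡ true → E a b ≡ true
      rows : ∀ a → rowdeg H a ℕ.≤ K
      cols : ∀ b → coldeg H b ℕ.≤ K
  open Capped

  -- Walks alternating between unused and used edges and ending with an unused edge at an unsaturated column.
  data Alt (H : Edges) : Fin p → ℕ → Set where
    here : ∀ {a} b → E a b ≡ true → H a b ≡ false → coldeg H b ℕ.< K → Alt H a 0
    step : ∀ {a a′ k} b → E a b ≡ true → H a b ≡ false → H a′ b ≡ true → Alt H a′ k → Alt H a (suc k)

  +0-1 : ∀ {x y v} → v ≡ false → x ℕ.+ bit v ≡ y ℕ.+ 1 → x ≡ suc y
  +0-1 {x} {y} refl eq = trans (sym (ℕP.+-identityʳ x)) (trans eq (ℕP.+-comm y 1))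

  +1-0 : ∀ {x y v} → v ≡ true → x ℕ.+ bit v ≡ y ℕ.+ 0 → suc x ≡ y
  +1-0 {x} {y} refl eq = trans (ℕP.+-comm 1 x) (trans eq (ℕP.+-identityʳ y))

  sub-put-true : ∀ {H} a b → (∀ a′ b′ → H a′ b′ ≡ true → E a′ b′ ≡ true) → E a b ≡ true →
    ∀ a′ b′ → put H a b true a′ b′ ≡ true → E a′ b′ ≡ true
  sub-put-true a b s e a′ b′ h with a′ FinP.≟ a | b′ FinP.≟ b
  ... | yes refl | yes refl = e
  ... | yes _ | no _ = s a′ b′ h
  ... | no _ | _ = s a′ b′ h

  sub-put-false : ∀ {H} a b → (∀ a′ b′ → H a′ b′ ≡ true → E a′ b′ ≡ true) →
    ∀ a′ b′ → put H a b false a′ b′ ≡ true → E a′ b′ ≡ true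
  sub-put-false a b s a′ b′ h with a′ FinP.≟ a | b′ FinP.≟ b
  ... | yes _ | no _ = s a′ b′ h
  ... | no _ | _ = s a′ b′ h

  true≢false : ∀ {v} → v ≡ true → v ≡ false → ⊥
  true≢false refl ()

  -- Replacing the edge `a₁ b` by `a b` passes the spare capacity of row `a` on to row `a₁`, without
  -- changing column degrees or the size. A walk is thus augmented one step at a time and need not
  -- be a path.
  module Exchange (H : Edges) (a a₁ : Fin p) (b : Fin q) (Hab : H a b ≡ false) (Ha₁b : H a₁ b ≡ true) where

    a₁≢a : a₁ ≢ a
    a₁≢a refl = true≢false Ha₁b Hab

    H₀ H₁ : Edges
    H₀ = put H a₁ b false
    H₁ = put H₀ a b true

    H₀ab : H₀ a b ≡ false
    H₀ab = trans (put-row H a₁ b false b (a₁≢a ∘ sym)) Hab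

    same : ∀ c {b′} → b′ ≢ b → H₁ c b′ ≡ H c b′
    same c ne = trans (put-col H₀ a b true c ne) (put-col H a₁ b false c ne)

    coldeg-same : ∀ b′ → coldeg H₁ b′ ≡ coldeg H b′
    coldeg-same b′ = go (b′ FinP.≟ b)
      where
      go : Dec (b′ ≡ b) → coldeg H₁ b′ ≡ coldeg H b′
      go (yes refl) = trans (+0-1 H₀ab (coldeg-put H₀ a b true)) (+1-0 Ha₁b (coldeg-put H a₁ b false))
      go (no ne) = trans (coldeg-put-≢ H₀ a b true ne) (coldeg-put-≢ H a₁ b false ne)

    rowdeg-a : rowdeg H₁ a ≡ suc (rowdeg H a)
    rowdeg-a = trans (+0-1 H₀ab (rowdeg-put H₀ a b true)) (cong suc (rowdeg-put-≢ H a₁ b false (a₁≢a ∘ sym)))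

    rowdeg-a₁ : suc (rowdeg H₁ a₁) ≡ rowdeg H a₁
    rowdeg-a₁ = trans (cong suc (rowdeg-put-≢ H₀ a b true a₁≢a)) (+1-0 Ha₁b (rowdeg-put H a₁ b false))

    rowdeg-other : ∀ c → c ≢ a → c ≢ a₁ → rowdeg H₁ c ≡ rowdeg H c
    rowdeg-other c ne ne₁ = trans (rowdeg-put-≢ H₀ a b true ne) (rowdeg-put-≢ H a₁ b false ne₁)

    size-same : size H₁ ≡ size H
    size-same = trans (+0-1 H₀ab (size-put H₀ a b true)) (+1-0 Ha₁b (size-put H a₁ b false))

    capped : Capped H → E a b ≡ true → rowdeg H a ℕ.< K → Capped H₁
    capped v e lt = record
      { inc = sub-put-true a b (sub-put-false a₁ b (inc v)) e
      ; rows = rows′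
      ; cols = λ b′ → subst (ℕ._≤ K) (sym (coldeg-same b′)) (cols v b′) }
      where
      rows′ : ∀ c → rowdeg H₁ c ℕ.≤ K
      rows′ c = go (c FinP.≟ a) (c FinP.≟ a₁)
        where
        go : Dec (c ≡ a) → Dec (c ≡ a₁) → rowdeg H₁ c ℕ.≤ K
        go (yes refl) _ = subst (ℕ._≤ K) (sym rowdeg-a) lt
        go (no _) (yes refl) = ℕP.≤-trans (ℕP.n≤1+n _) (subst (ℕ._≤ K) (sym rowdeg-a₁) (rows v c))
        go (no ne) (no ne₁) = subst (ℕ._≤ K) (sym (rowdeg-other c ne ne₁)) (rows v c)

    -- A walk meeting the column b can be entered there directly from a.
    transfer : E a b ≡ true → ∀ {c k} → Alt H c k → Alt H₁ c k ⊎ (∃[ j ] (j ℕ.≤ k × Alt H a j))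
    transfer e (here b′ e′ h′ lt) with b′ FinP.≟ b
    ... | yes refl = inj₂ (0 , ℕ.z≤n , here b e Hab lt)
    ... | no ne = inj₁ (here b′ e′ (trans (same _ ne) h′) (subst (ℕ._< K) (sym (coldeg-same b′)) lt))
    transfer e (step {k = k} b′ e′ h′ h″ P) with b′ FinP.≟ b
    ... | yes refl = inj₂ (suc k , ℕP.≤-refl , step b e Hab h″ P)
    ... | no ne with transfer e P
    ...   | inj₁ P′ = inj₁ (step b′ e′ (trans (same _ ne) h′) (trans (same _ ne) h″) P′)
    ...   | inj₂ (j , le , P′) = inj₂ (j , ℕP.≤-trans le (ℕP.n≤1+n k) , P′)

  -- `n` bounds the length of the walk. After an exchange the rest of the walk either survives,
  -- starting at `a₁`, which has just lost an edge, or it meets the column `b`, and then a shorter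
  -- walk from `a` exists already before the exchange. The length drops in both cases.
  augment : ∀ n k → k ℕ.< n → ∀ H → Capped H → ∀ a → rowdeg H a ℕ.< K → Alt H a k →
    ∃[ H′ ] (Capped H′ × size H′ ≡ suc (size H))
  augment (suc n) _ _ H v a lt (here b e h lt′) = H′ , record
    { inc = sub-put-true a b (inc v) e ; rows = rows′ ; cols = cols′ } , +0-1 h (size-put H a b true)
    where
    H′ : Edges
    H′ = put H a b true
    rows′ : ∀ c → rowdeg H′ c ℕ.≤ K
    rows′ c = go (c FinP.≟ a)
      where
      go : Dec (c ≡ a) → rowdeg H′ c ℕ.≤ K
      go (yes refl) = subst (ℕ._≤ K) (sym (+0-1 h (rowdeg-put H a b true))) lt
      go (no ne) = subst (ℕ._≤ K) (sym (rowdeg-put-≢ H a b true ne)) (rows v c)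
    cols′ : ∀ c → coldeg H′ c ℕ.≤ K
    cols′ c = go (c FinP.≟ b)
      where
      go : Dec (c ≡ b) → coldeg H′ c ℕ.≤ K
      go (yes refl) = subst (ℕ._≤ K) (sym (+0-1 h (coldeg-put H a b true))) lt′
      go (no ne) = subst (ℕ._≤ K) (sym (coldeg-put-≢ H a b true ne)) (cols v c)
  augment (suc n) (suc k) k<n H v a lt (step {a′ = a₁} b e h h₁ P) with Exchange.transfer H a a₁ b h h₁ e P
  ... | inj₂ (j , j≤k , P′) = augment n j (ℕP.≤-<-trans j≤k (ℕP.≤-pred k<n)) H v a lt P′
  ... | inj₁ P′ with augment n k (ℕP.≤-pred k<n) (Exchange.H₁ H a a₁ b h h₁) (Exchange.capped H a a₁ b h h₁ v e lt) a₁
                      (subst (ℕ._≤ K) (sym (Exchange.rowdeg-a₁ H a a₁ b h h₁)) (rows v a₁)) P′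
  ...   | H′ , v′ , eq = H′ , v′ , trans eq (cong suc (Exchange.size-same H a a₁ b h h₁))

  module Closure (H : Edges) where

    -- One step backwards along an alternating walk; `Reaching` and `Closed` together make `P`
    -- exactly the set of rows at which such walks start.
    Extends : Mask p → Fin p → Set
    Extends P a = ∃[ b ] (E a b ≡ true × H a b ≡ false × (coldeg H b ℕ.< K ⊎ ∃[ a′ ] (H a′ b ≡ true × P a′ ≡ true)))

    extends? : ∀ P a → Dec (Extends P a)
    extends? P a = FinP.any? (λ b → (E a b ≟ᵇ true) ×-dec ((H a b ≟ᵇ false) ×-dec
      ((coldeg H b ℕP.<? K) ⊎-dec FinP.any? (λ a′ → (H a′ b ≟ᵇ true) ×-dec (P a′ ≟ᵇ true)))))

    Reaching : Mask p → Set
    Reaching P = ∀ a → P a ≡ true → ∃[ k ] Alt H a k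

    Closed : Mask p → Set
    Closed P = ∀ a → P a ≡ false → ¬ Extends P a

    insert : Mask p → Fin p → Mask p
    insert P a k with k FinP.≟ a
    ... | yes _ = true
    ... | no _  = P k

    insert-self : ∀ P a → insert P a a ≡ true
    insert-self P a with a FinP.≟ a
    ... | yes _ = refl
    ... | no ne = contradiction refl ne

    insert-≢ : ∀ P a {k} → k ≢ a → insert P a k ≡ P k
    insert-≢ P a {k} ne with k FinP.≟ a
    ... | yes eq = contradiction eq ne
    ... | no _ = refl

    missing : Mask p → ℕ
    missing P = ∑ℕ (λ a → bit (not (P a)))

    missing-insert : ∀ P a → P a ≡ false → suc (missing (insert P a)) ≡ missing P
    missing-insert P a h = trans (ℕP.+-comm 1 _) (trans
      (subst₂ (λ u v → missing (insert P a) ℕ.+ bit (not u) ≡ missing P ℕ.+ bit (not v)) h (insert-self P a)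
        (∑ℕ-update _ _ a (λ k ne → cong (bit ∘ not) (insert-≢ P a ne))))
      (ℕP.+-identityʳ _))

    reach : ∀ P → Reaching P → ∀ a → Extends P a → ∃[ k ] Alt H a k
    reach P r a (b , e , h , inj₁ lt) = 0 , here b e h lt
    reach P r a (b , e , h , inj₂ (a′ , h′ , Pa′)) = suc (proj₁ (r a′ Pa′)) , step b e h h′ (proj₂ (r a′ Pa′))

    insert-reaching : ∀ P → Reaching P → ∀ a → Extends P a → Reaching (insert P a)
    insert-reaching P r a ext k h with k FinP.≟ a
    ... | yes refl = reach P r a ext
    ... | no _ = r k h

    close : ∀ n P → missing P ℕ.≤ n → Reaching P → ∃[ P′ ] (Reaching P′ × Closed P′)
    close n P le r with FinP.any? (λ a → (P a ≟ᵇ false) ×-dec extends? P a)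
    ... | no none = P , r , λ a h ext → none (a , h , ext)
    close zero P le r | yes (a , h , ext) = contradiction (subst (ℕ._≤ 0) (sym (missing-insert P a h)) le) λ ()
    close (suc n) P le r | yes (a , h , ext) =
      close n (insert P a) (ℕP.≤-pred (subst (ℕ._≤ suc n) (sym (missing-insert P a h)) le)) (insert-reaching P r a ext)

  record Result : Set where
    field
      H : Edges
      capped : Capped H
      P : Mask p
      Z : Mask q
      P-full : ∀ a → P a ≡ true → rowdeg H a ≡ K
      Z-full : ∀ b → Z b ≡ true → coldeg H b ≡ K
      PZ : ∀ a b → P a ≡ true → Z b ≡ true → H a b ≡ false
      cover : ∀ a b → P a ≡ false → Z b ≡ false → E a b ≡ true → H a b ≡ true

  empty : Edges
  empty _ _ = false

  empty-capped : Capped empty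
  empty-capped = record { inc = λ _ _ () ; rows = λ _ → subst (ℕ._≤ K) (sym (∑ℕ-zero q)) ℕ.z≤n ; cols = λ _ → subst (ℕ._≤ K) (sym (∑ℕ-zero p)) ℕ.z≤n }

  bound : ℕ
  bound = ∑ℕ {p} (λ _ → K)

  -- `n` counts the augmentations still possible: the row caps keep the size of `H` below `bound`,
  -- so an augmentation at `n` = 0 is contradictory.
  search : ∀ n H → Capped H → bound ℕ.≤ n ℕ.+ size H → Result
  search n H v le with Closure.close H (Closure.missing H (λ _ → false)) (λ _ → false) ℕP.≤-refl (λ _ ())
  ... | P , reaching , closed with FinP.any? (λ a → (P a ≟ᵇ true) ×-dec (rowdeg H a ℕP.<? K))
  search n H v le | P , reaching , closed | yes (a , Pa , lt) with reaching a Pa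
  ... | k , alt with augment (suc k) k ℕP.≤-refl H v a lt alt
  search zero H v le | P , reaching , closed | yes (a , Pa , lt) | k , alt | H′ , v′ , eq =
    contradiction (ℕP.≤-trans (ℕP.≤-reflexive (sym eq)) (ℕP.≤-trans (∑ℕ-mono (rows v′)) le)) (ℕP.<-irrefl refl)
  search (suc n) H v le | P , reaching , closed | yes (a , Pa , lt) | k , alt | H′ , v′ , eq =
    search n H′ v′ (ℕP.≤-trans le (ℕP.≤-reflexive (trans (sym (ℕP.+-suc n (size H))) (cong (λ z → n ℕ.+ z) (sym eq)))))
  search n H v le | P , reaching , closed | no none = record
    { H = H ; capped = v ; P = P ; Z = Z
    ; P-full = λ a Pa → ℕP.≤-antisym (rows v a) (ℕP.≮⇒≥ (λ lt → none (a , Pa , lt)))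
    ; Z-full = λ b Zb → ℕP.≤-antisym (cols v b) (proj₁ (Z-sound b Zb))
    ; PZ = λ a b Pa Zb → not-true (λ h → true≢false Pa (proj₂ (Z-sound b Zb) a h))
    ; cover = λ a b Pa Zb e → not-false (λ h → true≢false (Z-complete b (ℕP.≮⇒≥ (λ lt → closed a Pa (b , e , h , inj₁ lt)) ,
        (λ a′ h′ → not-true (λ Pa′ → closed a Pa (b , e , h , inj₂ (a′ , h′ , Pa′)))))) Zb) }
    where
    not-true : ∀ {x} → (x ≡ true → ⊥) → x ≡ false
    not-true {true} f = ⊥-elim (f refl)
    not-true {false} f = refl
    not-false : ∀ {x} → (x ≡ false → ⊥) → x ≡ true
    not-false {true} f = refl
    not-false {false} f = ⊥-elim (f refl)
    Zp : Fin q → Set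
    Zp b = K ℕ.≤ coldeg H b × (∀ a → H a b ≡ true → P a ≡ false)
    Z? : ∀ b → Dec (Zp b)
    Z? b = (K ℕP.≤? coldeg H b) ×-dec FinP.all? (λ a → (H a b ≟ᵇ true) →-dec (P a ≟ᵇ false))
    Z : Mask q
    Z b = does (Z? b)
    Z-sound : ∀ b → Z b ≡ true → Zp b
    Z-sound b h = does-true (Z? b) h
    Z-complete : ∀ b → Zp b → Z b ≡ true
    Z-complete b z = dec-true (Z? b) z

  opaque
    könig : Result
    könig = search bound empty empty-capped (ℕP.m≤m+n bound (size empty))

-- The cut inequality for a maximum capped subgraph

opaque
  ι-∑ : ∀ {n} (f : Fin n → ℕ) → ι (∑ℕ f) ≡ ∑ (ι ∘ f)
  ι-∑ {zero}  f = trans (cong ι (∑ℕ-0 f)) (trans ι0 (sym (∑-0 (ι ∘ f))))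
  ι-∑ {suc n} f = trans (cong ι (∑ℕ-suc f)) (trans (ι-+ (f zero) (∑ℕ (f ∘ suc)))
    (trans (cong (λ z → ι (f zero) + z) (ι-∑ (f ∘ suc))) (sym (∑-suc (ι ∘ f)))))

  ι-bit : ∀ b → ι (bit b) ≡ ind b
  ι-bit true  = ι1
  ι-bit false = ι0

  ι-∑bit : ∀ {n} (s : Mask n) → ι (∑ℕ (bit ∘ s)) ≡ ∑ (ind ∘ s)
  ι-∑bit s = trans (ι-∑ (bit ∘ s)) (∑-cong (ι-bit ∘ s))

module Count {p q} (E : Fin p → Fin q → Bool) (K : ℕ) where

  open König E K
  open Result könig public using (H; P; Z; capped)
  open Result könig using (P-full; Z-full; PZ; cover)
  open Edges {p} {q}

  h : Fin p → Fin q → ℚ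
  h a b = ind (H a b)

  k e : ℚ
  k = ι K
  e = ∑ (λ a → ∑ (h a))

  uncovered : Fin p → Fin q → ℚ
  uncovered a b = (1ℚ - ind (P a)) * ((1ℚ - ind (Z b)) * ind (E a b))

  opaque
    hrow : ∀ a → ∑ (h a) ≡ ι (rowdeg H a)
    hrow a = sym (ι-∑bit (H a))

    hcol : ∀ b → ∑ (λ a → h a b) ≡ ι (coldeg H b)
    hcol b = sym (ι-∑bit (λ a → H a b))

    split : ∀ a b → ind (P a) * h a b + (ind (Z b) * h a b + uncovered a b) ≤ h a b
    split a b = main (P a) (Z b) refl refl
      where
      G : Bool → Bool → ℚ → Set
      G u v t = ind u * t + (ind v * t + (1ℚ - ind u) * ((1ℚ - ind v) * ind (E a b))) ≤ t
      l₁ : ∀ e → 1ℚ * 0ℚ + (1ℚ * 0ℚ + (1ℚ - 1ℚ) * ((1ℚ - 1ℚ) * e)) ≡ 0ℚ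
      l₁ = solve-∀ ℚ-ring
      l₂ : ∀ t e → 1ℚ * t + (0ℚ * t + (1ℚ - 1ℚ) * ((1ℚ - 0ℚ) * e)) ≡ t
      l₂ = solve-∀ ℚ-ring
      l₃ : ∀ t e → 0ℚ * t + (1ℚ * t + (1ℚ - 0ℚ) * ((1ℚ - 1ℚ) * e)) ≡ t
      l₃ = solve-∀ ℚ-ring
      l₄ : ∀ t e → 0ℚ * t + (0ℚ * t + (1ℚ - 0ℚ) * ((1ℚ - 0ℚ) * e)) ≡ e
      l₄ = solve-∀ ℚ-ring
      covered : P a ≡ false → Z b ≡ false → ind (E a b) ≤ h a b
      covered Pa Zb = c (E a b) refl
        where
        c : ∀ v → E a b ≡ v → ind (E a b) ≤ h a b
        c true eq = ≤-reflexive (trans (cong ind eq) (sym (cong ind (cover a b Pa Zb eq))))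
        c false eq = subst (λ v → ind v ≤ h a b) (sym eq) (0≤ind (H a b))
      main : ∀ u v → P a ≡ u → Z b ≡ v → G (P a) (Z b) (h a b)
      main true true eq eq′ = subst₂ (λ u v → G u v (h a b)) (sym eq) (sym eq′)
        (subst (G true true) (sym (cong ind (PZ a b eq eq′))) (≤-reflexive (l₁ (ind (E a b)))))
      main true false eq eq′ = subst₂ (λ u v → G u v (h a b)) (sym eq) (sym eq′) (≤-reflexive (l₂ (h a b) (ind (E a b))))
      main false true eq eq′ = subst₂ (λ u v → G u v (h a b)) (sym eq) (sym eq′) (≤-reflexive (l₃ (h a b) (ind (E a b))))
      main false false eq eq′ = subst₂ (λ u v → G u v (h a b)) (sym eq) (sym eq′)
        (≤-trans (≤-reflexive (l₄ (h a b) (ind (E a b)))) (covered eq eq′))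

    P-part : ∑ (λ a → ind (P a) * ∑ (h a)) ≡ k * ∑ (ind ∘ P)
    P-part = trans (∑-cong (λ a → pt a (P a) refl)) (∑-* k (ind ∘ P))
      where
      pt : ∀ a v → P a ≡ v → ind (P a) * ∑ (h a) ≡ k * ind (P a)
      pt a true eq = trans (cong (ind (P a) *_) (trans (hrow a) (cong ι (P-full a eq)))) (*-comm (ind (P a)) k)
      pt a false eq = subst (λ v → ind v * ∑ (h a) ≡ k * ind v) (sym eq) (trans (*-zeroˡ (∑ (h a))) (sym (*-zeroʳ k)))

    Z-part : ∑ (λ b → ind (Z b) * ∑ (λ a → h a b)) ≡ k * ∑ (ind ∘ Z)
    Z-part = trans (∑-cong (λ b → pt b (Z b) refl)) (∑-* k (ind ∘ Z))
      where
      pt : ∀ b v → Z b ≡ v → ind (Z b) * ∑ (λ a → h a b) ≡ k * ind (Z b)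
      pt b true eq = trans (cong (ind (Z b) *_) (trans (hcol b) (cong ι (Z-full b eq)))) (*-comm (ind (Z b)) k)
      pt b false eq = subst (λ v → ind v * ∑ (λ a → h a b) ≡ k * ind v) (sym eq) (trans (*-zeroˡ (∑ (λ a → h a b))) (sym (*-zeroʳ k)))

    ∑∑-+₃ : ∀ (f g u : Fin p → Fin q → ℚ) → ∑ (λ a → ∑ (λ b → f a b + (g a b + u a b))) ≡
      ∑ (λ a → ∑ (f a)) + (∑ (λ b → ∑ (λ a → g a b)) + ∑ (λ a → ∑ (u a)))
    ∑∑-+₃ f g u = trans (∑-cong (λ a → trans (∑-+ (f a) (λ b → g a b + u a b)) (cong (λ z → ∑ (f a) + z) (∑-+ (g a) (u a)))))
      (trans (∑-+ (λ a → ∑ (f a)) (λ a → ∑ (g a) + ∑ (u a))) (cong (λ z → ∑ (λ a → ∑ (f a)) + z)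
        (trans (∑-+ (λ a → ∑ (g a)) (λ a → ∑ (u a))) (cong (λ z → z + ∑ (λ a → ∑ (u a))) (∑-swap g)))))

    -- Duality: rows of `P` and columns of `Z` are full and share no edge of `H`, and all edges of
    -- `E` that avoid both lie in `H`. Matchings use it with cap 1, `Cut` with cap D/2.
    count : k * ∑ (ind ∘ P) + (k * ∑ (ind ∘ Z) + ∑ (λ a → ∑ (uncovered a))) ≤ e
    count = subst (_≤ e) (trans (∑∑-+₃ (λ a b → ind (P a) * h a b) (λ a b → ind (Z b) * h a b) uncovered)
        (cong₂ (λ x y → x + (y + ∑ (λ a → ∑ (uncovered a))))
          (trans (∑-cong (λ a → ∑-* (ind (P a)) (h a))) P-part)
          (trans (∑-cong (λ b → ∑-* (ind (Z b)) (λ a → h a b))) Z-part)))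
      (∑-mono (λ a → ∑-mono (split a)))

    h-row≤ : ∀ a → ∑ (h a) ≤ k
    h-row≤ a = ≤-trans (≤-reflexive (hrow a)) (ι-mono (Capped.rows capped a))

    h-col≤ : ∀ b → ∑ (λ a → h a b) ≤ k
    h-col≤ b = ≤-trans (≤-reflexive (hcol b)) (ι-mono (Capped.cols capped b))

    H⊆E : ∀ a b → H a b ≡ true → E a b ≡ true
    H⊆E = Capped.inc capped

-- Every edge is covered by the vertex cover dual to a maximum matching.
module Matching {p q} (E : Fin p → Fin q → Bool) (Δ : ℚ) (1≤Δ : 1ℚ ≤ Δ)
  (row≤Δ : ∀ a → ∑ (λ b → ind (E a b)) ≤ Δ) (col≤Δ : ∀ b → ∑ (λ a → ind (E a b)) ≤ Δ) where

  open Count E 1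

  opaque
    -- At most Δ|P| edges meet `P` and Δ|Z| meet `Z`, and the rest `y` is at most Δ y; `count` at
    -- cap 1 bounds |P| + |Z| + y by the size of the matching.
    matching-large : ∑ (λ a → ∑ (λ b → ind (E a b))) ≤ Δ * e
    matching-large = ≤-trans (∑-mono (λ a → ∑-mono (λ b → ≤-by _ (0≤ind (P a) *≥ (0≤ind (Z b) *≥ 0≤ind (E a b))) (l (ind (P a)) (ind (Z b)) (ind (E a b))))))
      (≤-trans (≤-reflexive (∑∑-+₃ (λ a b → ind (P a) * ind (E a b)) (λ a b → ind (Z b) * ind (E a b)) uncovered))
      (≤-by _ (gap P≤ +≥ gap Z≤ +≥ gap 1≤Δ *≥ 0≤y +≥ ≤-trans 0≤1 1≤Δ *≥ gap (subst (λ z → z * ∑ (ind ∘ P) + (z * ∑ (ind ∘ Z) + y) ≤ e) ι1 count))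
        (l₂ Δ (∑ (ind ∘ P)) (∑ (ind ∘ Z)) y e (∑ (λ a → ∑ (λ b → ind (P a) * ind (E a b)))) (∑ (λ b → ∑ (λ a → ind (Z b) * ind (E a b)))))))
      where
      y : ℚ
      y = ∑ (λ a → ∑ (uncovered a))
      0≤y : 0ℚ ≤ y
      0≤y = ∑-nonneg (λ a → ∑-nonneg (λ b → 0≤1-ind (P a) *≥ (0≤1-ind (Z b) *≥ 0≤ind (E a b))))
      l : ∀ p z e → e + p * (z * e) ≡ p * e + (z * e + (1ℚ - p) * ((1ℚ - z) * e))
      l = solve-∀ ℚ-ring
      P≤ : ∑ (λ a → ∑ (λ b → ind (P a) * ind (E a b))) ≤ ∑ (ind ∘ P) * Δ
      P≤ = ≤-trans (∑-mono (λ a → ≤-trans (≤-reflexive (∑-* (ind (P a)) (λ b → ind (E a b)))) (*-monoˡ (0≤ind (P a)) (row≤Δ a))))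
        (≤-reflexive (∑-*ʳ Δ (ind ∘ P)))
      Z≤ : ∑ (λ b → ∑ (λ a → ind (Z b) * ind (E a b))) ≤ ∑ (ind ∘ Z) * Δ
      Z≤ = ≤-trans (∑-mono (λ b → ≤-trans (≤-reflexive (∑-* (ind (Z b)) (λ a → ind (E a b)))) (*-monoˡ (0≤ind (Z b)) (col≤Δ b))))
        (≤-reflexive (∑-*ʳ Δ (ind ∘ Z)))
      l₂ : ∀ Δ P Z y e U V → U + (V + y) + ((P * Δ - U) + (Z * Δ - V) + (Δ - 1ℚ) * y + Δ * (e - (1ℚ * P + (1ℚ * Z + y)))) ≡ Δ * e
      l₂ = solve-∀ ℚ-ring

record CappedSubgraph {p q} (E : Fin p → Fin q → Bool) (k : ℚ) : Set where
  field
    H : Fin p → Fin q → Bool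
    H⊆E : ∀ a b → H a b ≡ true → E a b ≡ true
    row≤ : ∀ a → ∑ (λ b → ind (H a b)) ≤ k
    col≤ : ∀ b → ∑ (λ a → ind (H a b)) ≤ k

  e : ℚ
  e = ∑ (λ a → ∑ (λ b → ind (H a b)))

opaque
  large-matching : ∀ {p q} (E : Fin p → Fin q → Bool) (Δ : ℚ) → 1ℚ ≤ Δ →
    (∀ a → ∑ (λ b → ind (E a b)) ≤ Δ) → (∀ b → ∑ (λ a → ind (E a b)) ≤ Δ) →
    Σ (CappedSubgraph E 1ℚ) (λ M → ∑ (λ a → ∑ (λ b → ind (E a b))) ≤ Δ * CappedSubgraph.e M)
  large-matching E Δ 1≤Δ row≤Δ col≤Δ = record
    { H = C.H ; H⊆E = C.H⊆E ; row≤ = λ a → subst (∑ (C.h a) ≤_) ι1 (C.h-row≤ a) ; col≤ = λ b → subst (∑ (λ a → C.h a b) ≤_) ι1 (C.h-col≤ b) } ,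
    Matching.matching-large E Δ 1≤Δ row≤Δ col≤Δ
    where module C = Count E 1

-- Edge weights with prescribed row and column totals

-- The default at 0 makes it total; wherever that value can occur below, it is multiplied by zero.
recip : ℚ → ℚ
recip q with q ≟ 0ℚ
... | yes _ = 0ℚ
... | no ne = 1/_ q {{≢-nonZero ne}}

recip-inverse : ∀ {q} → 0ℚ < q → q * recip q ≡ 1ℚ
recip-inverse {q} 0<q with q ≟ 0ℚ
... | yes eq = contradiction (sym eq) (<⇒≢ 0<q)
... | no ne = *-inverseʳ q {{≢-nonZero ne}}

0≤recip : ∀ {q} → 0ℚ < q → 0ℚ ≤ recip q
0≤recip {q} 0<q = *-cancelˡ {c = q} 0<q (subst₂ _≤_ (sym (*-zeroʳ q)) (sym (recip-inverse 0<q)) 0≤1)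

recip-≤ : ∀ {a b q} → 0ℚ < q → b ≤ a * q → b * recip q ≤ a
recip-≤ {a} {b} {q} 0<q h = ≤-trans (*-monoʳ (0≤recip 0<q) h)
  (≤-reflexive (trans (*-assoc a q (recip q)) (trans (cong (a *_) (recip-inverse 0<q)) (*-identityʳ a))))

recip-≥ : ∀ {a b q} → 0ℚ < q → a * q ≤ b → a ≤ b * recip q
recip-≥ {a} {b} {q} 0<q h = ≤-trans
  (≤-reflexive (sym (trans (*-assoc a q (recip q)) (trans (cong (a *_) (recip-inverse 0<q)) (*-identityʳ a)))))
  (*-monoʳ (0≤recip 0<q) h)

-- Column b spreads the amount 2D evenly over its edges. The row a receives x a · D in this way, and w a
-- rescales its shares to the total D.
module Weights {p q} (E : Fin p → Fin q → Bool) (act : Mask p) (β : Mask q)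
  (E-act : ∀ a b → E a b ≡ true → act a ≡ true) (E-β : ∀ a b → E a b ≡ true → β b ≡ true)
  (D ρ R lo hi : ℚ) (0≤D : 0ℚ ≤ D) (0<ρ : 0ℚ < ρ) (0<lo : 0ℚ < lo) (0<hi : 0ℚ < hi)
  (ρ≤ : ∀ a → act a ≡ true → ρ ≤ ∑ (λ b → ind (E a b)))
  (≤R : ∀ a → act a ≡ true → ∑ (λ b → ind (E a b)) ≤ R)
  (lo≤ : ∀ b → β b ≡ true → lo ≤ ∑ (λ a → ind (E a b)))
  (≤hi : ∀ b → β b ≡ true → ∑ (λ a → ind (E a b)) ≤ hi)
  (2R≤lo : R + R ≤ lo) (Dhi≤ρlo : D * hi ≤ ρ * lo) where

  ε : Fin p → Fin q → ℚ
  ε a b = ind (E a b)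

  s : Fin q → ℚ
  s b = ∑ (λ a → ε a b)

  ν : Fin p → ℚ
  ν a = ∑ (λ b → ε a b * recip (s b))

  w : Fin p → Fin q → ℚ
  w a b = D * recip (ν a) * (ε a b * recip (s b))

  x : Fin p → ℚ
  x a = ν a + ν a

  opaque
    0<s : ∀ b → β b ≡ true → 0ℚ < s b
    0<s b h = <-≤-trans 0<lo (lo≤ b h)

    E-cases : ∀ {ℓ} a b (G : ℚ → Set ℓ) → (E a b ≡ true → G 1ℚ) → G 0ℚ → G (ε a b)
    E-cases a b G t f = go (E a b) refl
      where
      go : ∀ v → E a b ≡ v → G (ε a b)
      go true eq = subst (G ∘ ind) (sym eq) (t eq)
      go false eq = subst (G ∘ ind) (sym eq) f

    lo*ν≤ : ∀ a → lo * ν a ≤ ∑ (ε a)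
    lo*ν≤ a = subst (_≤ ∑ (ε a)) (∑-* lo (λ b → ε a b * recip (s b))) (∑-mono pt)
      where
      l : ∀ lo i → 1ℚ * (lo * i) ≡ lo * (1ℚ * i)
      l = solve-∀ ℚ-ring
      l₀ : ∀ lo i → lo * (0ℚ * i) ≡ 0ℚ
      l₀ = solve-∀ ℚ-ring
      pt : ∀ b → lo * (ε a b * recip (s b)) ≤ ε a b
      pt b = E-cases a b (λ e → lo * (e * recip (s b)) ≤ e)
        (λ h → subst (_≤ 1ℚ) (trans (sym (*-identityˡ _)) (l lo (recip (s b))))
          (recip-≤ (0<s b (E-β a b h)) (subst (lo ≤_) (sym (*-identityˡ (s b))) (lo≤ b (E-β a b h)))))
        (≤-reflexive (l₀ lo (recip (s b))))

    hi*ν≥ : ∀ a → ∑ (ε a) ≤ hi * ν a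
    hi*ν≥ a = subst (∑ (ε a) ≤_) (∑-* hi (λ b → ε a b * recip (s b))) (∑-mono pt)
      where
      l : ∀ hi i → hi * i ≡ hi * (1ℚ * i)
      l = solve-∀ ℚ-ring
      l₀ : ∀ hi i → 0ℚ ≡ hi * (0ℚ * i)
      l₀ = solve-∀ ℚ-ring
      pt : ∀ b → ε a b ≤ hi * (ε a b * recip (s b))
      pt b = E-cases a b (λ e → e ≤ hi * (e * recip (s b)))
        (λ h → subst (1ℚ ≤_) (l hi (recip (s b)))
          (recip-≥ (0<s b (E-β a b h)) (subst (_≤ hi) (sym (*-identityˡ (s b))) (≤hi b (E-β a b h)))))
        (≤-reflexive (l₀ hi (recip (s b))))

    0<ν : ∀ a → act a ≡ true → 0ℚ < ν a
    0<ν a h = *-cancelˡ-<-nonNeg hi {{nonNegative (<⇒≤ 0<hi)}}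
      (subst (_< hi * ν a) (sym (*-zeroʳ hi)) (<-≤-trans 0<ρ (≤-trans (ρ≤ a h) (hi*ν≥ a))))

    0≤term : ∀ a b → 0ℚ ≤ ε a b * recip (s b)
    0≤term a b = E-cases a b (λ e → 0ℚ ≤ e * recip (s b))
      (λ h → subst (0ℚ ≤_) (sym (*-identityˡ (recip (s b)))) (0≤recip (0<s b (E-β a b h))))
      (≤-reflexive (sym (*-zeroˡ (recip (s b)))))

    0≤x : ∀ a → 0ℚ ≤ x a
    0≤x a = ∑-nonneg (0≤term a) +≥ ∑-nonneg (0≤term a)

    ε-off : ∀ a → act a ≡ false → ∀ b → ε a b ≡ 0ℚ
    ε-off a h b = E-cases a b (λ e → e ≡ 0ℚ) (λ e → contradiction (trans (sym (E-act a b e)) h) λ ()) refl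

    ν-off : ∀ a → act a ≡ false → ν a ≡ 0ℚ
    ν-off a h = trans (∑-cong (λ b → trans (cong (_* recip (s b)) (ε-off a h b)) (*-zeroˡ (recip (s b))))) (∑-zero q)

    -- Columns have degree at least `lo`, so ν a ≤ R / lo ≤ 1/2 by `2R≤lo`.
    x≤1 : ∀ a → x a ≤ 1ℚ
    x≤1 a = go (act a) refl
      where
      l : ∀ lo ν R t → lo * (ν + ν) + ((lo - (R + R)) + # 2 * (R - t) + # 2 * (t - lo * ν)) ≡ lo * 1ℚ
      l = solve-∀ ℚ-ring
      go : ∀ v → act a ≡ v → x a ≤ 1ℚ
      go true h = *-cancelˡ {c = lo} 0<lo (≤-by _ (gap 2R≤lo +≥ #≥ 2 *≥ gap (≤R a h) +≥ #≥ 2 *≥ gap (lo*ν≤ a)) (l lo (ν a) R (∑ (ε a))))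
      go false h = subst (_≤ 1ℚ) (sym (cong (λ z → z + z) (ν-off a h))) 0≤1

    0≤w : ∀ a b → 0ℚ ≤ w a b
    0≤w a b = go (act a) refl
      where
      go : ∀ v → act a ≡ v → 0ℚ ≤ w a b
      go true h = 0≤D *≥ 0≤recip (0<ν a h) *≥ 0≤term a b
      go false h = ≤-reflexive (sym (trans (cong (λ e → D * recip (ν a) * (e * recip (s b))) (ε-off a h b)) (l (D * recip (ν a)) (recip (s b)))))
        where
        l : ∀ u v → u * (0ℚ * v) ≡ 0ℚ
        l = solve-∀ ℚ-ring

    row : ∀ a → ∑ (w a) ≡ ind (act a) * D
    row a = trans (∑-* (D * recip (ν a)) (λ b → ε a b * recip (s b))) (go (act a) refl)
      where
      l : ∀ D r n → D * r * n ≡ (n * r) * D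
      l = solve-∀ ℚ-ring
      go : ∀ v → act a ≡ v → D * recip (ν a) * ν a ≡ ind (act a) * D
      go true h = trans (l D (recip (ν a)) (ν a)) (cong (_* D) (trans (recip-inverse (0<ν a h)) (sym (cong ind h))))
      go false h = trans (trans (cong (λ z → D * recip (ν a) * z) (ν-off a h)) (*-zeroʳ (D * recip (ν a)))) (sym (trans (cong (λ v → ind v * D) h) (*-zeroˡ D)))

    col : ∀ b → ∑ (λ a → x a * w a b) ≡ ind (β b) * (D + D)
    col b = trans (∑-cong pt) (trans (∑-*ʳ ((D + D) * recip (s b)) (λ a → ε a b)) (go (β b) refl))
      where
      l : ∀ D n r i → (n + n) * (D * r * (1ℚ * i)) ≡ 1ℚ * ((n * r) * ((D + D) * i))
      l = solve-∀ ℚ-ring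
      l₀ : ∀ D n r i → (n + n) * (D * r * (0ℚ * i)) ≡ 0ℚ * ((D + D) * i)
      l₀ = solve-∀ ℚ-ring
      pt : ∀ a → x a * w a b ≡ ε a b * ((D + D) * recip (s b))
      pt a = E-cases a b (λ e → x a * (D * recip (ν a) * (e * recip (s b))) ≡ e * ((D + D) * recip (s b)))
        (λ h → trans (l D (ν a) (recip (ν a)) (recip (s b))) (cong (λ z → 1ℚ * z)
          (trans (cong (_* ((D + D) * recip (s b))) (recip-inverse (0<ν a (E-act a b h)))) (*-identityˡ ((D + D) * recip (s b))))))
        (l₀ D (ν a) (recip (ν a)) (recip (s b)))
      l₁ : ∀ D r n → n * (D * r) ≡ (n * r) * D
      l₁ = solve-∀ ℚ-ring
      s-off : β b ≡ false → s b ≡ 0ℚ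
      s-off h = trans (∑-cong (λ a → E-cases a b (λ e → e ≡ 0ℚ) (λ e → contradiction (trans (sym (E-β a b e)) h) λ ()) refl)) (∑-zero p)
      go : ∀ v → β b ≡ v → s b * ((D + D) * recip (s b)) ≡ ind (β b) * (D + D)
      go true h = trans (l₁ (D + D) (recip (s b)) (s b)) (cong (_* (D + D)) (trans (recip-inverse (0<s b h)) (sym (cong ind h))))
      go false h = trans (trans (cong (λ z → z * ((D + D) * recip (s b))) (s-off h)) (*-zeroˡ ((D + D) * recip (s b)))) (sym (trans (cong (λ v → ind v * (D + D)) h) (*-zeroˡ (D + D))))

    w-β : ∀ a b → β b ≡ false → w a b ≡ 0ℚ
    w-β a b h = E-cases a b (λ e → D * recip (ν a) * (e * recip (s b)) ≡ 0ℚ) (λ e → contradiction (trans (sym (E-β a b e)) h) λ ())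
      (l (D * recip (ν a)) (recip (s b)))
      where
      l : ∀ u v → u * (0ℚ * v) ≡ 0ℚ
      l = solve-∀ ℚ-ring

    -- On an edge `w a b` is D / (ν a · s b), where ν a ≥ ρ / hi and s b ≥ lo; `Dhi≤ρlo` is what
    -- bounds this by 1.
    w≤E : ∀ a b → w a b ≤ ind (E a b)
    w≤E a b = E-cases a b (λ e → D * recip (ν a) * (e * recip (s b)) ≤ e) main (≤-reflexive (l₀ (D * recip (ν a)) (recip (s b))))
      where
      l₀ : ∀ u v → u * (0ℚ * v) ≡ 0ℚ
      l₀ = solve-∀ ℚ-ring
      l : ∀ D r i → D * r * (1ℚ * i) ≡ D * i * r
      l = solve-∀ ℚ-ring
      l₁ : ∀ D hi lo ρ n i t → hi * lo * (D * i) + (hi * (D * (1ℚ - lo * i)) + (ρ * lo - D * hi) + lo * (t - ρ) + lo * (hi * n - t)) ≡ hi * lo * n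
      l₁ = solve-∀ ℚ-ring
      main : E a b ≡ true → D * recip (ν a) * (1ℚ * recip (s b)) ≤ 1ℚ
      main h = subst (_≤ 1ℚ) (sym (l D (recip (ν a)) (recip (s b)))) (recip-≤ (0<ν a (E-act a b h))
        (subst (D * recip (s b) ≤_) (sym (*-identityˡ (ν a))) (*-cancelˡ {c = hi * lo} 0<hilo
          (≤-by _ (<⇒≤ 0<hi *≥ (0≤D *≥ gap loi≤1) +≥ gap Dhi≤ρlo +≥ <⇒≤ 0<lo *≥ gap (ρ≤ a (E-act a b h)) +≥ <⇒≤ 0<lo *≥ gap (hi*ν≥ a))
            (l₁ D hi lo ρ (ν a) (recip (s b)) (∑ (ε a)))))))
        where
        0<hilo : 0ℚ < hi * lo
        0<hilo = subst (_< hi * lo) (*-zeroʳ hi) (*-monoʳ-<-pos hi {{positive 0<hi}} 0<lo)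
        loi≤1 : lo * recip (s b) ≤ 1ℚ
        loi≤1 = recip-≤ (0<s b (E-β a b h)) (subst (lo ≤_) (sym (*-identityˡ (s b))) (lo≤ b (E-β a b h)))

record Weighting {p q} (E : Fin p → Fin q → Bool) (act : Mask p) (β : Mask q) (D : ℚ) : Set where
  field
    w   : Fin p → Fin q → ℚ
    x   : Fin p → ℚ
    0≤w : ∀ a b → 0ℚ ≤ w a b
    w≤E : ∀ a b → w a b ≤ ind (E a b)
    0≤x : ∀ a → 0ℚ ≤ x a
    x≤1 : ∀ a → x a ≤ 1ℚ
    row : ∀ a → ∑ (w a) ≡ ind (act a) * D
    col : ∀ b → ∑ (λ a → x a * w a b) ≡ ind (β b) * (D + D)
    w-β : ∀ a b → β b ≡ false → w a b ≡ 0ℚ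

opaque
  weighting : ∀ {p q} (E : Fin p → Fin q → Bool) (act : Mask p) (β : Mask q) →
    (∀ a b → E a b ≡ true → act a ≡ true) → (∀ a b → E a b ≡ true → β b ≡ true) →
    (D ρ R lo hi : ℚ) → 0ℚ ≤ D → 0ℚ < ρ → 0ℚ < lo → 0ℚ < hi →
    (∀ a → act a ≡ true → ρ ≤ ∑ (λ b → ind (E a b))) → (∀ a → act a ≡ true → ∑ (λ b → ind (E a b)) ≤ R) →
    (∀ b → β b ≡ true → lo ≤ ∑ (λ a → ind (E a b))) → (∀ b → β b ≡ true → ∑ (λ a → ind (E a b)) ≤ hi) →
    R + R ≤ lo → D * hi ≤ ρ * lo → Weighting E act β D
  weighting E act β E-act E-β D ρ R lo hi 0≤D 0<ρ 0<lo 0<hi ρ≤ ≤R lo≤ ≤hi 2R≤lo Dhi≤ρlo = record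
    { w = M.w ; x = M.x ; 0≤w = M.0≤w ; w≤E = M.w≤E ; 0≤x = M.0≤x ; x≤1 = M.x≤1 ; row = M.row ; col = M.col ; w-β = M.w-β }
    where module M = Weights E act β E-act E-β D ρ R lo hi 0≤D 0<ρ 0<lo 0<hi ρ≤ ≤R lo≤ ≤hi 2R≤lo Dhi≤ρlo

-- The dual cut against the stability condition

-- X is A′ without P. Summing the stability condition over X bounds the capacity |X| k by that
-- of the cut (Z and the uncovered edges y), up to |X| / 4.
module Cut {p q} (w : Fin p → Fin q → ℚ) (act : Mask p) (β : Mask q) (x : Fin p → ℚ) (K : ℕ)
  (1≤K : 1 ℕ.≤ K) (0≤w : ∀ a b → 0ℚ ≤ w a b)
  (0≤x : ∀ a → 0ℚ ≤ x a) (x≤1 : ∀ a → x a ≤ 1ℚ)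
  (row : ∀ a → ∑ (w a) ≡ ind (act a) * (ι K + ι K))
  (col : ∀ b → ∑ (λ a → x a * w a b) ≡ ind (β b) * ((ι K + ι K) + (ι K + ι K)))
  (w-β : ∀ a b → β b ≡ false → w a b ≡ 0ℚ)
  (E : Fin p → Fin q → Bool) (w≤E : ∀ a b → w a b ≤ ind (E a b)) where

  k D : ℚ
  k = ι K
  D = k + k

  1≤k : 1ℚ ≤ k
  1≤k = subst (_≤ k) ι1 (ι-mono 1≤K)

  0≤k : 0ℚ ≤ k
  0≤k = 0≤ι K

  1≤D : 1ℚ ≤ D
  1≤D = ≤-trans 1≤k (subst (_≤ D) (+-identityʳ k) (+-monoʳ-≤ k 0≤k))

  open TwoStage w act β x D 1≤D 0≤w (λ a b → ≤-trans (w≤E a b) (ind≤1 (E a b))) 0≤x x≤1 row col w-β public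
    using (A′; excess; m; A′-large; A′-stable; A′⊆act; 0≤m; 0≤D)

  E′ : Fin p → Fin q → Bool
  E′ a b = A′ a ∧ E a b

  open Count E′ K public using (H; P; Z; h; e; uncovered; count; h-row≤; h-col≤; H⊆E)

  X : Fin p → ℚ
  X a = ind (A′ a) * (1ℚ - ind (P a))

  ζ : Fin q → ℚ
  ζ b = ind (Z b)

  π : Fin q → ℚ
  π b = ∑ (λ a → X a * w a b)

  ∑X ∑PA ∑ζβ y : ℚ
  ∑X = ∑ X
  ∑PA = ∑ (λ a → ind (A′ a) * ind (P a))
  ∑ζβ = ∑ (λ b → ζ b * ind (β b))
  y = ∑ (λ b → (1ℚ - ζ b) * ∑ (λ a → X a * ind (E a b)))

  0≤X : ∀ a → 0ℚ ≤ X a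
  0≤X a = 0≤ind (A′ a) *≥ 0≤1-ind (P a)

  0≤π : ∀ b → 0ℚ ≤ π b
  0≤π b = ∑-nonneg (λ a → 0≤X a *≥ 0≤w a b)

  opaque
    stable : ∀ a → X a * (∑ (λ b → w a b * excess b) + ∑ (λ b → w a b * excess b)) ≤ X a * D
    stable a = main (A′ a) refl
      where
      R : ℚ
      R = ∑ (λ b → w a b * excess b) + ∑ (λ b → w a b * excess b)
      l : ∀ z r → 0ℚ * z * r ≡ 0ℚ
      l = solve-∀ ℚ-ring
      main : ∀ v → A′ a ≡ v → X a * R ≤ X a * D
      main true eq = *-monoˡ (0≤X a) (A′-stable a eq)
      main false eq = subst (λ v → ind v * (1ℚ - ind (P a)) * R ≤ ind v * (1ℚ - ind (P a)) * D) (sym eq)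
        (≤-reflexive (trans (l (1ℚ - ind (P a)) R) (sym (l (1ℚ - ind (P a)) D))))

    π≤ : ∀ b → π b - ind (β b) * D ≤ excess b
    π≤ b = +-monoˡ-≤ (- (ind (β b) * D)) (∑-mono (λ a → *-monoʳ (0≤w a b)
      (≤-by {X a} _ (0≤ind (A′ a) *≥ 0≤ind (P a)) (l (ind (A′ a)) (ind (P a))))))
      where
      l : ∀ a p → a * (1ℚ - p) + a * p ≡ a
      l = solve-∀ ℚ-ring

    -- By (π − D)² ≥ 0 on Z and by the sign of the quadratic term off Z.
    pointwise : ∀ b → D * (ζ b * π b) - D * (D * (ζ b * ind (β b))) - D * ((1ℚ - ζ b) * π b) ≤ π b * excess b
    pointwise b = ≤-trans (main (Z b) (β b) refl refl) (*-monoˡ (0≤π b) (π≤ b))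
      where
      π0 : β b ≡ false → π b ≡ 0ℚ
      π0 eq = trans (∑-cong (λ a → trans (cong (X a *_) (w-β a b eq)) (*-zeroʳ (X a)))) (∑-zero p)
      G : Bool → Bool → ℚ → Set
      G z v t = D * (ind z * t) - D * (D * (ind z * ind v)) - D * ((1ℚ - ind z) * t) ≤ t * (t - ind v * D)
      l₁ : ∀ D t → D * (1ℚ * t) - D * (D * (1ℚ * 1ℚ)) - D * ((1ℚ - 1ℚ) * t) + (t - D) * (t - D) ≡ t * (t - 1ℚ * D)
      l₁ = solve-∀ ℚ-ring
      l₂ : ∀ D → D * (1ℚ * 0ℚ) - D * (D * (1ℚ * 0ℚ)) - D * ((1ℚ - 1ℚ) * 0ℚ) ≡ 0ℚ * (0ℚ - 0ℚ * D)
      l₂ = solve-∀ ℚ-ring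
      l₃ : ∀ D t v → D * (0ℚ * t) - D * (D * (0ℚ * v)) - D * ((1ℚ - 0ℚ) * t) + (t * t + D * ((1ℚ - v) * t)) ≡ t * (t - v * D)
      l₃ = solve-∀ ℚ-ring
      main : ∀ z v → Z b ≡ z → β b ≡ v → G (Z b) (β b) (π b)
      main true true eq eq′ = subst₂ (λ z v → G z v (π b)) (sym eq) (sym eq′) (≤-by _ (sq≥0 (π b - D)) (l₁ D (π b)))
      main true false eq eq′ = subst₂ (λ z v → G z v (π b)) (sym eq) (sym eq′)
        (subst (G true false) (sym (π0 eq′)) (≤-reflexive (l₂ D)))
      main false v eq eq′ = subst (λ z → G z (β b) (π b)) (sym eq)
        (≤-by _ (0≤π b *≥ 0≤π b +≥ 0≤D *≥ (0≤1-ind (β b) *≥ 0≤π b)) (l₃ D (π b) (ind (β b))))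

    ∑ζπ ∑ζ̄π : ℚ
    ∑ζπ = ∑ (λ b → ζ b * π b)
    ∑ζ̄π = ∑ (λ b → (1ℚ - ζ b) * π b)

    summed : D * ∑ζπ - D * (D * ∑ζβ) - D * ∑ζ̄π ≤ ∑ (λ b → π b * excess b)
    summed = subst (_≤ ∑ (λ b → π b * excess b)) (trans (∑-- _ (λ b → D * ((1ℚ - ζ b) * π b)))
      (cong₂ _-_ (trans (∑-- _ (λ b → D * (D * (ζ b * ind (β b))))) (cong₂ _-_ (∑-* D _) (trans (∑-* D _) (cong (D *_) (∑-* D _))))) (∑-* D _)))
      (∑-mono pointwise)

    weighted : ∑ (λ b → π b * excess b) + ∑ (λ b → π b * excess b) ≤ ∑X * D
    weighted = subst₂ _≤_ (trans (∑-cong (λ a → d (X a) (∑ (λ b → w a b * excess b)))) (trans (∑-+ (λ a → X a * ∑ (λ b → w a b * excess b)) (λ a → X a * ∑ (λ b → w a b * excess b)))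
        (cong (λ z → z + z) (∑-inner X w excess)))) (∑-*ʳ D X) (∑-mono stable)
      where
      d : ∀ x r → x * (r + r) ≡ x * r + x * r
      d = solve-∀ ℚ-ring

    ∑π : ∑ζπ + ∑ζ̄π ≡ ∑X * D
    ∑π = trans (sym (∑-+ (λ b → ζ b * π b) (λ b → (1ℚ - ζ b) * π b))) (trans (∑-cong (λ b → d (ζ b) (π b))) (trans (sym (∑-inner₁ X w))
      (trans (∑-cong (λ a → pt a (A′ a) refl)) (∑-*ʳ D X))))
      where
      d : ∀ z p → z * p + (1ℚ - z) * p ≡ p
      d = solve-∀ ℚ-ring
      l : ∀ z r → 0ℚ * z * r ≡ 0ℚ
      l = solve-∀ ℚ-ring
      pt : ∀ a v → A′ a ≡ v → X a * ∑ (w a) ≡ X a * D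
      pt a true eq = cong (X a *_) (trans (row a) (trans (cong (λ v → ind v * D) (A′⊆act a eq)) (*-identityˡ D)))
      pt a false eq = subst (λ v → ind v * (1ℚ - ind (P a)) * ∑ (w a) ≡ ind v * (1ℚ - ind (P a)) * D) (sym eq)
        (trans (l (1ℚ - ind (P a)) (∑ (w a))) (sym (l (1ℚ - ind (P a)) D)))

    ζ̄π≤y : ∑ζ̄π ≤ y
    ζ̄π≤y = ∑-mono (λ b → *-monoˡ (0≤1-ind (Z b)) (∑-mono (λ a → *-monoˡ (0≤X a) (w≤E a b))))

    -- Let U and V be the weight from X into `Z` and off it, so that U + V = D|X|. `summed` and
    -- `weighted` give U - V - D|Z ∩ β| ≤ |X| / 2, hence D|X| ≤ 2V + D|Z ∩ β| + |X| / 2. As D = 2k,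
    -- halving this removes the factor 2 of V, and V ≤ `y` because weights are at most 1.
    cut : # 4 * (k * ∑X) ≤ # 4 * y + # 4 * (k * ∑ζβ) + ∑X
    cut = *-cancelˡ {c = D} (<-≤-trans (positive⁻¹ 1ℚ) 1≤D) (subst₂ _≤_
      (trans (cong (λ t → D * (# 2 * t)) ∑π) (l₁ k ∑X)) (trans (cong (λ t → t + D * (# 4 * y + # 4 * (k * ∑ζβ))) ∑π) (l₂ k ∑X (# 4 * y + # 4 * (k * ∑ζβ))))
      (≤-by _ (gap (subst (λ t → S + S ≤ t) (sym ∑π) weighted) +≥ #≥ 2 *≥ gap summed +≥ #≥ 4 *≥ (0≤D *≥ gap ζ̄π≤y))
        (l k S ∑ζπ ∑ζ̄π ∑ζβ y)))
      where
      S : ℚ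
      S = ∑ (λ b → π b * excess b)
      l₁ : ∀ k X → (k + k) * (# 2 * (X * (k + k))) ≡ (k + k) * (# 4 * (k * X))
      l₁ = solve-∀ ℚ-ring
      l₂ : ∀ k X r → X * (k + k) + (k + k) * r ≡ (k + k) * (r + X)
      l₂ = solve-∀ ℚ-ring
      l : ∀ k S U V B y → (k + k) * (# 2 * (U + V)) + ((U + V - (S + S)) + # 2 * (S - ((k + k) * U - (k + k) * ((k + k) * B) - (k + k) * V)) + # 4 * ((k + k) * (y - V)))
        ≡ (U + V) + (k + k) * (# 4 * y + # 4 * (k * B))
      l = solve-∀ ℚ-ring

    ∑X≡ : ∑ (ind ∘ A′) ≡ ∑X + ∑PA
    ∑X≡ = trans (∑-cong (λ a → l (ind (A′ a)) (ind (P a)))) (∑-+ X (λ a → ind (A′ a) * ind (P a)))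
      where
      l : ∀ a p → a ≡ a * (1ℚ - p) + a * p
      l = solve-∀ ℚ-ring

    P-part : ∑PA ≤ ∑ (ind ∘ P)
    P-part = ∑-mono (λ a → subst (ind (A′ a) * ind (P a) ≤_) (*-identityˡ (ind (P a))) (*-monoʳ (0≤ind (P a)) (ind≤1 (A′ a))))

    Z-part : ∑ζβ ≤ ∑ (ind ∘ Z)
    Z-part = ∑-mono (λ b → subst (ζ b * ind (β b) ≤_) (*-identityʳ (ζ b)) (*-monoˡ (0≤ind (Z b)) (ind≤1 (β b))))

    uncovered≡y : ∑ (λ a → ∑ (uncovered a)) ≡ y
    uncovered≡y = trans (∑-swap uncovered) (∑-cong (λ b → trans (∑-cong (λ a → trans
        (cong (λ z → (1ℚ - ind (P a)) * ((1ℚ - ζ b) * z)) (ind-∧ (A′ a) (E a b))) (l (ind (P a)) (ζ b) (ind (A′ a)) (ind (E a b)))))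
      (∑-* (1ℚ - ζ b) (λ a → X a * ind (E a b)))))
      where
      l : ∀ p z a e → (1ℚ - p) * ((1ℚ - z) * (a * e)) ≡ (1ℚ - z) * (a * (1ℚ - p) * e)
      l = solve-∀ ℚ-ring

    edges-split : k * ∑ (ind ∘ P) + (k * ∑ (ind ∘ Z) + y) ≤ e
    edges-split = subst (λ z → k * ∑ (ind ∘ P) + (k * ∑ (ind ∘ Z) + z) ≤ e) uncovered≡y count

    -- `cut` charges the capacity of X to k|Z| and `y`, and `edges-split` finds these as edges of
    -- `H` besides the k|P| edges at `P`. Only |X| / 4 is lost.
    saturated : # 4 * (k * ∑ (ind ∘ A′)) ≤ # 4 * e + ∑ (ind ∘ A′)
    saturated = subst (λ t → # 4 * (k * t) ≤ # 4 * e + t) (sym ∑X≡)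
      (≤-by _ (gap cut +≥ #≥ 4 *≥ gap edges-split +≥ #≥ 4 *≥ (0≤k *≥ gap P-part) +≥ #≥ 4 *≥ (0≤k *≥ gap Z-part) +≥ ∑-nonneg (λ a → 0≤ind (A′ a) *≥ 0≤ind (P a)))
        (l k e ∑X ∑PA ∑ζβ y (∑ (ind ∘ P)) (∑ (ind ∘ Z))))
      where
      l : ∀ k e X P B y U V → # 4 * (k * (X + P)) + ((# 4 * y + # 4 * (k * B) + X - # 4 * (k * X)) + # 4 * (e - (k * U + (k * V + y)))
        + # 4 * (k * (U - P)) + # 4 * (k * (V - B)) + P) ≡ # 4 * e + (X + P)
      l = solve-∀ ℚ-ring

record NearlyRegular {p q} (E : Fin p → Fin q → Bool) (act : Mask p) (β : Mask q) (k : ℚ) : Set where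
  field
    A′ : Mask p
    A′⊆act : ∀ a → A′ a ≡ true → act a ≡ true
    subgraph : CappedSubgraph (λ a b → A′ a ∧ E a b) k

  open CappedSubgraph subgraph public

  field
    A′-large : (k + k) * ∑ (ind ∘ β) ≤ (k + k) * ∑ (ind ∘ A′) + # 10 * ∑ (ind ∘ β)
    saturated : # 4 * (k * ∑ (ind ∘ A′)) ≤ # 4 * e + ∑ (ind ∘ A′)

opaque
  nearly-regular : ∀ {p q} (E : Fin p → Fin q → Bool) (act : Mask p) (β : Mask q) (K : ℕ) → 1 ℕ.≤ K →
    Weighting E act β (ι K + ι K) → NearlyRegular E act β (ι K)
  nearly-regular E act β K 1≤K W = record
    { A′ = M.A′ ; A′⊆act = M.A′⊆act ; subgraph = record { H = M.H ; H⊆E = M.H⊆E ; row≤ = M.h-row≤ ; col≤ = M.h-col≤ }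
    ; A′-large = M.A′-large ; saturated = M.saturated }
    where
    open Weighting W
    module M = Cut w act β x K 1≤K 0≤w 0≤x x≤1 row col w-β E w≤E

-- Thinning the graph

-- A maximum cut leaves every vertex at least half of its edges.
module MaxCut {n} (adj : Fin n → Fin n → Bool) (adj-sym : ∀ i j → adj i j ≡ adj j i)
  (irrefl : ∀ i → adj i i ≡ false) where

  ε : Fin n → Fin n → ℚ
  ε u v = ind (adj u v)

  dg : Fin n → ℚ
  dg u = ∑ (ε u)

  -- The form equals minus the number of edges from a set to its complement, so its minimiser is a
  -- maximum cut. Without loops the diagonal term vanishes, and the half is exact.
  module Q = QuadraticForm ε (λ i k → cong ind (adj-sym i k)) dg

  κ : Mask n
  κ = proj₁ Q.minimiser

  C : Fin n → Fin n → Bool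
  C a b = κ a ∧ (not (κ b) ∧ adj a b)

  opaque
    ind-not : ∀ b → ind (not b) ≡ 1ℚ - ind b
    ind-not true  = refl
    ind-not false = refl

    ind-C : ∀ a b → ind (C a b) ≡ ind (κ a) * ((1ℚ - ind (κ b)) * ε a b)
    ind-C a b = trans (ind-∧ (κ a) (not (κ b) ∧ adj a b)) (cong (ind (κ a) *_)
      (trans (ind-∧ (not (κ b)) (adj a b)) (cong (_* ε a b) (ind-not (κ b)))))

    row-C : ∀ a → κ a ≡ true → ∑ (λ b → ind (C a b)) ≡ dg a - Q.grad (ind ∘ κ) a
    row-C a h = trans (∑-cong (λ b → trans (ind-C a b) (trans (cong (λ v → ind v * ((1ℚ - ind (κ b)) * ε a b)) h) (l (ind (κ b)) (ε a b)))))
      (∑-- (ε a) (λ b → ε a b * ind (κ b)))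
      where
      l : ∀ k e → 1ℚ * ((1ℚ - k) * e) ≡ e - e * k
      l = solve-∀ ℚ-ring

    col-C : ∀ b → κ b ≡ false → ∑ (λ a → ind (C a b)) ≡ Q.grad (ind ∘ κ) b
    col-C b h = ∑-cong (λ a → trans (ind-C a b) (trans (cong (λ v → ind (κ a) * ((1ℚ - ind v) * ε a b)) h)
      (trans (l (ind (κ a)) (ε a b)) (cong (λ v → ind v * ind (κ a)) (adj-sym a b)))))
      where
      l : ∀ k e → k * ((1ℚ - 0ℚ) * e) ≡ e * k
      l = solve-∀ ℚ-ring

    half-row : ∀ a → κ a ≡ true → dg a ≤ # 2 * ∑ (λ b → ind (C a b))
    half-row a h = ≤-by _ (gap (Q.Minimiser.inside (proj₂ Q.minimiser) a h))
      (trans (l (dg a) (Q.grad (ind ∘ κ) a) (ε a a) (cong ind (irrefl a))) (cong (# 2 *_) (sym (row-C a h))))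
      where
      l′ : ∀ d g → d + (0ℚ - (g + g - d)) ≡ # 2 * (d - g)
      l′ = solve-∀ ℚ-ring
      l : ∀ d g z → z ≡ 0ℚ → d + (z - (g + g - d)) ≡ # 2 * (d - g)
      l d g .0ℚ refl = l′ d g

    half-col : ∀ b → κ b ≡ false → dg b ≤ # 2 * ∑ (λ a → ind (C a b))
    half-col b h = ≤-by _ (gap (Q.Minimiser.outside (proj₂ Q.minimiser) b h))
      (trans (l (dg b) (Q.grad (ind ∘ κ) b) (ε b b) (cong ind (irrefl b))) (cong (# 2 *_) (sym (col-C b h))))
      where
      l′ : ∀ d g → d + (g + g - d - - 0ℚ) ≡ # 2 * g
      l′ = solve-∀ ℚ-ring
      l : ∀ d g z → z ≡ 0ℚ → d + (g + g - d - - z) ≡ # 2 * g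
      l d g .0ℚ refl = l′ d g

    ind-C≤ : ∀ a b → ind (C a b) ≤ ε a b
    ind-C≤ a b with κ a | κ b | adj a b
    ... | true  | true  | true  = 0≤1
    ... | true  | true  | false = ≤-refl
    ... | true  | false | _     = ≤-refl
    ... | false | _     | true  = 0≤1
    ... | false | _     | false = ≤-refl

    row-C≤ : ∀ a → ∑ (λ b → ind (C a b)) ≤ dg a
    row-C≤ a = ∑-mono (ind-C≤ a)

    col-C≤ : ∀ b → ∑ (λ a → ind (C a b)) ≤ dg b
    col-C≤ b = ≤-trans (∑-mono (λ a → ind-C≤ a b)) (≤-reflexive (∑-cong (λ a → cong ind (adj-sym a b))))

    C-κ : ∀ a b → C a b ≡ true → κ a ≡ true
    C-κ a b h with κ a
    ... | true = refl

    C-κ̄ : ∀ a b → C a b ≡ true → κ b ≡ false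
    C-κ̄ a b h with κ a | κ b
    ... | true | false = refl

    C-adj : ∀ a b → C a b ≡ true → adj a b ≡ true
    C-adj a b h with κ a | κ b
    ... | true | false = h

    many-edges : ∀ d → (∀ v → d ≤ dg v) → d * ∑ {n} (λ _ → 1ℚ) ≤ # 4 * ∑ (λ a → ∑ (λ b → ind (C a b)))
    many-edges d d≤ = subst₂ _≤_ (∑-* d (λ _ → 1ℚ))
      (trans (∑-+ (λ v → # 2 * r v) (λ v → # 2 * c v)) (trans (cong₂ _+_ (∑-* (# 2) r) (trans (∑-* (# 2) c) (cong (# 2 *_) (sym (∑-swap (λ a b → ind (C a b))))))) (l (∑ r))))
      (∑-mono pt)
      where
      r c : Fin n → ℚ
      r v = ∑ (λ b → ind (C v b))
      c v = ∑ (λ a → ind (C a v))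
      0≤r : ∀ v → 0ℚ ≤ r v
      0≤r v = ∑-nonneg (λ b → 0≤ind (C v b))
      0≤c : ∀ v → 0ℚ ≤ c v
      0≤c v = ∑-nonneg (λ a → 0≤ind (C a v))
      l : ∀ e → # 2 * e + # 2 * e ≡ # 4 * e
      l = solve-∀ ℚ-ring
      l₁ : ∀ x → x ≡ x * 1ℚ
      l₁ = solve-∀ ℚ-ring
      pt : ∀ v → d * 1ℚ ≤ # 2 * r v + # 2 * c v
      pt v = subst (_≤ # 2 * r v + # 2 * c v) (l₁ d) (≤-trans (d≤ v) (go (κ v) refl))
        where
        go : ∀ u → κ v ≡ u → dg v ≤ # 2 * r v + # 2 * c v
        go true h = ≤-trans (half-row v h) (≤-by _ (#≥ 2 *≥ 0≤c v) refl)
        go false h = ≤-trans (half-col v h) (≤-by _ (#≥ 2 *≥ 0≤r v) (+-comm (# 2 * c v) (# 2 * r v)))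

record HalfCut {n} (adj : Fin n → Fin n → Bool) : Set where
  field
    κ : Mask n

  dg : Fin n → ℚ
  dg u = ∑ (λ v → ind (adj u v))

  C : Fin n → Fin n → Bool
  C a b = κ a ∧ (not (κ b) ∧ adj a b)

  field
    half-col   : ∀ b → κ b ≡ false → dg b ≤ # 2 * ∑ (λ a → ind (C a b))
    row-C≤     : ∀ a → ∑ (λ b → ind (C a b)) ≤ dg a
    col-C≤     : ∀ b → ∑ (λ a → ind (C a b)) ≤ dg b
    C-κ        : ∀ a b → C a b ≡ true → κ a ≡ true
    C-κ̄        : ∀ a b → C a b ≡ true → κ b ≡ false
    C-adj      : ∀ a b → C a b ≡ true → adj a b ≡ true
    many-edges : ∀ d → (∀ v → d ≤ dg v) → d * ∑ {n} (λ _ → 1ℚ) ≤ # 4 * ∑ (λ a → ∑ (λ b → ind (C a b)))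

opaque
  half-cut : ∀ {n} (adj : Fin n → Fin n → Bool) → (∀ i j → adj i j ≡ adj j i) → (∀ i → adj i i ≡ false) → HalfCut adj
  half-cut adj adj-sym irrefl = record
    { κ = M.κ ; half-col = M.half-col ; row-C≤ = M.row-C≤ ; col-C≤ = M.col-C≤ ; C-κ = M.C-κ ; C-κ̄ = M.C-κ̄
    ; C-adj = M.C-adj ; many-edges = M.many-edges }
    where module M = MaxCut adj adj-sym irrefl

-- Balancing the rows towards load t selects columns s; rows that stay above 4t carry only 3/8 of the selected edges,
-- by the second-moment bound.
module Sampling {p q} (C : Fin p → Fin q → Bool) (κ : Mask p) (β₀ : Mask q)
  (C-κ : ∀ a b → C a b ≡ true → κ a ≡ true) (C-β₀ : ∀ a b → C a b ≡ true → β₀ b ≡ true)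
  (t Δ d : ℚ) (1≤t : 1ℚ ≤ t) (t≤Δ : t ≤ Δ)
  (≤Δ : ∀ a → ∑ (λ b → ind (C a b)) ≤ Δ)
  (d≤ : ∀ b → β₀ b ≡ true → d ≤ # 2 * ∑ (λ a → ind (C a b))) where

  ε : Fin p → Fin q → ℚ
  ε a b = ind (C a b)

  -- Rows outside `κ` have no edges; the target 0 keeps their discrepancy at 0.
  T : Fin p → ℚ
  T a = ind (κ a) * t

  module S = Balancing (λ b a → ε a b) T

  s : Mask q
  s = proj₁ S.balanced

  τ : Fin p → ℚ
  τ = S.load (ind ∘ s)

  c : Fin p → ℚ
  c a = ∑ (ε a)

  e₀ e₁ : ℚ
  e₀ = ∑ c
  e₁ = ∑ τ

  A : Mask p
  A a = κ a ∧ does (τ a ≤? # 4 * t)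

  B : Mask q
  B b = s b ∧ β₀ b

  eA : ℚ
  eA = ∑ (λ a → ind (A a) * τ a)

  opaque
    0≤ε : ∀ a b → 0ℚ ≤ ε a b
    0≤ε a b = 0≤ind (C a b)

    0≤τ : ∀ a → 0ℚ ≤ τ a
    0≤τ a = ∑-nonneg (λ b → 0≤ind (s b) *≥ 0≤ε a b)

    0≤c : ∀ a → 0ℚ ≤ c a
    0≤c a = ∑-nonneg (0≤ε a)

    0≤e₁ : 0ℚ ≤ e₁
    0≤e₁ = ∑-nonneg 0≤τ

    ε² : ∀ a b → ε a b * ε a b ≡ ε a b
    ε² a b with C a b
    ... | true  = refl
    ... | false = refl

    ε-off : ∀ a → κ a ≡ false → ∀ b → ε a b ≡ 0ℚ
    ε-off a h b = go (C a b) refl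
      where
      go : ∀ v → C a b ≡ v → ε a b ≡ 0ℚ
      go true eq = contradiction (trans (sym (C-κ a b eq)) h) λ ()
      go false eq = cong ind eq

    c-off : ∀ a → κ a ≡ false → c a ≡ 0ℚ
    c-off a h = trans (∑-cong (ε-off a h)) (∑-zero q)

    τ-off : ∀ a → κ a ≡ false → τ a ≡ 0ℚ
    τ-off a h = trans (∑-cong (λ b → trans (cong (ind (s b) *_) (ε-off a h b)) (*-zeroʳ (ind (s b))))) (∑-zero q)

    slack : ∀ b → 0ℚ ≤ (1ℚ - ind (s b)) * ∑ (λ a → ε a b * (S.disc (ind ∘ s) a + S.disc (ind ∘ s) a + 1ℚ))
    slack b = subst (λ z → 0ℚ ≤ (1ℚ - ind (s b)) * z) (sym eq) (main (s b) refl)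
      where
      R V : ℚ
      R = ∑ (λ a → ε a b * S.disc (ind ∘ s) a)
      V = ∑ (λ a → ε a b * ε a b)
      d′ : ∀ w e → w * (e + e + 1ℚ) ≡ w * e + (w * e + w)
      d′ = solve-∀ ℚ-ring
      eq : ∑ (λ a → ε a b * (S.disc (ind ∘ s) a + S.disc (ind ∘ s) a + 1ℚ)) ≡ R + (R + V)
      eq = trans (∑-cong (λ a → trans (d′ (ε a b) (S.disc (ind ∘ s) a)) (cong (λ z → ε a b * S.disc (ind ∘ s) a + (ε a b * S.disc (ind ∘ s) a + z)) (sym (ε² a b)))))
        (trans (∑-+ (λ a → ε a b * S.disc (ind ∘ s) a) (λ a → ε a b * S.disc (ind ∘ s) a + ε a b * ε a b))
          (cong (λ z → R + z) (∑-+ (λ a → ε a b * S.disc (ind ∘ s) a) (λ a → ε a b * ε a b))))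
      l₀ : ∀ r → 0ℚ ≡ (1ℚ - 1ℚ) * r
      l₀ = solve-∀ ℚ-ring
      l₁ : ∀ R V → 0ℚ + (R + R - - V) ≡ (1ℚ - 0ℚ) * (R + (R + V))
      l₁ = solve-∀ ℚ-ring
      main : ∀ v → s b ≡ v → 0ℚ ≤ (1ℚ - ind (s b)) * (R + (R + V))
      main true h = subst (λ v → 0ℚ ≤ (1ℚ - ind v) * (R + (R + V))) (sym h) (≤-reflexive (l₀ (R + (R + V))))
      main false h = subst (λ v → 0ℚ ≤ (1ℚ - ind v) * (R + (R + V))) (sym h)
        (≤-by _ (gap (S.Balanced.outside (proj₂ S.balanced) b h)) (l₁ R V))

    unused : ∀ a → ∑ (λ b → (1ℚ - ind (s b)) * ε a b) ≡ c a - τ a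
    unused a = trans (∑-cong (λ b → l (ind (s b)) (ε a b))) (∑-- (ε a) (λ b → ind (s b) * ε a b))
      where
      l : ∀ y w → (1ℚ - y) * w ≡ w - y * w
      l = solve-∀ ℚ-ring

    rowwise : ∀ a → ∑ (λ b → (1ℚ - ind (s b)) * ε a b) * (S.disc (ind ∘ s) a + S.disc (ind ∘ s) a + 1ℚ) ≤
      (1ℚ - # 2 * t) * c a + (# 2 * Δ + # 2 * t) * τ a
    rowwise a = subst (λ z → z * (S.disc (ind ∘ s) a + S.disc (ind ∘ s) a + 1ℚ) ≤ (1ℚ - # 2 * t) * c a + (# 2 * Δ + # 2 * t) * τ a) (sym (unused a)) (main (κ a) refl)
      where
      G : ℚ → ℚ → ℚ → Set
      G v c τ = (c - τ) * ((τ - v * t) + (τ - v * t) + 1ℚ) ≤ (1ℚ - # 2 * t) * c + (# 2 * Δ + # 2 * t) * τ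
      l : ∀ t Δ c τ → (c - τ) * ((τ - 1ℚ * t) + (τ - 1ℚ * t) + 1ℚ) + (# 2 * (τ * (Δ - c)) + # 2 * (τ * τ) + τ) ≡ (1ℚ - # 2 * t) * c + (# 2 * Δ + # 2 * t) * τ
      l = solve-∀ ℚ-ring
      l₀ : ∀ t Δ → (0ℚ - 0ℚ) * ((0ℚ - 0ℚ * t) + (0ℚ - 0ℚ * t) + 1ℚ) ≡ (1ℚ - # 2 * t) * 0ℚ + (# 2 * Δ + # 2 * t) * 0ℚ
      l₀ = solve-∀ ℚ-ring
      main : ∀ v → κ a ≡ v → G (ind (κ a)) (c a) (τ a)
      main true h = subst (λ v → G (ind v) (c a) (τ a)) (sym h)
        (≤-by _ (#≥ 2 *≥ (0≤τ a *≥ gap (≤Δ a)) +≥ #≥ 2 *≥ (0≤τ a *≥ 0≤τ a) +≥ 0≤τ a) (l t Δ (c a) (τ a)))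
      main false h = subst₂ (G (ind (κ a))) (sym (c-off a h)) (sym (τ-off a h))
        (subst (λ v → G (ind v) 0ℚ 0ℚ) (sym h) (≤-reflexive (l₀ t Δ)))

    0≤e₀ : 0ℚ ≤ e₀
    0≤e₀ = ∑-nonneg 0≤c

    -- An omitted column sees little underload. Summing over the omitted columns counts row `a` with
    -- multiplicity c - τ, and too few selected edges would leave the rows far below `t`: the
    -- outcome is (2t - 1) e₀ ≤ (2Δ + 2t) e₁.
    e₁-large : t * e₀ ≤ # 4 * Δ * e₁
    e₁-large = ≤-by _ (≤-trans (∑-nonneg slack) (≤-trans (≤-reflexive (∑-inner (λ b → 1ℚ - ind (s b)) (λ b a → ε a b) (λ a → S.disc (ind ∘ s) a + S.disc (ind ∘ s) a + 1ℚ)))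
        (≤-trans (∑-mono rowwise) (≤-reflexive (trans (∑-+ _ (λ a → (# 2 * Δ + # 2 * t) * τ a)) (cong₂ _+_ (∑-* (1ℚ - # 2 * t) c) (∑-* (# 2 * Δ + # 2 * t) τ))))))
      +≥ gap 1≤t *≥ 0≤e₀ +≥ #≥ 2 *≥ (gap t≤Δ *≥ 0≤e₁)) (l t Δ e₀ e₁)
      where
      l : ∀ t Δ e₀ e₁ → t * e₀ + (((1ℚ - # 2 * t) * e₀ + (# 2 * Δ + # 2 * t) * e₁) + (t - 1ℚ) * e₀ + # 2 * ((Δ - t) * e₁)) ≡ # 4 * Δ * e₁
      l = solve-∀ ℚ-ring

    ∑τ² : ℚ
    ∑τ² = ∑ (λ a → τ a * τ a)

    -- Summing the conditions of the selected columns weights the discrepancy of a row by its own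
    -- load, which produces a second moment: 2 (Σ τ² - t e₁) ≤ e₁.
    τ²-small : # 2 * ∑τ² ≤ # 3 * t * e₁
    τ²-small = ≤-by _ (gap (subst₂ _≤_ eq₁ eq₂ (∑-mono pt)) +≥ gap 1≤t *≥ 0≤e₁) (l ∑τ² t e₁)
      where
      R : Fin q → ℚ
      R b = ∑ (λ a → ε a b * S.disc (ind ∘ s) a)
      l₀ : ∀ r → 0ℚ * r + 0ℚ * r ≡ 0ℚ * r
      l₀ = solve-∀ ℚ-ring
      l₁ : ∀ r → 1ℚ * r + 1ℚ * r ≡ r + r
      l₁ = solve-∀ ℚ-ring
      l : ∀ Q t e → # 2 * Q + ((e - (# 2 * (Q - t * e))) + (t - 1ℚ) * e) ≡ # 3 * t * e
      l = solve-∀ ℚ-ring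
      pt : ∀ b → ind (s b) * R b + ind (s b) * R b ≤ ind (s b) * ∑ (λ a → ε a b)
      pt b = go (s b) refl
        where
        V : ℚ
        V = ∑ (λ a → ε a b)
        go : ∀ v → s b ≡ v → ind (s b) * R b + ind (s b) * R b ≤ ind (s b) * V
        go true h = subst (λ v → ind v * R b + ind v * R b ≤ ind v * V) (sym h)
          (≤-trans (≤-reflexive (l₁ (R b))) (≤-trans (S.Balanced.inside (proj₂ S.balanced) b h)
            (≤-reflexive (trans (∑-cong (λ a → ε² a b)) (sym (*-identityˡ V))))))
        go false h = subst (λ v → ind v * R b + ind v * R b ≤ ind v * V) (sym h)
          (≤-reflexive (trans (l₀ (R b)) (trans (*-zeroˡ (R b)) (sym (*-zeroˡ V)))))
      τd : ∀ a → τ a * S.disc (ind ∘ s) a ≡ τ a * τ a - t * τ a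
      τd a = go (κ a) refl
        where
        m₁ : ∀ τ t → τ * (τ - 1ℚ * t) ≡ τ * τ - t * τ
        m₁ = solve-∀ ℚ-ring
        m₀ : ∀ v t → 0ℚ * (0ℚ - v * t) ≡ 0ℚ * 0ℚ - t * 0ℚ
        m₀ = solve-∀ ℚ-ring
        go : ∀ v → κ a ≡ v → τ a * (τ a - ind (κ a) * t) ≡ τ a * τ a - t * τ a
        go true h = subst (λ v → τ a * (τ a - ind v * t) ≡ τ a * τ a - t * τ a) (sym h) (m₁ (τ a) t)
        go false h = subst (λ z → z * (z - ind (κ a) * t) ≡ z * z - t * z) (sym (τ-off a h)) (m₀ (ind (κ a)) t)
      ∑R : ∑ (λ b → ind (s b) * R b) ≡ ∑τ² - t * e₁
      ∑R = trans (∑-inner (ind ∘ s) (λ b a → ε a b) (S.disc (ind ∘ s))) (trans (∑-cong τd)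
        (trans (∑-- (λ a → τ a * τ a) (λ a → t * τ a)) (cong (λ z → ∑τ² - z) (∑-* t τ))))
      eq₁ : ∑ (λ b → ind (s b) * R b + ind (s b) * R b) ≡ # 2 * (∑τ² - t * e₁)
      eq₁ = trans (∑-+ (λ b → ind (s b) * R b) (λ b → ind (s b) * R b)) (trans (cong (λ z → z + z) ∑R) (dbl (∑τ² - t * e₁)))
        where
        dbl : ∀ z → z + z ≡ # 2 * z
        dbl = solve-∀ ℚ-ring
      eq₂ : ∑ (λ b → ind (s b) * ∑ (λ a → ε a b)) ≡ e₁
      eq₂ = ∑-inner₁ (ind ∘ s) (λ b a → ε a b)

    A-τ : ∀ a → A a ≡ true → τ a ≤ # 4 * t
    A-τ a h with κ a
    ... | true = does-true (τ a ≤? # 4 * t) h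

    B-s : ∀ b → B b ≡ true → s b ≡ true
    B-s b h with s b
    ... | true = refl

    B-β₀ : ∀ b → B b ≡ true → β₀ b ≡ true
    B-β₀ b h with s b | β₀ b
    ... | true | true = refl

    heavy-small : ∀ a → # 4 * t * ((1ℚ - ind (A a)) * τ a) ≤ τ a * τ a
    heavy-small a = go (κ a) (τ a ≤? # 4 * t) refl refl
      where
      l₀ : ∀ t u → # 4 * t * ((1ℚ - u) * 0ℚ) ≡ 0ℚ * 0ℚ
      l₀ = solve-∀ ℚ-ring
      l₁ : ∀ t τ → # 4 * t * ((1ℚ - 1ℚ) * τ) + τ * τ ≡ τ * τ
      l₁ = solve-∀ ℚ-ring
      l₂ : ∀ t τ → # 4 * t * ((1ℚ - 0ℚ) * τ) + τ * (τ - # 4 * t) ≡ τ * τ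
      l₂ = solve-∀ ℚ-ring
      G : Bool → Set
      G v = # 4 * t * ((1ℚ - ind v) * τ a) ≤ τ a * τ a
      go : ∀ v (D : Dec (τ a ≤ # 4 * t)) → κ a ≡ v → does (τ a ≤? # 4 * t) ≡ does D → G (A a)
      go false D h h′ = subst (λ z → # 4 * t * ((1ℚ - ind (A a)) * z) ≤ z * z) (sym (τ-off a h)) (≤-reflexive (l₀ t (ind (A a))))
      go true (yes _) h h′ = subst G (sym (cong₂ _∧_ h h′)) (≤-by _ (sq≥0 (τ a)) (l₁ t (τ a)))
      go true (no big) h h′ = subst G (sym (cong₂ _∧_ h h′)) (≤-by _ (0≤τ a *≥ gap (<⇒≤ (≰⇒> big))) (l₂ t (τ a)))

    eA-large : # 5 * e₁ ≤ # 8 * eA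
    eA-large = *-cancelˡ {c = t} (<-≤-trans (positive⁻¹ 1ℚ) 1≤t)
      (≤-by _ (#≥ 2 *≥ gap (subst (_≤ ∑τ²) eq (∑-mono heavy-small)) +≥ gap τ²-small) (l t e₁ eA ∑τ²))
      where
      d′ : ∀ u τ → (1ℚ - u) * τ ≡ τ - u * τ
      d′ = solve-∀ ℚ-ring
      eq : ∑ (λ a → # 4 * t * ((1ℚ - ind (A a)) * τ a)) ≡ # 4 * t * (e₁ - eA)
      eq = trans (∑-* (# 4 * t) (λ a → (1ℚ - ind (A a)) * τ a)) (cong (# 4 * t *_)
        (trans (∑-cong (λ a → d′ (ind (A a)) (τ a))) (∑-- τ (λ a → ind (A a) * τ a))))
      l : ∀ t e₁ eA Q → t * (# 5 * e₁) + (# 2 * (Q - # 4 * t * (e₁ - eA)) + (# 3 * t * e₁ - # 2 * Q)) ≡ t * (# 8 * eA)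
      l = solve-∀ ℚ-ring

    -- A selected column keeps all its edges, at least d/2 of them, among those counted by `e₁`.
    -- This makes the degree threshold on the small side affordable in the core.
    B-small : d * ∑ (ind ∘ B) ≤ # 2 * e₁
    B-small = subst₂ _≤_ (∑-* d (ind ∘ B)) (trans (∑-* (# 2) (λ b → ind (s b) * ∑ (λ a → ε a b))) (cong (# 2 *_) (∑-inner₁ (ind ∘ s) (λ b a → ε a b))))
      (∑-mono (λ b → go b (B b) refl))
      where
      go : ∀ b v → B b ≡ v → d * ind (B b) ≤ # 2 * (ind (s b) * ∑ (λ a → ε a b))
      go b true h = subst₂ (λ u v → d * ind u ≤ # 2 * (ind v * ∑ (λ a → ε a b))) (sym h) (sym (B-s b h))
        (subst₂ _≤_ (sym (*-identityʳ d)) (cong (# 2 *_) (sym (*-identityˡ (∑ (λ a → ε a b))))) (d≤ b (B-β₀ b h)))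
      go b false h = subst (λ u → d * ind u ≤ # 2 * (ind (s b) * ∑ (λ a → ε a b))) (sym h)
        (subst (_≤ # 2 * (ind (s b) * ∑ (λ a → ε a b))) (sym (*-zeroʳ d)) (#≥ 2 *≥ (0≤ind (s b) *≥ ∑-nonneg (λ a → 0≤ε a b))))

record Spreading {p q} (C : Fin p → Fin q → Bool) (κ : Mask p) (β₀ : Mask q) (t Δ d : ℚ) : Set where
  field
    s : Mask q

  τ : Fin p → ℚ
  τ a = ∑ (λ b → ind (s b) * ind (C a b))

  e₁ : ℚ
  e₁ = ∑ τ

  A : Mask p
  A a = κ a ∧ does (τ a ≤? # 4 * t)

  B : Mask q
  B b = s b ∧ β₀ b

  eA : ℚ
  eA = ∑ (λ a → ind (A a) * τ a)

  field
    e₁-large : t * ∑ (λ a → ∑ (λ b → ind (C a b))) ≤ # 4 * Δ * e₁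
    A-τ      : ∀ a → A a ≡ true → τ a ≤ # 4 * t
    eA-large : # 5 * e₁ ≤ # 8 * eA
    B-small  : d * ∑ (ind ∘ B) ≤ # 2 * e₁

opaque
  spreading : ∀ {p q} (C : Fin p → Fin q → Bool) (κ : Mask p) (β₀ : Mask q) →
    (∀ a b → C a b ≡ true → κ a ≡ true) → (∀ a b → C a b ≡ true → β₀ b ≡ true) →
    (t Δ d : ℚ) → 1ℚ ≤ t → t ≤ Δ → (∀ a → ∑ (λ b → ind (C a b)) ≤ Δ) →
    (∀ b → β₀ b ≡ true → d ≤ # 2 * ∑ (λ a → ind (C a b))) → Spreading C κ β₀ t Δ d
  spreading C κ β₀ C-κ C-β₀ t Δ d 1≤t t≤Δ ≤Δ d≤ = record
    { s = M.s ; e₁-large = M.e₁-large ; A-τ = M.A-τ ; eA-large = M.eA-large ; B-small = M.B-small }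
    where module M = Sampling C κ β₀ C-κ C-β₀ t Δ d 1≤t t≤Δ ≤Δ d≤

-- The form is minus twice e − ρ|A| − σ|B|, so that a vertex of too small degree would have been dropped.
module Core {n} (F : Fin n → Fin n → Bool) (A B : Mask n)
  (disjoint : ∀ u → A u ≡ true → B u ≡ false)
  (F-A : ∀ a b → F a b ≡ true → A a ≡ true) (F-B : ∀ a b → F a b ≡ true → B b ≡ true)
  (ρ σ : ℚ) (0≤ρ : 0ℚ ≤ ρ) (0≤σ : 0ℚ ≤ σ) where

  ε : Fin n → Fin n → ℚ
  ε a b = ind (F a b)

  -- `F` is directed from `A` to `B`, so it is symmetrised; the doubled cost in `c` keeps the
  -- proportion.
  M : Fin n → Fin n → ℚ
  M u v = - (ε u v + ε v u)

  cost c : Fin n → ℚ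
  cost u = ρ * ind (A u) + σ * ind (B u)
  c u = - (cost u + cost u)

  module Q = QuadraticForm M (λ i k → cong -_ (+-comm (ε i k) (ε k i))) c

  s : Mask n
  s = proj₁ Q.minimiser

  act β : Mask n
  act a = s a ∧ A a
  β b = s b ∧ B b

  E : Fin n → Fin n → Bool
  E a b = s a ∧ (s b ∧ F a b)

  out into : (Fin n → ℚ) → Fin n → ℚ
  out x u = ∑ (λ v → ε u v * x v)
  into x u = ∑ (λ v → ε v u * x v)

  opaque
    F⇒∧ : ∀ a b → E a b ≡ true → s a ≡ true × s b ≡ true × F a b ≡ true
    F⇒∧ a b h with s a | s b | F a b
    ... | true | true | true = refl , refl , refl

    E-act : ∀ a b → E a b ≡ true → act a ≡ true
    E-act a b h with F⇒∧ a b h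
    ... | sa , sb , f = cong₂ _∧_ sa (F-A a b f)

    E-β : ∀ a b → E a b ≡ true → β b ≡ true
    E-β a b h with F⇒∧ a b h
    ... | sa , sb , f = cong₂ _∧_ sb (F-B a b f)

    E-F : ∀ a b → E a b ≡ true → F a b ≡ true
    E-F a b h = proj₂ (proj₂ (F⇒∧ a b h))

    act-s : ∀ {u v} → u ∧ v ≡ true → u ≡ true
    act-s {true} h = refl

    act-A : ∀ {u v} → u ∧ v ≡ true → v ≡ true
    act-A {true} h = h

    ind-E : ∀ a b → ind (E a b) ≡ ind (s a) * (ε a b * ind (s b))
    ind-E a b = trans (ind-∧ (s a) (s b ∧ F a b)) (cong (ind (s a) *_) (trans (ind-∧ (s b) (F a b)) (*-comm (ind (s b)) (ε a b))))

    grad≡ : ∀ x u → Q.grad x u ≡ - (out x u + into x u)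
    grad≡ x u = trans (∑-cong (λ v → l (ε u v) (ε v u) (x v))) (trans (∑-neg (λ v → ε u v * x v + ε v u * x v))
      (cong -_ (∑-+ (λ v → ε u v * x v) (λ v → ε v u * x v))))
      where
      l : ∀ a b x → - (a + b) * x ≡ - (a * x + b * x)
      l = solve-∀ ℚ-ring

    F-off : ∀ a b → (F a b ≡ true → ⊥) → ε a b ≡ 0ℚ
    F-off a b f with F a b
    ... | true  = ⊥-elim (f refl)
    ... | false = refl

    no-loop : ∀ u → M u u ≡ 0ℚ
    no-loop u = cong (λ z → - (z + z)) (F-off u u (λ h → contradiction (trans (sym (F-B u u h)) (disjoint u (F-A u u h))) λ ()))

    -- Disjointness of `A` and `B` excludes loops of `F`, so the diagonal term vanishes and the
    -- threshold is met without loss. On each side one of the two directions is empty, and the other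
    -- is the degree.
    degree : ∀ u → s u ≡ true → cost u ≤ out (ind ∘ s) u + into (ind ∘ s) u
    degree u h = *-cancelˡ {c = # 2} (positive⁻¹ (# 2)) (≤-by _ (gap (subst₂ (λ z y → z + z - c u ≤ y) (grad≡ (ind ∘ s) u) (no-loop u)
      (Q.Minimiser.inside (proj₂ Q.minimiser) u h))) (l (cost u) (out (ind ∘ s) u + into (ind ∘ s) u)))
      where
      l : ∀ c g → # 2 * c + (0ℚ - (- g + - g - - (c + c))) ≡ # 2 * g
      l = solve-∀ ℚ-ring

    row-≥ : ∀ a → act a ≡ true → ρ ≤ ∑ (λ b → ind (E a b))
    row-≥ a h = subst₂ _≤_ eq₁ eq₂ (degree a (act-s h))
      where
      Ba : B a ≡ false
      Ba = disjoint a (act-A {s a} h)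
      l₁ : ∀ ρ σ → ρ * 1ℚ + σ * 0ℚ ≡ ρ
      l₁ = solve-∀ ℚ-ring
      eq₁ : cost a ≡ ρ
      eq₁ = trans (cong₂ (λ u v → ρ * ind u + σ * ind v) (act-A {s a} h) Ba) (l₁ ρ σ)
      eq₂ : out (ind ∘ s) a + into (ind ∘ s) a ≡ ∑ (λ b → ind (E a b))
      eq₂ = trans (cong (λ z → out (ind ∘ s) a + z) (trans (∑-cong (λ v → trans (cong (_* ind (s v)) (F-off v a (λ f → contradiction (trans (sym (F-B v a f)) Ba) λ ())))
          (*-zeroˡ (ind (s v))))) (∑-zero n))) (trans (+-identityʳ _)
        (∑-cong (λ b → sym (trans (ind-E a b) (trans (cong (λ z → ind z * (ε a b * ind (s b))) (act-s {s a} h)) (*-identityˡ (ε a b * ind (s b))))))))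

    col-≥ : ∀ b → β b ≡ true → σ ≤ ∑ (λ a → ind (E a b))
    col-≥ b h = subst₂ _≤_ eq₁ eq₂ (degree b (act-s h))
      where
      notA : A b ≡ true → ⊥
      notA Ab = contradiction (trans (sym (act-A {s b} h)) (disjoint b Ab)) λ ()
      Ab : ∀ v → A b ≡ v → A b ≡ false
      Ab true eq = ⊥-elim (notA eq)
      Ab false eq = eq
      l₁ : ∀ ρ σ → ρ * 0ℚ + σ * 1ℚ ≡ σ
      l₁ = solve-∀ ℚ-ring
      eq₁ : cost b ≡ σ
      eq₁ = trans (cong₂ (λ u v → ρ * ind u + σ * ind v) (Ab (A b) refl) (act-A {s b} h)) (l₁ ρ σ)
      l : ∀ x e → e * x ≡ x * (e * 1ℚ)
      l = solve-∀ ℚ-ring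
      eq₂ : out (ind ∘ s) b + into (ind ∘ s) b ≡ ∑ (λ a → ind (E a b))
      eq₂ = trans (cong (λ z → z + into (ind ∘ s) b) (trans (∑-cong (λ v → trans (cong (_* ind (s v)) (F-off b v (λ f → notA (F-A b v f))))
          (*-zeroˡ (ind (s v))))) (∑-zero n))) (trans (+-identityˡ _)
        (∑-cong (λ a → sym (trans (ind-E a b) (trans (cong (λ z → ind (s a) * (ε a b * ind z)) (act-s {s b} h)) (sym (l (ind (s a)) (ε a b))))))))

    volume : (Fin n → ℚ) → ℚ
    volume x = ∑ (λ u → x u * out x u)

    form≡ : ∀ x → Q.form x ≡ # 2 * (∑ (λ u → x u * cost u) - volume x)
    form≡ x = trans (∑-cong (λ u → trans (cong (λ z → x u * (z - c u)) (grad≡ x u)) (l (x u) (out x u) (into x u) (cost u))))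
      (trans (∑-- (λ u → # 2 * (x u * cost u)) (λ u → x u * out x u + x u * into x u)) (trans
        (cong₂ _-_ (∑-* (# 2) (λ u → x u * cost u)) (trans (∑-+ (λ u → x u * out x u) (λ u → x u * into x u)) (cong (λ z → volume x + z) flip)))
        (l₂ (∑ (λ u → x u * cost u)) (volume x))))
      where
      l : ∀ x o i c → x * (- (o + i) - - (c + c)) ≡ # 2 * (x * c) - (x * o + x * i)
      l = solve-∀ ℚ-ring
      l₂ : ∀ c e → # 2 * c - (e + e) ≡ # 2 * (c - e)
      l₂ = solve-∀ ℚ-ring
      flip : ∑ (λ u → x u * into x u) ≡ volume x
      flip = trans (∑-inner x (λ u v → ε v u) x) (∑-cong (λ v → trans (*-comm _ (x v)) (cong (x v *_) (∑-cong (λ u → *-comm (x u) (ε v u))))))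

    volume-E : volume (ind ∘ s) ≡ ∑ (λ a → ∑ (λ b → ind (E a b)))
    volume-E = ∑-cong (λ a → trans (sym (∑-* (ind (s a)) (λ b → ε a b * ind (s b)))) (∑-cong (λ b → sym (ind-E a b))))

    volume-F : volume (λ _ → 1ℚ) ≡ ∑ (λ a → ∑ (ε a))
    volume-F = ∑-cong (λ a → trans (*-identityˡ (out (λ _ → 1ℚ) a)) (∑-cong (λ b → *-identityʳ (ε a b))))

    -- The minimiser is compared with the full vertex set, which pays the total cost for all edges;
    -- the cost of the core itself is dropped.
    core-large : ∑ (λ a → ∑ (ε a)) ≤ ∑ (λ a → ∑ (λ b → ind (E a b))) + (ρ * ∑ (ind ∘ A) + σ * ∑ (ind ∘ B))
    core-large = *-cancelˡ {c = # 2} (positive⁻¹ (# 2)) (≤-by _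
      (gap (subst₂ _≤_ (trans (form≡ (ind ∘ s)) (cong (λ z → # 2 * (∑ (λ u → ind (s u) * cost u) - z)) volume-E))
                       (trans (form≡ (λ _ → 1ℚ)) (cong₂ (λ y z → # 2 * (y - z)) total-cost volume-F))
             (Q.Minimiser.global (proj₂ Q.minimiser) (λ _ → true)))
        +≥ #≥ 2 *≥ ∑-nonneg {f = λ u → ind (s u) * cost u} (λ u → 0≤ind (s u) *≥ (0≤ρ *≥ 0≤ind (A u) +≥ 0≤σ *≥ 0≤ind (B u))))
      (l (∑ (λ a → ∑ (ε a))) (∑ (λ a → ∑ (λ b → ind (E a b)))) (ρ * ∑ (ind ∘ A) + σ * ∑ (ind ∘ B)) (∑ (λ u → ind (s u) * cost u))))
      where
      total-cost : ∑ (λ u → 1ℚ * cost u) ≡ ρ * ∑ (ind ∘ A) + σ * ∑ (ind ∘ B)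
      total-cost = trans (∑-cong (λ u → *-identityˡ (cost u))) (trans (∑-+ (λ u → ρ * ind (A u)) (λ u → σ * ind (B u)))
        (cong₂ _+_ (∑-* ρ (ind ∘ A)) (∑-* σ (ind ∘ B))))
      l : ∀ eF eE K k → # 2 * eF + ((# 2 * (K - eF) - # 2 * (k - eE)) + # 2 * k) ≡ # 2 * (eE + K)
      l = solve-∀ ℚ-ring

record DenseCore {n} (F : Fin n → Fin n → Bool) (A B : Mask n) (ρ σ : ℚ) : Set where
  field
    s : Mask n

  act : Mask n
  act a = s a ∧ A a

  β : Mask n
  β b = s b ∧ B b

  E : Fin n → Fin n → Bool
  E a b = s a ∧ (s b ∧ F a b)

  field
    E-act : ∀ a b → E a b ≡ true → act a ≡ true
    E-β   : ∀ a b → E a b ≡ true → β b ≡ true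
    E-F   : ∀ a b → E a b ≡ true → F a b ≡ true
    row-≥ : ∀ a → act a ≡ true → ρ ≤ ∑ (λ b → ind (E a b))
    col-≥ : ∀ b → β b ≡ true → σ ≤ ∑ (λ a → ind (E a b))
    core-large : ∑ (λ a → ∑ (λ b → ind (F a b))) ≤ ∑ (λ a → ∑ (λ b → ind (E a b))) + (ρ * ∑ (ind ∘ A) + σ * ∑ (ind ∘ B))

opaque
  dense-core : ∀ {n} (F : Fin n → Fin n → Bool) (A B : Mask n) → (∀ u → A u ≡ true → B u ≡ false) →
    (∀ a b → F a b ≡ true → A a ≡ true) → (∀ a b → F a b ≡ true → B b ≡ true) →
    (ρ σ : ℚ) → 0ℚ ≤ ρ → 0ℚ ≤ σ → DenseCore F A B ρ σ
  dense-core F A B disjoint F-A F-B ρ σ 0≤ρ 0≤σ = record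
    { s = M.s ; E-act = M.E-act ; E-β = M.E-β ; E-F = M.E-F ; row-≥ = M.row-≥ ; col-≥ = M.col-≥ ; core-large = M.core-large }
    where module M = Core F A B disjoint F-A F-B ρ σ 0≤ρ 0≤σ

-- The case of large minimum degree

1≤* : ∀ {a b} → 1ℚ ≤ a → 1ℚ ≤ b → 1ℚ ≤ a * b
1≤* {a} {b} 1≤a 1≤b = ≤-by _ (gap 1≤a +≥ ≤-trans 0≤1 1≤a *≥ gap 1≤b) (l a b)
  where
  l : ∀ a b → 1ℚ + ((a - 1ℚ) + a * (b - 1ℚ)) ≡ a * b
  l = solve-∀ ℚ-ring

0<1≤ : ∀ {a} → 1ℚ ≤ a → 0ℚ < a
0<1≤ = <-≤-trans (positive⁻¹ 1ℚ)

-- The edges are directed from the side κ of a bipartition to the other side.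
record Witness {n} (adj : Fin n → Fin n → Bool) (k : ℚ) : Set where
  field
    κ U : Mask n
    H   : Fin n → Fin n → Bool
    H-adj : ∀ a b → H a b ≡ true → adj a b ≡ true
    H-κ   : ∀ a b → H a b ≡ true → κ a ≡ true
    H-κ̄   : ∀ a b → H a b ≡ true → κ b ≡ false
    H-U₁  : ∀ a b → H a b ≡ true → U a ≡ true
    H-U₂  : ∀ a b → H a b ≡ true → U b ≡ true
    row≤  : ∀ a → ∑ (λ b → ind (H a b)) ≤ k
    col≤  : ∀ b → ∑ (λ a → ind (H a b)) ≤ k

  e : ℚ
  e = ∑ (λ a → ∑ (λ b → ind (H a b)))

  u : ℚ
  u = ∑ (ind ∘ U)

-- The conclusions with denominators cleared, (e + e) / u being the average degree; that `u` is
-- positive is drawn later from `large`. The constant 8388608 = 2^23 and the cube of `L` are set by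
-- `MatchingCase`, 8192 = 2^13 by `DegreeGap`.
record Good {n} (adj : Fin n → Fin n → Bool) (L d : ℚ) : Set where
  field
    {k} : ℚ
    witness : Witness adj k

  open Witness witness public

  field
    dense   : d * u ≤ ι 8388608 * (L * L * L) * (e + e)
    regular : k * u ≤ (e + e) + ι 100000000 * u
    large   : ∑ {n} (λ _ → 1ℚ) ≤ ι 8192 * (L * L) * u

module DegreeGap {n} (adj : Fin n → Fin n → Bool) (adj-sym : ∀ i j → adj i j ≡ adj j i)
  (irrefl : ∀ i → adj i i ≡ false) (K : ℕ) (1≤K : 1 ℕ.≤ K) (L d : ℚ) (1≤L : 1ℚ ≤ L)
  (d≤dg : ∀ v → d ≤ ∑ (λ u → ind (adj v u))) (dg≤ : ∀ v → ∑ (λ u → ind (adj v u)) ≤ L * d) where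

  -- ρ = 16 L D makes the weights at most 1 (D Δ ≤ ρ σ); t = 128 L ρ makes the core keep a quarter of the edges.
  k D ρ t Δ σ : ℚ
  k = ι K
  D = k + k
  ρ = # 16 * L * D
  t = # 128 * L * ρ
  Δ = L * d
  σ = # 8 * t

  opaque
    half : HalfCut adj
    half = half-cut adj adj-sym irrefl

  module MC = HalfCut half
  open MC using (κ; C)

  -- `64t≤d` keeps the loss σ|B| ≤ d|B| / 8 in the core small; `d≤128t` keeps the column degrees, at
  -- most L d, within a factor 16 L of their lower bound `σ`.
  module Spread (64t≤d : # 64 * t ≤ d) (d≤128t : d ≤ # 128 * t) where

    1≤k : 1ℚ ≤ k
    1≤k = subst (_≤ k) ι1 (ι-mono 1≤K)

    1≤D : 1ℚ ≤ D
    1≤D = ≤-trans 1≤k (≤-by _ (≤-trans 0≤1 1≤k) refl)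

    1≤# : ∀ m → 1ℚ ≤ # (suc m)
    1≤# m = subst₂ _≤_ ι1 (ι≡ (suc m)) (ι-mono {1} {suc m} (ℕ.s≤s ℕ.z≤n))

    1≤ρ : 1ℚ ≤ ρ
    1≤ρ = 1≤* (1≤* (1≤# 15) 1≤L) 1≤D

    1≤t : 1ℚ ≤ t
    1≤t = 1≤* (1≤* (1≤# 127) 1≤L) 1≤ρ

    0≤t : 0ℚ ≤ t
    0≤t = ≤-trans 0≤1 1≤t

    1≤d : 1ℚ ≤ d
    1≤d = ≤-trans (1≤* (1≤# 63) 1≤t) 64t≤d

    1≤Δ : 1ℚ ≤ Δ
    1≤Δ = 1≤* 1≤L 1≤d

    t≤Δ : t ≤ Δ
    t≤Δ = ≤-by _ (#≥ 63 *≥ 0≤t +≥ gap 64t≤d +≥ gap 1≤L *≥ ≤-trans 0≤1 1≤d) (l t d L)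
      where
      l : ∀ t d L → t + (# 63 * t + (d - # 64 * t) + (L - 1ℚ) * d) ≡ L * d
      l = solve-∀ ℚ-ring

    not-true : ∀ {v} → v ≡ false → not v ≡ true
    not-true refl = refl

    not-false : ∀ {v} → not v ≡ true → v ≡ false
    not-false {false} _ = refl

    opaque
      smp : Spreading C κ (not ∘ κ) t Δ d
      smp = spreading C κ (not ∘ κ) MC.C-κ (λ a b h → not-true (MC.C-κ̄ a b h)) t Δ d 1≤t t≤Δ
        (λ a → ≤-trans (MC.row-C≤ a) (dg≤ a)) (λ b h → ≤-trans (d≤dg b) (MC.half-col b (not-false h)))

    module S = Spreading smp
    open S using (A; B; τ; e₁; eA)

    e₀ : ℚ
    e₀ = ∑ (λ a → ∑ (λ b → ind (C a b)))

    F : Fin n → Fin n → Bool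
    F a b = A a ∧ (B b ∧ C a b)

    ∧-fst : ∀ {u v} → u ∧ v ≡ true → u ≡ true
    ∧-fst {true} _ = refl

    ∧-snd : ∀ {u v} → u ∧ v ≡ true → v ≡ true
    ∧-snd {true} h = h

    F-A : ∀ a b → F a b ≡ true → A a ≡ true
    F-A a b = ∧-fst

    F-B : ∀ a b → F a b ≡ true → B b ≡ true
    F-B a b h = ∧-fst {B b} (∧-snd {A a} h)

    F-C : ∀ a b → F a b ≡ true → C a b ≡ true
    F-C a b h = ∧-snd {B b} (∧-snd {A a} h)

    B-κ : ∀ b → B b ≡ true → κ b ≡ false
    B-κ b h = not-false (∧-snd {S.s b} h)

    disjoint : ∀ u → A u ≡ true → B u ≡ false
    disjoint u h = go (B u) refl
      where
      go : ∀ v → B u ≡ v → B u ≡ false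
      go true eq = contradiction (trans (sym (∧-fst h)) (B-κ u eq)) λ ()
      go false eq = eq

    opaque
      core : DenseCore F A B ρ σ
      core = dense-core F A B disjoint F-A F-B ρ σ (≤-trans 0≤1 1≤ρ) (#≥ 8 *≥ 0≤t)

    module R = DenseCore core
    open R using (E; act; β)

    ind-mono : ∀ {u v} → (u ≡ true → v ≡ true) → ind u ≤ ind v
    ind-mono {true}  {v} f = ≤-reflexive (sym (cong ind (f refl)))
    ind-mono {false} {v} f = 0≤ind v

    opaque
      ind-F : ∀ a b → ind (F a b) ≡ ind (A a) * (ind (S.s b) * ind (C a b))
      ind-F a b = trans (ind-∧ (A a) (B b ∧ C a b)) (cong (ind (A a) *_) (go (C a b) refl))
        where
        z : ∀ u v → u ∧ v ≡ true → v ≡ true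
        z true v h = h
        go : ∀ v → C a b ≡ v → ind (B b ∧ C a b) ≡ ind (S.s b) * ind (C a b)
        go true h = trans (ind-∧ (B b) (C a b)) (cong (_* ind (C a b))
          (trans (ind-∧ (S.s b) (not (κ b))) (trans (cong (λ v → ind (S.s b) * ind v) (not-true (MC.C-κ̄ a b h))) (*-identityʳ (ind (S.s b))))))
        go false h = trans (trans (ind-∧ (B b) (C a b)) (trans (cong (λ v → ind (B b) * ind v) h) (*-zeroʳ (ind (B b)))))
          (sym (trans (cong (λ v → ind (S.s b) * ind v) h) (*-zeroʳ (ind (S.s b)))))

      row-F : ∀ a → ∑ (λ b → ind (F a b)) ≡ ind (A a) * τ a
      row-F a = trans (∑-cong (ind-F a)) (∑-* (ind (A a)) (λ b → ind (S.s b) * ind (C a b)))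

      row-E≤ : ∀ a → act a ≡ true → ∑ (λ b → ind (E a b)) ≤ # 4 * t
      row-E≤ a h = ≤-trans (∑-mono (λ b → ind-mono (R.E-F a b))) (≤-trans (≤-reflexive (trans (row-F a)
        (trans (cong (λ v → ind v * τ a) Aa) (*-identityˡ (τ a))))) (S.A-τ a Aa))
        where
        Aa : A a ≡ true
        Aa = ∧-snd {R.s a} h

      col-E≤ : ∀ b → ∑ (λ a → ind (E a b)) ≤ Δ
      col-E≤ b = ≤-trans (∑-mono (λ a → ind-mono (λ h → F-C a b (R.E-F a b h)))) (≤-trans (MC.col-C≤ b) (dg≤ b))

      4t+4t≤8t : # 4 * t + # 4 * t ≤ σ
      4t+4t≤8t = ≤-reflexive (l t)
        where
        l : ∀ t → # 4 * t + # 4 * t ≡ # 8 * t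
        l = solve-∀ ℚ-ring

      DΔ≤ρσ : D * Δ ≤ ρ * σ
      DΔ≤ρσ = ≤-by _ (≤-trans 0≤1 1≤D *≥ (≤-trans 0≤1 1≤L *≥ gap d≤128t)) (l D L d t)
        where
        l : ∀ D L d t → D * (L * d) + D * (L * (# 128 * t - d)) ≡ # 16 * L * D * (# 8 * t)
        l = solve-∀ ℚ-ring

    opaque
      weights : Weighting E act β D
      weights = weighting E act β R.E-act R.E-β D ρ (# 4 * t) σ Δ (≤-trans 0≤1 1≤D) (0<1≤ 1≤ρ) (0<1≤ (1≤* (1≤# 7) 1≤t)) (0<1≤ 1≤Δ)
        R.row-≥ row-E≤ R.col-≥ (λ b _ → col-E≤ b) 4t+4t≤8t DΔ≤ρσ

      result : NearlyRegular E act β k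
      result = nearly-regular E act β K 1≤K weights

    module X = NearlyRegular result
    open X using (A′; H; e)

    m : ℚ
    m = ∑ (ind ∘ β)

    0≤m : 0ℚ ≤ m
    0≤m = ∑-nonneg (λ b → 0≤ind (β b))

    N a′ : ℚ
    N = ∑ {n} (λ _ → 1ℚ)
    a′ = ∑ (ind ∘ A′)

    opaque
      eE : ℚ
      eE = ∑ (λ a → ∑ (λ b → ind (E a b)))

      tN≤ : t * N ≤ # 16 * L * e₁
      tN≤ = *-cancelˡ {c = d} (0<1≤ 1≤d) (≤-by _ (0≤t *≥ gap (MC.many-edges d d≤dg) +≥ #≥ 4 *≥ gap S.e₁-large) (l t d N e₀ L e₁))
        where
        l : ∀ t d N e₀ L e₁ → d * (t * N) + (t * (# 4 * e₀ - d * N) + # 4 * (# 4 * (L * d) * e₁ - t * e₀)) ≡ d * (# 16 * L * e₁)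
        l = solve-∀ ℚ-ring

      8ρN≤ : # 8 * (ρ * N) ≤ e₁
      8ρN≤ = *-cancelˡ {c = # 16 * L} (0<1≤ (1≤* (1≤# 15) 1≤L)) (≤-by _ (gap tN≤) (l L ρ N e₁))
        where
        l : ∀ L ρ N e₁ → # 16 * L * (# 8 * (ρ * N)) + (# 16 * L * e₁ - # 128 * L * ρ * N) ≡ # 16 * L * e₁
        l = solve-∀ ℚ-ring

      A≤N : ∑ (ind ∘ A) ≤ N
      A≤N = ∑-mono (λ a → ind≤1 (A a))

      -- The core keeps 5/8 - 1/8 - 1/4 of the selected edges: ρ|A| ≤ ρN ≤ e₁/8 by `8ρN≤`, and σ|B|
      -- = 8t|B| ≤ d|B|/8 ≤ e₁/4 by `B-small`.
      e₁≤4eE : e₁ ≤ # 4 * eE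
      e₁≤4eE = *-cancelˡ {c = # 4} (positive⁻¹ (# 4)) (≤-by _ (#≥ 2 *≥ gap S.eA-large +≥ #≥ 16 *≥ gap e-core +≥ #≥ 16 *≥ (≤-trans 0≤1 1≤ρ *≥ gap A≤N)
          +≥ #≥ 2 *≥ gap 8ρN≤ +≥ #≥ 2 *≥ (∑-nonneg (λ b → 0≤ind (B b)) *≥ gap 64t≤d) +≥ #≥ 2 *≥ gap S.B-small) (l e₁ eA eE ρ (∑ (ind ∘ A)) N t d (∑ (ind ∘ B))))
        where
        e-core : eA ≤ eE + (ρ * ∑ (ind ∘ A) + σ * ∑ (ind ∘ B))
        e-core = subst (_≤ eE + (ρ * ∑ (ind ∘ A) + σ * ∑ (ind ∘ B))) (∑-cong row-F) R.core-large
        l : ∀ e₁ eA eE ρ a N t d b → # 4 * e₁ + (# 2 * (# 8 * eA - # 5 * e₁) + # 16 * (eE + (ρ * a + # 8 * t * b) - eA) + # 16 * (ρ * (N - a))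
          + # 2 * (e₁ - # 8 * (ρ * N)) + # 2 * (b * (d - # 64 * t)) + # 2 * (# 2 * e₁ - d * b)) ≡ # 4 * (# 4 * eE)
        l = solve-∀ ℚ-ring

      eE≤ : eE ≤ Δ * m
      eE≤ = ≤-trans (≤-reflexive (∑-swap (λ a b → ind (E a b)))) (≤-trans (∑-mono pt) (≤-reflexive (∑-* Δ (ind ∘ β))))
        where
        pt : ∀ b → ∑ (λ a → ind (E a b)) ≤ Δ * ind (β b)
        pt b = go (β b) refl
          where
          go : ∀ v → β b ≡ v → ∑ (λ a → ind (E a b)) ≤ Δ * ind (β b)
          go true h = subst (∑ (λ a → ind (E a b)) ≤_) (trans (sym (*-identityʳ Δ)) (cong (λ v → Δ * ind v) (sym h))) (col-E≤ b)
          go false h = ≤-trans (∑-mono (λ a → ind-mono {E a b} {false} (λ f → trans (sym h) (R.E-β a b f))))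
            (≤-reflexive (trans (∑-zero n) (sym (trans (cong (λ v → Δ * ind v) h) (*-zeroʳ Δ)))))

      -- The chain is tN ≤ 16L e₁ ≤ 64L eE ≤ 64L² d m ≤ 8192 L² t m.
      N≤ : N ≤ # 8192 * (L * L) * m
      N≤ = *-cancelˡ {c = t} (0<1≤ 1≤t) (≤-by _ (gap tN≤ +≥ #≥ 16 *≥ (0≤L *≥ gap e₁≤4eE) +≥ #≥ 64 *≥ (0≤L *≥ gap eE≤)
          +≥ #≥ 64 *≥ (0≤L *≥ (0≤L *≥ (0≤m *≥ gap d≤128t)))) (l t N L e₁ eE d m))
        where
        0≤L : 0ℚ ≤ L
        0≤L = ≤-trans 0≤1 1≤L
        l : ∀ t N L e₁ eE d m → t * N + ((# 16 * L * e₁ - t * N) + # 16 * (L * (# 4 * eE - e₁)) + # 64 * (L * (L * d * m - eE))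
          + # 64 * (L * (L * (m * (# 128 * t - d))))) ≡ t * (# 8192 * (L * L) * m)
        l = solve-∀ ℚ-ring

      0≤a′ : 0ℚ ≤ a′
      0≤a′ = ∑-nonneg (λ a → 0≤ind (A′ a))

      -- `A′-large` trades km for ka′ + 5m, after which `saturated` pays for 2ka′ with 2e + a′/2.
      almost-regular : k * (a′ + m) ≤ # 2 * e + # 6 * (a′ + m)
      almost-regular = *-cancelˡ {c = # 2} (positive⁻¹ (# 2)) (≤-by _ (gap X.saturated +≥ gap X.A′-large +≥ #≥ 2 *≥ 0≤m +≥ #≥ 11 *≥ 0≤a′) (l k a′ m e))
        where
        l : ∀ k a m e → # 2 * (k * (a + m)) + ((# 4 * e + a - # 4 * (k * a)) + ((k + k) * a + # 10 * m - (k + k) * m) + # 2 * m + # 11 * a) ≡ # 2 * (# 2 * e + # 6 * (a + m))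
        l = solve-∀ ℚ-ring

    A′-A : ∀ a → A′ a ≡ true → A a ≡ true
    A′-A a h = ∧-snd {R.s a} (X.A′⊆act a h)

    H-E : ∀ a b → H a b ≡ true → E a b ≡ true
    H-E a b h = ∧-snd {A′ a} (X.H⊆E a b h)

    H-C : ∀ a b → H a b ≡ true → C a b ≡ true
    H-C a b h = F-C a b (R.E-F a b (H-E a b h))

    ∨-fst : ∀ {u v} → u ≡ true → u ∨ v ≡ true
    ∨-fst refl = refl

    ∨-snd : ∀ {u v} → v ≡ true → u ∨ v ≡ true
    ∨-snd {true} _ = refl
    ∨-snd {false} h = h

    W : Witness adj k
    W = record
      { κ = κ ; U = λ v → A′ v ∨ β v ; H = H
      ; H-adj = λ a b h → MC.C-adj a b (H-C a b h)
      ; H-κ = λ a b h → MC.C-κ a b (H-C a b h)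
      ; H-κ̄ = λ a b h → MC.C-κ̄ a b (H-C a b h)
      ; H-U₁ = λ a b h → ∨-fst (∧-fst {A′ a} (X.H⊆E a b h))
      ; H-U₂ = λ a b h → ∨-snd {A′ b} (R.E-β a b (H-E a b h))
      ; row≤ = X.row≤ ; col≤ = X.col≤ }

    u : ℚ
    u = Witness.u W

    opaque
      u≡ : u ≡ a′ + m
      u≡ = trans (∑-cong (λ v → pt v (A′ v) refl)) (∑-+ (ind ∘ A′) (ind ∘ β))
        where
        pt : ∀ v x → A′ v ≡ x → ind (A′ v ∨ β v) ≡ ind (A′ v) + ind (β v)
        pt v true h = trans (cong (λ x → ind (x ∨ β v)) h) (sym (cong₂ (λ x y → ind x + ind y) h (β-off (β v) refl)))
          where
          β-off : ∀ y → β v ≡ y → β v ≡ false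
          β-off true eq = contradiction (trans (sym (∧-snd {R.s v} eq)) (disjoint v (A′-A v h))) λ ()
          β-off false eq = eq
        pt v false h = trans (cong (λ x → ind (x ∨ β v)) h) (trans (sym (+-identityˡ (ind (β v)))) (cong (λ x → ind x + ind (β v)) (sym h)))

      0≤u : 0ℚ ≤ u
      0≤u = ∑-nonneg (λ v → 0≤ind (A′ v ∨ β v))

      0≤e : 0ℚ ≤ e
      0≤e = ∑-nonneg (λ a → ∑-nonneg (λ b → 0≤ind (H a b)))

      regular₆ : k * u ≤ # 2 * e + # 6 * u
      regular₆ = subst (λ z → k * z ≤ # 2 * e + # 6 * z) (sym u≡) almost-regular

      -- With k ≥ 12 the error 6u is at most ku/2, so ku ≤ 4e; d ≤ 128t = 2^19 L² k turns this into
      -- the bound on the average degree.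
      spread-case : 12 ℕ.≤ K → Good adj L d
      spread-case 12≤K = record
        { witness = W
        ; dense = subst (λ c → d * u ≤ c * (L * L * L) * (e + e)) (sym (ι≡ 8388608)) (≤-by _ (0≤u *≥ gap d≤128t +≥ #≥ 524288 *≥ (0≤L *≥ 0≤L *≥ (#≥ 2 *≥ gap regular₆ +≥ 0≤u *≥ gap 12≤k))
            +≥ #≥ 16777216 *≥ (gap 1≤L *≥ (0≤L *≥ 0≤L *≥ 0≤e)) +≥ #≥ 14680064 *≥ (0≤L *≥ 0≤L *≥ 0≤e)) (l₁ d u L k e))
        ; regular = subst (λ c → k * u ≤ (e + e) + c * u) (sym (ι≡ 100000000)) (≤-trans regular₆ (≤-by _ (#≥ 99999994 *≥ 0≤u) (l₂ e u)))
        ; large = subst (λ c → N ≤ c * (L * L) * u) (sym (ι≡ 8192)) (≤-trans N≤ (subst (λ z → # 8192 * (L * L) * m ≤ # 8192 * (L * L) * z) (sym u≡)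
            (*-monoˡ (#≥ 8192 *≥ (0≤L *≥ 0≤L)) (≤-by _ 0≤a′ (+-comm m a′))))) }
        where
        0≤L : 0ℚ ≤ L
        0≤L = ≤-trans 0≤1 1≤L
        12≤k : # 12 ≤ k
        12≤k = subst (_≤ k) (ι≡ 12) (ι-mono 12≤K)
        l₁ : ∀ d u L k e → d * u + (u * (# 128 * (# 128 * L * (# 16 * L * (k + k))) - d) + # 524288 * (L * L * (# 2 * (# 2 * e + # 6 * u - k * u) + u * (k - # 12)))
          + # 16777216 * ((L - 1ℚ) * (L * L * e)) + # 14680064 * (L * L * e)) ≡ # 8388608 * (L * L * L) * (e + e)
        l₁ = solve-∀ ℚ-ring
        l₂ : ∀ e u → # 2 * e + # 6 * u + # 99999994 * u ≡ (e + e) + # 100000000 * u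
        l₂ = solve-∀ ℚ-ring

-- From bipartite edge sets to subgraphs

opaque
  ∑-one : ∀ n → ∑ {n} (λ _ → 1ℚ) ≡ ι n
  ∑-one zero    = trans (∑-0 _) (sym ι0)
  ∑-one (suc n) = trans (∑-suc (λ _ → 1ℚ)) (trans (cong₂ _+_ (sym ι1) (∑-one n)) (sym (ι-+ 1 n)))

  ι-list-sum : ∀ {n} (f : Fin n → ℕ) → ι (sumᴸ (map f (allFin n))) ≡ ∑ (ι ∘ f)
  ι-list-sum {n} f = trans (cong (ι ∘ sumᴸ) (map-tabulate (λ i → i) f)) (go f)
    where
    go : ∀ {n} (f : Fin n → ℕ) → ι (sumᴸ (List.tabulate f)) ≡ ∑ (ι ∘ f)
    go {zero}  f = trans ι0 (sym (∑-0 (ι ∘ f)))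
    go {suc n} f = trans (ι-+ (f zero) _) (trans (cong (λ z → ι (f zero) + z) (go (f ∘ suc))) (sym (∑-suc (ι ∘ f))))

  ι-deg : ∀ {n} (G : Graph n) v → ι (deg G v) ≡ ∑ (λ u → ind (adj G v u))
  ι-deg G v = trans (ι-list-sum (λ u → if adj G v u then 1 else 0)) (∑-cong (λ u → ι-if (adj G v u)))
    where
    ι-if : ∀ b → ι (if b then 1 else 0) ≡ ind b
    ι-if true  = ι1
    ι-if false = ι0

  ι-degSum : ∀ {n} (G : Graph n) → ι (degSum G) ≡ ∑ (λ v → ∑ (λ u → ind (adj G v u)))
  ι-degSum G = trans (ι-list-sum (deg G)) (∑-cong (ι-deg G))

  avg-* : ∀ {k} (G : Graph (suc k)) → avgDeg G * ι (suc k) ≡ ι (degSum G)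
  avg-* {k} G = trans (cong (avgDeg G *_) (ι≡ (suc k))) (trans (toℚᵘ-injective (ℚᵘP.≃-trans (toℚᵘ-homo-* (avgDeg G) (# (suc k)))
    (ℚᵘP.≃-trans (ℚᵘP.*-cong (toℚᵘ-fromℚᵘ (ℚᵘ.mkℚᵘ (ℤ.+ degSum G) k)) (toℚᵘ-fromℚᵘ (ℚᵘ.mkℚᵘ (ℤ.+ suc k) 0)))
    (ℚᵘP.≃-trans (ℚᵘ.*≡* eq) (ℚᵘP.≃-sym (toℚᵘ-fromℚᵘ (ℚᵘ.mkℚᵘ (ℤ.+ degSum G) 0))))))) (sym (ι≡ (degSum G))))
    where
    eq : (ℤ.+ degSum G ℤ.* ℤ.+ suc k) ℤ.* ℤ.+ 1 ≡ ℤ.+ degSum G ℤ.* ℤ.+ suc (k ℕ.* 1 )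
    eq = trans (ℤP.*-identityʳ _) (cong (λ z → ℤ.+ degSum G ℤ.* ℤ.+ suc z) (sym (ℕP.*-identityʳ k)))

-- `reindex` takes the place of surjectivity onto `U`: counts and degree sums of the subgraph become
-- masked sums over `Fin n`.
record Enumeration {n} (U : Mask n) : Set where
  field
    size : ℕ
    pick : Fin size → Fin n
    pick-inj : Injective _≡_ _≡_ pick
    reindex : ∀ g → ∑ (g ∘ pick) ≡ ∑ (λ v → ind (U v) * g v)

enumerate : ∀ {n} (U : Mask n) → Enumeration U
enumerate {zero} U = record { size = 0 ; pick = λ () ; pick-inj = λ { {()} } ; reindex = λ g → trans (∑-0 _) (sym (∑-0 _)) }
enumerate {suc n} U = go (U zero) refl
  where
  open Enumeration (enumerate (U ∘ suc))
  go : ∀ b → U zero ≡ b → Enumeration U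
  go false h = record { size = size ; pick = suc ∘ pick ; pick-inj = λ eq → pick-inj (FinP.suc-injective eq)
    ; reindex = λ g → trans (reindex (g ∘ suc)) (trans (sym (+-identityˡ _)) (trans
        (cong (λ z → z + ∑ (λ v → ind (U (suc v)) * g (suc v))) (sym (trans (cong (λ v → ind v * g zero) h) (*-zeroˡ (g zero)))))
        (sym (∑-suc (λ v → ind (U v) * g v))))) }
  go true h = record { size = suc size ; pick = pick′ ; pick-inj = inj
    ; reindex = λ g → trans (∑-suc (g ∘ pick′)) (trans (cong₂ _+_
        (sym (trans (cong (λ v → ind v * g zero) h) (*-identityˡ (g zero)))) (reindex (g ∘ suc))) (sym (∑-suc (λ v → ind (U v) * g v)))) }
    where
    pick′ : Fin (suc size) → Fin (suc n)
    pick′ zero    = zero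
    pick′ (suc i) = suc (pick i)
    inj : Injective _≡_ _≡_ pick′
    inj {zero} {zero} _ = refl
    inj {suc i} {suc j} eq = cong suc (pick-inj (FinP.suc-injective eq))

module Realise {n} (G : Graph n) (k : ℚ) (W : Witness (adj G) k) where

  open Witness W
  open Enumeration (enumerate U)

  h̃ : Fin n → Fin n → Bool
  h̃ a b = H a b ∨ H b a

  row col : Fin n → ℚ
  row a = ∑ (λ b → ind (H a b))
  col b = ∑ (λ a → ind (H a b))

  opaque
    one-way : ∀ a b → H a b ≡ true → H b a ≡ false
    one-way a b h = go (H b a) refl
      where
      go : ∀ v → H b a ≡ v → H b a ≡ false
      go true h′ = contradiction (trans (sym (H-κ b a h′)) (H-κ̄ a b h)) λ ()
      go false h′ = h′

    ind-h̃ : ∀ a b → ind (h̃ a b) ≡ ind (H a b) + ind (H b a)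
    ind-h̃ a b = go (H a b) refl
      where
      go : ∀ v → H a b ≡ v → ind (H a b ∨ H b a) ≡ ind (H a b) + ind (H b a)
      go true h = trans (cong (λ v → ind (v ∨ H b a)) h) (sym (cong₂ (λ v w → ind v + ind w) h (one-way a b h)))
      go false h = trans (cong (λ v → ind (v ∨ H b a)) h) (trans (sym (+-identityˡ (ind (H b a)))) (cong (λ v → ind v + ind (H b a)) (sym h)))

    absorb : ∀ {c} {v w : Bool} → (v ≡ true → c ≡ true) → (w ≡ true → c ≡ true) → ind c * (ind v + ind w) ≡ ind v + ind w
    absorb {true} f g = *-identityˡ _
    absorb {false} {true} f g = contradiction (f refl) λ ()
    absorb {false} {false} {true} f g = contradiction (g refl) λ ()
    absorb {false} {false} {false} f g = refl

    degree-sum : ∀ a → ∑ (λ j → ind (h̃ a (pick j))) ≡ row a + col a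
    degree-sum a = trans (reindex (λ b → ind (h̃ a b))) (trans (∑-cong (λ b → trans (cong (ind (U b) *_) (ind-h̃ a b)) (absorb (H-U₂ a b) (H-U₁ b a))))
      (∑-+ (λ b → ind (H a b)) (λ b → ind (H b a))))

    total-degree : ∑ (λ i → ∑ (λ j → ind (h̃ (pick i) (pick j)))) ≡ e + e
    total-degree = trans (∑-cong (λ i → degree-sum (pick i))) (trans (reindex (λ a → row a + col a)) (trans
      (∑-cong (λ a → trans (cong (ind (U a) *_) (sym (∑-+ (λ b → ind (H a b)) (λ b → ind (H b a)))))
        (trans (sym (∑-* (ind (U a)) (λ b → ind (H a b) + ind (H b a)))) (trans (∑-cong (λ b → absorb (H-U₁ a b) (H-U₂ b a)))
          (∑-+ (λ b → ind (H a b)) (λ b → ind (H b a)))))))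
      (trans (∑-+ row col) (cong (λ z → e + z) (sym (∑-swap (λ a b → ind (H a b))))))))

    -- `κ` decides which of `row a` and `col a` is zero, so the cap is not doubled.
    degree≤ : ∀ a → row a + col a ≤ k
    degree≤ a = go (κ a) refl
      where
      off : ∀ v → (v ≡ true → ⊥) → ind v ≡ 0ℚ
      off true f = ⊥-elim (f refl)
      off false f = refl
      go : ∀ v → κ a ≡ v → row a + col a ≤ k
      go true h = subst (_≤ k) (sym (trans (cong (λ z → row a + z) (trans (∑-cong (λ b → off (H b a) (λ f → contradiction (trans (sym h) (H-κ̄ b a f)) λ ()))) (∑-zero n)))
        (+-identityʳ (row a)))) (row≤ a)
      go false h = subst (_≤ k) (sym (trans (cong (λ z → z + col a) (trans (∑-cong (λ b → off (H a b) (λ f → contradiction (trans (sym (H-κ a b f)) h) λ ()))) (∑-zero n)))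
        (+-identityˡ (col a)))) (col≤ a)

    size≡u : ι size ≡ u
    size≡u = trans (sym (∑-one size)) (trans (reindex (λ _ → 1ℚ)) (∑-cong (λ v → *-identityʳ (ind (U v)))))

    h̃-sym : ∀ a b → h̃ a b ≡ h̃ b a
    h̃-sym a b with H a b | H b a
    ... | true  | true  = refl
    ... | true  | false = refl
    ... | false | true  = refl
    ... | false | false = refl

    h̃-adj : ∀ a b → h̃ a b ≡ true → adj G a b ≡ true
    h̃-adj a b h = go (H a b) (H b a) refl refl h
      where
      go : ∀ v w → H a b ≡ v → H b a ≡ w → h̃ a b ≡ true → adj G a b ≡ true
      go true w eq eq′ _ = H-adj a b eq
      go false true eq eq′ _ = trans (adj-sym G a b) (H-adj b a eq′)
      go false false eq eq′ h = contradiction (trans (sym h) (cong₂ _∨_ eq eq′)) λ ()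

    h̃-irrefl : ∀ a → h̃ a a ≡ false
    h̃-irrefl a = go (h̃ a a) refl
      where
      go : ∀ v → h̃ a a ≡ v → h̃ a a ≡ false
      go true eq = contradiction (trans (sym (h̃-adj a a eq)) (irrefl G a)) λ ()
      go false eq = eq

  subgraph : Subgraph G size
  subgraph = record
    { graph = record { adj = λ i j → h̃ (pick i) (pick j) ; sym = λ i j → h̃-sym (pick i) (pick j) ; irrefl = λ i → h̃-irrefl (pick i) }
    ; emb = pick ; emb-inj = pick-inj ; edges = λ i j → h̃-adj (pick i) (pick j) }

  realise : ∃[ s ] (ι s ≡ u × Σ (Subgraph G s) (λ S → ι (degSum (graph S)) ≡ e + e × (∀ i → ι (deg (graph S) i) ≤ k)))
  realise = size , size≡u , subgraph , trans (ι-degSum (graph subgraph)) total-degree ,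
    λ i → ≤-trans (≤-reflexive (trans (ι-deg (graph subgraph) i) (degree-sum (pick i)))) (degree≤ (pick i))

-- The case of small minimum degree

-- In this range d / L³ is at most of order 1 / L. By `u≤4Le` the matching, taken on all vertices,
-- has average degree at least 1 / (2L), and its maximum degree 1 is within the additive error.
module MatchingCase {n} (adj : Fin n → Fin n → Bool) (adj-sym : ∀ i j → adj i j ≡ adj j i) (irrefl : ∀ i → adj i i ≡ false)
  (L d : ℚ) (1≤L : 1ℚ ≤ L) (1≤d : 1ℚ ≤ d)
  (d≤dg : ∀ v → d ≤ ∑ (λ u → ind (adj v u))) (dg≤ : ∀ v → ∑ (λ u → ind (adj v u)) ≤ L * d)
  (small : d ≤ # 12 * (ι 262144 * (L * L))) where

  private
    0≤L : 0ℚ ≤ L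
    0≤L = ≤-trans 0≤1 1≤L

    opaque
      half : HalfCut adj
      half = half-cut adj adj-sym irrefl

    module MC = HalfCut half

    opaque
      matching : Σ (CappedSubgraph MC.C 1ℚ) (λ M → ∑ (λ a → ∑ (λ b → ind (MC.C a b))) ≤ L * d * CappedSubgraph.e M)
      matching = large-matching MC.C (L * d) (1≤* 1≤L 1≤d) (λ a → ≤-trans (MC.row-C≤ a) (dg≤ a)) (λ b → ≤-trans (MC.col-C≤ b) (dg≤ b))

    module X = CappedSubgraph (proj₁ matching)

    W : Witness adj 1ℚ
    W = record
      { κ = MC.κ ; U = λ _ → true ; H = X.H
      ; H-adj = λ a b h → MC.C-adj a b (X.H⊆E a b h)
      ; H-κ = λ a b h → MC.C-κ a b (X.H⊆E a b h)
      ; H-κ̄ = λ a b h → MC.C-κ̄ a b (X.H⊆E a b h)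
      ; H-U₁ = λ _ _ _ → refl ; H-U₂ = λ _ _ _ → refl
      ; row≤ = X.row≤ ; col≤ = X.col≤ }

    open Witness W using (u; e)

    0≤u : 0ℚ ≤ u
    0≤u = ∑-nonneg {n} {λ _ → 1ℚ} (λ _ → 0≤1)

    0≤e : 0ℚ ≤ e
    0≤e = ∑-nonneg (λ a → ∑-nonneg (λ b → 0≤ind (X.H a b)))

    u≤4Le : u ≤ # 4 * (L * e)
    u≤4Le = *-cancelˡ {c = d} (0<1≤ 1≤d) (≤-by _ (gap (MC.many-edges d d≤dg) +≥ #≥ 4 *≥ gap (proj₂ matching)) (l d u (∑ (λ a → ∑ (λ b → ind (MC.C a b)))) L e))
      where
      l : ∀ d u c L e → d * u + ((# 4 * c - d * u) + # 4 * (L * d * e - c)) ≡ d * (# 4 * (L * e))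
      l = solve-∀ ℚ-ring

  opaque
    matching-case : Good adj L d
    matching-case = record
      { witness = W
      ; dense = subst (λ c → d * u ≤ c * (L * L * L) * (e + e)) (sym (ι≡ 8388608)) (≤-by _ (0≤u *≥ gap (subst (λ c → d ≤ # 12 * (c * (L * L))) (ι≡ 262144) small) +≥ #≥ 3145728 *≥ (0≤L *≥ 0≤L *≥ gap u≤4Le) +≥ #≥ 4194304 *≥ (0≤L *≥ (0≤L *≥ (0≤L *≥ 0≤e)))) (l₁ d u L e))
      ; regular = subst (λ c → 1ℚ * u ≤ (e + e) + c * u) (sym (ι≡ 100000000)) (≤-by _ (#≥ 2 *≥ 0≤e +≥ #≥ 99999999 *≥ 0≤u) (l₂ e u))
      ; large = subst (λ c → u ≤ c * (L * L) * u) (sym (ι≡ 8192)) (≤-by _ (gap (1≤* 1≤L 1≤L) *≥ 0≤u +≥ #≥ 8191 *≥ (0≤L *≥ 0≤L *≥ 0≤u)) (l₃ L u)) }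
      where
      l₁ : ∀ d u L e → d * u + (u * (# 12 * (# 262144 * (L * L)) - d) + # 3145728 * (L * L * (# 4 * (L * e) - u)) + # 4194304 * (L * (L * (L * e))))
        ≡ # 8388608 * (L * L * L) * (e + e)
      l₁ = solve-∀ ℚ-ring
      l₂ : ∀ e u → 1ℚ * u + (# 2 * e + # 99999999 * u) ≡ (e + e) + # 100000000 * u
      l₂ = solve-∀ ℚ-ring
      l₃ : ∀ L u → u + ((L * L - 1ℚ) * u + # 8191 * (L * L * u)) ≡ # 8192 * (L * L) * u
      l₃ = solve-∀ ℚ-ring

-- Choosing the integer parameters

m<[1+m/n]*n : ∀ m n .{{_ : ℕ.NonZero n}} → m ℕ.< suc (m DivMod./ n) ℕ.* n
m<[1+m/n]*n m n = ℕP.≤-<-trans (ℕP.≤-reflexive (DivMod.m≡m%n+[m/n]*n m n)) (ℕP.+-monoˡ-< (m DivMod./ n ℕ.* n) (DivMod.m%n<n m n))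

least : ∀ {n} (f : Fin (suc n) → ℕ) → ∃[ i ] (∀ j → f i ℕ.≤ f j)
least {zero}  f = zero , λ { zero → ℕP.≤-refl }
least {suc n} f with least (f ∘ suc)
... | i , h with ℕP.≤-total (f zero) (f (suc i))
...   | inj₁ le = zero , λ { zero → ℕP.≤-refl ; (suc j) → ℕP.≤-trans le (h j) }
...   | inj₂ le = suc i , λ { zero → le ; (suc j) → h j }

greatest : ∀ {n} (f : Fin (suc n) → ℕ) → ∃[ i ] (∀ j → f j ℕ.≤ f i)
greatest {zero}  f = zero , λ { zero → ℕP.≤-refl }
greatest {suc n} f with greatest (f ∘ suc)
... | i , h with ℕP.≤-total (f (suc i)) (f zero)
...   | inj₁ le = zero , λ { zero → ℕP.≤-refl ; (suc j) → ℕP.≤-trans (h j) le }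
...   | inj₂ le = suc i , λ { zero → le ; (suc j) → h j }

module Choice {n} (G : Graph (suc n)) (d₀ q : ℕ) (1≤d₀ : 1 ℕ.≤ d₀)
  (d₀≤ : ∀ v → d₀ ℕ.≤ deg G v) (≤Ld₀ : ∀ v → deg G v ℕ.≤ suc q ℕ.* d₀) where

  L : ℕ
  L = suc q

  d≤dg : ∀ v → ι d₀ ≤ ∑ (λ u → ind (adj G v u))
  d≤dg v = ≤-trans (ι-mono (d₀≤ v)) (≤-reflexive (ι-deg G v))

  dg≤ : ∀ v → ∑ (λ u → ind (adj G v u)) ≤ ι L * ι d₀
  dg≤ v = ≤-trans (≤-reflexive (sym (ι-deg G v))) (≤-trans (ι-mono (≤Ld₀ v)) (≤-reflexive (ι-* L d₀)))

  ι≥1 : ∀ {m} → 1 ℕ.≤ m → 1ℚ ≤ ι m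
  ι≥1 {m} h = subst (_≤ ι m) ι1 (ι-mono h)

  1≤L : 1ℚ ≤ ι L
  1≤L = ι≥1 (ℕ.s≤s ℕ.z≤n)

  opaque
    64t≡ : ∀ L k → # 64 * (# 128 * L * (# 16 * L * (k + k))) ≡ k * (ι 262144 * (L * L))
    64t≡ L k = trans (l L k) (cong (λ c → k * (c * (L * L))) (sym (ι≡ 262144)))
      where
      l : ∀ L k → # 64 * (# 128 * L * (# 16 * L * (k + k))) ≡ k * (# 262144 * (L * L))
      l = solve-∀ ℚ-ring

    128t≡ : ∀ L k → # 128 * (# 128 * L * (# 16 * L * (k + k))) ≡ k * (ι 262144 * (L * L)) + k * (ι 262144 * (L * L))
    128t≡ L k = trans (l L k) (cong (λ z → z + z) (64t≡ L k))
      where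
      l : ∀ L k → # 128 * (# 128 * L * (# 16 * L * (k + k))) ≡ # 64 * (# 128 * L * (# 16 * L * (k + k))) + # 64 * (# 128 * L * (# 16 * L * (k + k)))
      l = solve-∀ ℚ-ring

    -- Since 64t equals K M, the quotient `K` of `d₀` by `M` gives 64t ≤ d₀ ≤ 128t as soon as K ≥ 1.
    -- A quotient below 12 means d₀ < 12 M, the range of the matching.
    by-quotient : ∀ (M K : ℕ) → ι M ≡ ι 262144 * (ι L * ι L) → K ℕ.* M ℕ.≤ d₀ → d₀ ℕ.< suc K ℕ.* M → Good (adj G) (ι L) (ι d₀)
    by-quotient M K eq lo hi = go (12 ℕP.≤? K)
      where
      k : ℚ
      k = ι K
      kM : ι (K ℕ.* M) ≡ k * (ι 262144 * (ι L * ι L))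
      kM = trans (ι-* K M) (cong (k *_) eq)
      go : Dec (12 ℕ.≤ K) → Good (adj G) (ι L) (ι d₀)
      go (yes 12≤K) = DegreeGap.Spread.spread-case (adj G) (adj-sym G) (irrefl G) K 1≤K (ι L) (ι d₀) 1≤L d≤dg dg≤
          (≤-trans (≤-reflexive (trans (64t≡ (ι L) k) (sym kM))) (ι-mono lo))
          (≤-trans (ι-mono (ℕP.≤-trans (ℕP.<⇒≤ hi) (ℕP.+-monoˡ-≤ (K ℕ.* M) M≤KM)))
            (≤-reflexive (trans (ι-+ (K ℕ.* M) (K ℕ.* M)) (trans (cong (λ z → z + z) kM) (sym (128t≡ (ι L) k))))))
          12≤K
        where
        1≤K : 1 ℕ.≤ K
        1≤K = ℕP.≤-trans (ℕ.s≤s ℕ.z≤n) 12≤K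
        M≤KM : M ℕ.≤ K ℕ.* M
        M≤KM = ℕP.≤-trans (ℕP.≤-reflexive (sym (ℕP.*-identityˡ M))) (ℕP.*-monoˡ-≤ M 1≤K)
      go (no 12≰K) = MatchingCase.matching-case (adj G) (adj-sym G) (irrefl G) (ι L) (ι d₀) 1≤L (ι≥1 1≤d₀) d≤dg dg≤
          (≤-trans (ι-mono (ℕP.≤-trans (ℕP.<⇒≤ hi) (ℕP.*-monoˡ-≤ M (ℕP.≰⇒> 12≰K))))
            (≤-reflexive (trans (ι-* 12 M) (cong₂ _*_ (ι≡ 12) eq))))

    good : Good (adj G) (ι L) (ι d₀)
    good = go (262144 ℕ.* (L ℕ.* L)) refl (ℕP.m*n≢0 262144 (L ℕ.* L))
      where
      go : ∀ M → M ≡ 262144 ℕ.* (L ℕ.* L) → ℕ.NonZero M → Good (adj G) (ι L) (ι d₀)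
      go M eq nz = by-quotient M (DivMod._/_ d₀ M {{nz}})
        (trans (cong ι eq) (trans (ι-* 262144 (L ℕ.* L)) (cong (ι 262144 *_) (ι-* L L))))
        (DivMod.m/n*n≤m d₀ M {{nz}}) (m<[1+m/n]*n d₀ M {{nz}})

-- From integer parameters back to rational ones

1≤^ : ∀ {l} → 1ℚ ≤ l → ∀ e → 1ℚ ≤ l ^ℚ e
1≤^ 1≤l zero    = ≤-refl
1≤^ 1≤l (suc e) = 1≤* 1≤l (1≤^ 1≤l e)

*-mono : ∀ {a b c d} → 0ℚ ≤ c → 0ℚ ≤ b → a ≤ b → c ≤ d → a * c ≤ b * d
*-mono 0≤c 0≤b a≤b c≤d = ≤-trans (*-monoʳ 0≤c a≤b) (*-monoˡ 0≤b c≤d)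

-- The denominator is 2^26 = 8 · 2^23: replacing `L` by 2l costs a factor 8 in the cube of `dense`.
constant : ℚ
constant = recip (ι 67108864)

0<ι : ∀ n → 0ℚ < ι (suc n)
0<ι n = 0<1≤ (subst (_≤ ι (suc n)) ι1 (ι-mono {1} {suc n} (ℕ.s≤s ℕ.z≤n)))

opaque
  constant-inverse : ι 67108864 * constant ≡ 1ℚ
  constant-inverse = recip-inverse (0<ι 67108863)

  0<constant : 0ℚ < constant
  0<constant = *-cancelˡ-<-nonNeg (ι 67108864) {{nonNegative (0≤ι 67108864)}}
    (subst₂ _<_ (sym (*-zeroʳ (ι 67108864))) (sym constant-inverse) (positive⁻¹ 1ℚ))

  67108864-cube : ι 67108864 ≡ ι 8 * ι 8388608
  67108864-cube = ι-* 8 8388608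

  67108864-square : ι 67108864 ≡ ι 2048 * (ι 4 * ι 8192)
  67108864-square = trans (ι-* 2048 32768) (cong (ι 2048 *_) (ι-* 4 8192))

module Conclusion (l d d₀ L u e k x N : ℚ) (1≤l : 1ℚ ≤ l) (0≤d₀ : 0ℚ ≤ d₀) (0≤L : 0ℚ ≤ L) (0<u : 0ℚ < u) (0≤e : 0ℚ ≤ e)
  (d≤d₀ : d ≤ d₀) (L≤2l : L ≤ ι 2 * l) (average : x * u ≡ e + e)
  (dense : d₀ * u ≤ ι 8388608 * (L * L * L) * (e + e))
  (regular : k * u ≤ (e + e) + ι 100000000 * u)
  (large : N ≤ ι 8192 * (L * L) * u) where

  0≤l : 0ℚ ≤ l
  0≤l = ≤-trans 0≤1 1≤l

  0≤2l : 0ℚ ≤ ι 2 * l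
  0≤2l = 0≤ι 2 *≥ 0≤l

  opaque
    squares : L * L ≤ ι 4 * (l * l)
    squares = ≤-trans (*-mono 0≤L 0≤2l L≤2l L≤2l) (≤-reflexive (trans (r (ι 2) l) (cong (_* (l * l)) (sym (ι-* 2 2)))))
      where
      r : ∀ t l → t * l * (t * l) ≡ t * t * (l * l)
      r = solve-∀ ℚ-ring

    cubes : L * L * L ≤ ι 8 * (l ^ℚ 3)
    cubes = ≤-trans (*-mono 0≤L (0≤ι 4 *≥ (0≤l *≥ 0≤l)) squares L≤2l)
      (≤-reflexive (trans (r (ι 4) (ι 2) l) (cong (_* (l ^ℚ 3)) (sym (ι-* 4 2)))))
      where
      r : ∀ s t l → s * (l * l) * (t * l) ≡ s * t * (l * (l * (l * 1ℚ)))
      r = solve-∀ ℚ-ring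

    average-degree : constant * d ≤ x * (l ^ℚ 3)
    average-degree = *-cancelˡ {c = ι 67108864} (0<ι 67108863) (*-cancelˡ {c = u} 0<u
      (≤-trans (≤-reflexive (trans (r₁ u (ι 67108864) constant d) (trans (cong (λ z → z * (d * u)) constant-inverse) (*-identityˡ (d * u)))))
      (≤-trans (*-monoʳ (<⇒≤ 0<u) d≤d₀) (≤-trans dense (≤-trans (*-monoʳ (0≤e +≥ 0≤e) (*-monoˡ (0≤ι 8388608) cubes))
        (≤-reflexive (trans (r₂ (ι 8388608) (ι 8) (l ^ℚ 3) (e + e)) (trans (cong₂ (λ y z → y * (z * (l ^ℚ 3))) (sym 67108864-cube) (sym average))
          (r₃ (ι 67108864) x u (l ^ℚ 3))))))))))
      where
      r₁ : ∀ u c k d → u * (c * (k * d)) ≡ c * k * (d * u)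
      r₁ = solve-∀ ℚ-ring
      r₂ : ∀ a b c e → a * (b * c) * e ≡ b * a * (e * c)
      r₂ = solve-∀ ℚ-ring
      r₃ : ∀ a x u l → a * (x * u * l) ≡ u * (a * (x * l))
      r₃ = solve-∀ ℚ-ring

    maximum-degree : k ≤ x + ι 100000000
    maximum-degree = *-cancelˡ {c = u} 0<u (≤-trans (≤-reflexive (*-comm u k)) (≤-trans regular
      (≤-reflexive (trans (cong (λ z → z + ι 100000000 * u) (sym average)) (r x u (ι 100000000))))))
      where
      r : ∀ x u c → x * u + c * u ≡ u * (x + c)
      r = solve-∀ ℚ-ring

    -- After `large` and `squares` the factor left to absorb is 2048 l⁸, which is at least 1.
    size : constant * N ≤ u * (l ^ℚ 10)
    size = *-cancelˡ {c = ι 67108864} (0<ι 67108863)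
      (≤-trans (≤-reflexive (trans (sym (*-assoc (ι 67108864) constant N)) (trans (cong (_* N) constant-inverse) (*-identityˡ N))))
      (≤-trans large (≤-trans (*-monoʳ (<⇒≤ 0<u) (*-monoˡ (0≤ι 8192) squares))
        (≤-trans (≤-by _ (0≤4·8192 *≥ (<⇒≤ 0<u *≥ (0≤l *≥ 0≤l)) *≥ gap (1≤* (≤-trans (≤-reflexive (sym ι1)) (ι-mono {1} {2048} (ℕ.s≤s ℕ.z≤n))) (1≤^ 1≤l 8)))
            (r (ι 8192) (ι 4) (ι 2048) l u (l ^ℚ 8)))
          (≤-reflexive (cong (_* (u * (l ^ℚ 10))) (sym 67108864-square)))))))
      where
      0≤4·8192 : 0ℚ ≤ ι 4 * ι 8192
      0≤4·8192 = 0≤ι 4 *≥ 0≤ι 8192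
      r : ∀ a b c l u y → a * (b * (l * l)) * u + b * a * (u * (l * l)) * (c * y - 1ℚ) ≡ c * (b * a) * (u * (l * (l * y)))
      r = solve-∀ ℚ-ring

theorem2p1 : Σ ℚ (λ c → (0ℚ < c) ×
    ((l d : ℚ) → 1ℚ ≤ l → 0ℚ < d →
    (n : ℕ) (G : Graph (suc n)) →
    (∀ v → (d ≤ ℕ→ℚ (deg G v)) × (ℕ→ℚ (deg G v) ≤ l * d)) →
    Σ ℕ (λ k → Σ (Subgraph G (suc k)) (λ H →
    (c * d ≤ avgDeg (graph H) * (l ^ℚ 3)) ×
    (∀ v → ℕ→ℚ (deg (graph H) v) ≤ avgDeg (graph H) + ℕ→ℚ 100000000) ×
    (c * ℕ→ℚ (suc n) ≤ ℕ→ℚ (suc k) * (l ^ℚ 10))))))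
theorem2p1 = constant , 0<constant , main
  where
  main : (l d : ℚ) → 1ℚ ≤ l → 0ℚ < d → (n : ℕ) (G : Graph (suc n)) →
    (∀ v → (d ≤ ℕ→ℚ (deg G v)) × (ℕ→ℚ (deg G v) ≤ l * d)) →
    Σ ℕ (λ k → Σ (Subgraph G (suc k)) (λ H →
    (constant * d ≤ avgDeg (graph H) * (l ^ℚ 3)) ×
    (∀ v → ℕ→ℚ (deg (graph H) v) ≤ avgDeg (graph H) + ℕ→ℚ 100000000) ×
    (constant * ℕ→ℚ (suc n) ≤ ℕ→ℚ (suc k) * (l ^ℚ 10))))
  main l d 1≤l 0<d n G bounds = build (proj₁ R) (proj₁ (proj₂ R)) (proj₂ (proj₂ R))
    where
    v₀ v₁ : Fin (suc n)
    v₀ = proj₁ (least (deg G))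
    v₁ = proj₁ (greatest (deg G))

    -- Minimum and maximum degree replace `d` and `l * d`, since the construction works with
    -- integers; `d₀` is at least 1 even when `d` is tiny.
    d₀ Δ : ℕ
    d₀ = deg G v₀
    Δ = deg G v₁

    d≤d₀ : d ≤ ι d₀
    d≤d₀ = subst (d ≤_) (sym (ι≡ d₀)) (proj₁ (bounds v₀))

    1≤d₀ : 1 ℕ.≤ d₀
    1≤d₀ = ℕP.n≢0⇒n>0 (λ eq → <-irrefl refl (<-≤-trans 0<d (≤-trans d≤d₀ (≤-reflexive (trans (cong ι eq) ι0)))))

    instance
      d₀≢0 : ℕ.NonZero d₀
      d₀≢0 = ℕ.>-nonZero 1≤d₀

    q : ℕ
    q = Δ DivMod./ d₀

    Δ≤Ld₀ : ∀ v → deg G v ℕ.≤ suc q ℕ.* d₀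
    Δ≤Ld₀ v = ℕP.≤-trans (proj₂ (greatest (deg G)) v) (ℕP.<⇒≤ (m<[1+m/n]*n Δ d₀))

    -- The rounding costs a factor 2: (q + 1) d₀ ≤ d₀ + Δ ≤ 2Δ, and Δ ≤ l d ≤ l d₀.
    L≤2l : ι (suc q) ≤ ι 2 * l
    L≤2l = *-cancelˡ {c = ι d₀} (<-≤-trans 0<d d≤d₀) (≤-trans (≤-reflexive (trans (*-comm (ι d₀) (ι (suc q))) (sym (ι-* (suc q) d₀))))
      (≤-trans (ι-mono (ℕP.+-mono-≤ (proj₂ (least (deg G)) v₁) (ℕP.≤-trans (DivMod.m/n*n≤m Δ d₀) (ℕP.≤-reflexive (sym (ℕP.+-identityʳ Δ))))))
      (≤-trans (≤-reflexive (ι-* 2 Δ)) (≤-trans (*-monoˡ (0≤ι 2) (≤-trans (≤-trans (≤-reflexive (ι≡ Δ)) (proj₂ (bounds v₁))) (*-monoˡ (≤-trans 0≤1 1≤l) d≤d₀)))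
        (≤-reflexive (r (ι 2) l (ι d₀)))))))
      where
      r : ∀ t l d → t * (l * d) ≡ d * (t * l)
      r = solve-∀ ℚ-ring

    module B = Good (Choice.good G d₀ q 1≤d₀ (proj₂ (least (deg G))) Δ≤Ld₀)

    R : ∃[ s ] (ι s ≡ B.u × Σ (Subgraph G s) (λ S → ι (degSum (graph S)) ≡ B.e + B.e × (∀ i → ι (deg (graph S) i) ≤ B.k)))
    R = Realise.realise G B.k B.witness

    build : ∀ s → ι s ≡ B.u → Σ (Subgraph G s) (λ S → ι (degSum (graph S)) ≡ B.e + B.e × (∀ i → ι (deg (graph S) i) ≤ B.k)) →
      Σ ℕ (λ k → Σ (Subgraph G (suc k)) (λ H →
      (constant * d ≤ avgDeg (graph H) * (l ^ℚ 3)) ×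
      (∀ v → ℕ→ℚ (deg (graph H) v) ≤ avgDeg (graph H) + ℕ→ℚ 100000000) ×
      (constant * ℕ→ℚ (suc n) ≤ ℕ→ℚ (suc k) * (l ^ℚ 10))))
    -- An empty subgraph would contradict `large`, since `G` has a vertex.
    build zero eq _ = contradiction (<-≤-trans (0<ι n) (≤-trans (≤-reflexive (sym (∑-one (suc n)))) (≤-trans B.large (≤-reflexive
      (trans (cong (ι 8192 * (ι (suc q) * ι (suc q)) *_) (trans (sym eq) ι0)) (*-zeroʳ (ι 8192 * (ι (suc q) * ι (suc q))))))))) (<-irrefl refl)
    build (suc k) eq (S , total , degrees) = k , S , C.average-degree ,
      (λ v → subst₂ (λ y z → y ≤ avgDeg (graph S) + z) (ι≡ (deg (graph S) v)) (ι≡ 100000000) (≤-trans (degrees v) C.maximum-degree)) ,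
      subst₂ (λ y z → constant * y ≤ z * (l ^ℚ 10)) (trans (∑-one (suc n)) (ι≡ (suc n))) (trans (sym eq) (ι≡ (suc k))) C.size
      where
      module C = Conclusion l d (ι d₀) (ι (suc q)) B.u B.e B.k (avgDeg (graph S)) (∑ {suc n} (λ _ → 1ℚ)) 1≤l (0≤ι d₀) (0≤ι (suc q))
        (subst (0ℚ <_) eq (0<ι k)) (∑-nonneg (λ a → ∑-nonneg (λ b → 0≤ind (B.H a b)))) d≤d₀ L≤2l
        (trans (cong (avgDeg (graph S) *_) (sym eq)) (trans (avg-* (graph S)) total)) B.dense B.regular B.large
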